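{- Let $a,b,c>1$ be integers with $\gcd(a,b)>1$, not all three powers of $2$. Suppose the equation $a^x+b^y=c^z$ has two solutions $(x_1,y_1,z_1)$ and $(x_2,y_2,z_2)$ that do not correspond to each other, and that the nine-tuple $(a,b,c,x_1,y_1,z_1,x_2,y_2,z_2)$ is not in any of the infinite families (i), (ii), (iii), (iv). Then $$a=g^{\alpha_g}a_1,\quad b=g^{\beta_g}b_1,\quad c=g^{\gamma_g}c_1$$ for some positive integers $g,\alpha_g,\beta_g,\gamma_g,a_1,b_1,c_1$ with $\gcd(g,a_1b_1c_1)=1$ and $\gcd(a_1,b_1)=1$; one of the two solutions is Type A for $g$ and the other is Type B for $g$; and the equation has no solutions $(x,y,z)$ other than these two (as ordered triples).
   Context: Equation: $a^x+b^y=c^z$ in positive integers $x,y,z$. A solution $(x,y,z)$ for $(a,b,c)$ corresponds to a solution $(X,Y,Z)$ for $(A,B,C)$ if $\{a^x,b^y\}=\{A^X,B^Y\}$. Types: for a prime $p$ dividing all of $a,b,c$, let $p^{\alpha_p}\parallel a$, $p^{\beta_p}\parallel b$, $p^{\gamma_p}\parallel c$. A solution $(x,y,z)$ is Type A for $p$ if $\alpha_p x>\beta_p y=\gamma_p z$, and Type B for $p$ if $\beta_p y>\alpha_p x=\gamma_p z$. For an integer $g>1$ all of whose prime factors divide $a,b,c$, a solution is Type A (resp. Type B) for $g$ if it is Type A (resp. Type B) for every prime dividing $g$. Infinite families (parameters are integers; allowable choices satisfy the constraints with all entries positive integers): (i) $(a,b,c)=(2,2^u(2^{h-1}-1),2^u(2^{h-1}+1))$,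 $(x_1,y_1,z_1)=(u+1,1,1)$, $(x_2,y_2,z_2)=(2u+h+1,2,2)$, $u>0$, $h>1$. (ii) $(a,b,c)=(2\cdot3^t,3,3)$, $(x_1,y_1,z_1)=(1,t,t+1)$, $(x_2,y_2,z_2)=(3,3t,3t+2)$, $t>0$. (iii) $(a,b,c)=(g^j,g^{ju}d,g^{ju}(d+1))$, $(x_1,y_1,z_1)=(u,1,1)$, $(x_2,y_2,z_2)=(ku+\frac wj,k,k)$, $j,u,d>0$, $g>1$ odd, $(d+1)^k-d^k=g^w$, $w>0$, $k>1$. (iv) $(a,b,c)=(2^ig^j,2^{iu-1}g^{ju}d,2^{iu-1}g^{ju}(d+2))$, $(x_1,y_1,z_1)=(u,1,1)$, $(x_2,y_2,z_2)=(ku+\frac wj,k,k)$, $i,j,u>0$, $d>0$ odd, $g>1$ odd, $g^w$ the greatest odd divisor of $(d+2)^k-d^k$, $w>0$, $k>0$ even, $k-v=h-\frac{iw}{j}$ where $2^h\parallel 2d+2$, $2^v\parallel k$. For a family let $F$ be the set of nine-tuples $(a,b,c,x_1,y_1,z_1,x_2,y_2,z_2)$ from allowable parameter choices. A nine-tuple $(a,b,c,x_1,y_1,z_1,x_2,y_2,z_2)$, with $(x_1,y_1,z_1)$, $(x_2,y_2,z_2)$ distinct solutions for $(a,b,c)$, is in the family if some $(A,B,C,X_1,Y_1,Z_1,X_2,Y_2,Z_2)\in F$ has each of its solutions $(X_1,Y_1,Z_1)$, $(X_2,Y_2,Z_2)$ for $(A,B,C)$ corresponding to one of $(x_1,y_1,z_1)$,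 $(x_2,y_2,z_2)$. -}

module Defs where

open import Data.Nat using (ℕ; zero; suc; _+_; _*_; _∸_; _^_; _≤_; _<_)
open import Data.Nat.Divisibility using (_∣_)
open import Data.Nat.Primality using (Prime)
open import Data.Nat.GCD using (gcd)
open import Data.Product using (Σ; ∃; ∃-syntax; _×_; _,_)
open import Data.Sum using (_⊎_)
open import Relation.Nullary using (¬_)
open import Relation.Binary.PropositionalEquality using (_≡_)

_^_∥_ : ℕ → ℕ → ℕ → Set
p ^ k ∥ n = (p ^ k ∣ n) × ¬ (p ^ suc k ∣ n)

Odd : ℕ → Set
Odd n = ¬ (2 ∣ n)

IsPowerOf2 : ℕ → Set
IsPowerOf2 n = ∃[ k ] n ≡ 2 ^ k

GreatestOddDivisor : ℕ → ℕ → Set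
GreatestOddDivisor n m = Odd m × (m ∣ n) × (∀ m′ → Odd m′ → m′ ∣ n → m′ ≤ m)

Sol : ℕ → ℕ → ℕ → ℕ → ℕ → ℕ → Set
Sol a b c x y z = (0 < x) × (0 < y) × (0 < z) × (a ^ x + b ^ y ≡ c ^ z)

Corr : ℕ → ℕ → ℕ → ℕ → ℕ → ℕ → ℕ → ℕ → Set
Corr a b x y A B X Y =
  ((a ^ x ≡ A ^ X) × (b ^ y ≡ B ^ Y)) ⊎ ((a ^ x ≡ B ^ Y) × (b ^ y ≡ A ^ X))

TypeAp : ℕ → ℕ → ℕ → ℕ → ℕ → ℕ → ℕ → Set
TypeAp p a b c x y z = (p ∣ a) × (p ∣ b) × (p ∣ c) ×
  (∃[ α ] ∃[ β ] ∃[ γ ] (p ^ α ∥ a) × (p ^ β ∥ b) × (p ^ γ ∥ c) ×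
     (β * y < α * x) × (β * y ≡ γ * z))

TypeBp : ℕ → ℕ → ℕ → ℕ → ℕ → ℕ → ℕ → Set
TypeBp p a b c x y z = (p ∣ a) × (p ∣ b) × (p ∣ c) ×
  (∃[ α ] ∃[ β ] ∃[ γ ] (p ^ α ∥ a) × (p ^ β ∥ b) × (p ^ γ ∥ c) ×
     (α * x < β * y) × (α * x ≡ γ * z))

TypeAg : ℕ → ℕ → ℕ → ℕ → ℕ → ℕ → ℕ → Set
TypeAg g a b c x y z = (1 < g) × (∀ p → Prime p → p ∣ g → TypeAp p a b c x y z)

TypeBg : ℕ → ℕ → ℕ → ℕ → ℕ → ℕ → ℕ → Set
TypeBg g a b c x y z = (1 < g) × (∀ p → Prime p → p ∣ g → TypeBp p a b c x y z)

NineSet : Set₁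
NineSet = ℕ → ℕ → ℕ → ℕ → ℕ → ℕ → ℕ → ℕ → ℕ → Set

F₁ : NineSet
F₁ A B C X₁ Y₁ Z₁ X₂ Y₂ Z₂ = ∃[ u ] ∃[ h ] (0 < u) × (1 < h) ×
  (A ≡ 2) × (B ≡ 2 ^ u * (2 ^ (h ∸ 1) ∸ 1)) × (C ≡ 2 ^ u * (2 ^ (h ∸ 1) + 1)) ×
  (X₁ ≡ u + 1) × (Y₁ ≡ 1) × (Z₁ ≡ 1) ×
  (X₂ ≡ 2 * u + h + 1) × (Y₂ ≡ 2) × (Z₂ ≡ 2)

F₂ : NineSet
F₂ A B C X₁ Y₁ Z₁ X₂ Y₂ Z₂ = ∃[ t ] (0 < t) ×
  (A ≡ 2 * 3 ^ t) × (B ≡ 3) × (C ≡ 3) ×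
  (X₁ ≡ 1) × (Y₁ ≡ t) × (Z₁ ≡ t + 1) ×
  (X₂ ≡ 3) × (Y₂ ≡ 3 * t) × (Z₂ ≡ 3 * t + 2)

-- (iii); X₂ = k u + w / j is encoded as j * X₂ = j * k * u + w (X₂ a positive integer)
F₃ : NineSet
F₃ A B C X₁ Y₁ Z₁ X₂ Y₂ Z₂ = ∃[ g ] ∃[ j ] ∃[ u ] ∃[ d ] ∃[ k ] ∃[ w ]
  (0 < j) × (0 < u) × (0 < d) × (1 < g) × Odd g ×
  (d ^ k + g ^ w ≡ (d + 1) ^ k) × (0 < w) × (1 < k) ×
  (A ≡ g ^ j) × (B ≡ g ^ (j * u) * d) × (C ≡ g ^ (j * u) * (d + 1)) ×
  (X₁ ≡ u) × (Y₁ ≡ 1) × (Z₁ ≡ 1) ×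
  (j * X₂ ≡ j * (k * u) + w) × (Y₂ ≡ k) × (Z₂ ≡ k)

-- (iv); X₂ = k u + w / j encoded as j * X₂ = j * k * u + w,
-- and k - v = h - i w / j encoded as j * k + i * w = j * h + j * v
F₄ : NineSet
F₄ A B C X₁ Y₁ Z₁ X₂ Y₂ Z₂ = ∃[ g ] ∃[ i ] ∃[ j ] ∃[ u ] ∃[ d ] ∃[ k ] ∃[ w ] ∃[ h ] ∃[ v ]
  (0 < i) × (0 < j) × (0 < u) × (0 < d) × Odd d × (1 < g) × Odd g ×
  GreatestOddDivisor ((d + 2) ^ k ∸ d ^ k) (g ^ w) × (0 < w) ×
  (0 < k) × (2 ∣ k) ×
  (2 ^ h ∥ (2 * d + 2)) × (2 ^ v ∥ k) × (j * k + i * w ≡ j * h + j * v) ×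
  (A ≡ 2 ^ i * g ^ j) ×
  (B ≡ 2 ^ (i * u ∸ 1) * g ^ (j * u) * d) ×
  (C ≡ 2 ^ (i * u ∸ 1) * g ^ (j * u) * (d + 2)) ×
  (X₁ ≡ u) × (Y₁ ≡ 1) × (Z₁ ≡ 1) ×
  (j * X₂ ≡ j * (k * u) + w) × (Y₂ ≡ k) × (Z₂ ≡ k)

InFamily : NineSet → NineSet
InFamily F a b c x₁ y₁ z₁ x₂ y₂ z₂ =
  ∃[ A ] ∃[ B ] ∃[ C ] ∃[ X₁ ] ∃[ Y₁ ] ∃[ Z₁ ] ∃[ X₂ ] ∃[ Y₂ ] ∃[ Z₂ ]
    F A B C X₁ Y₁ Z₁ X₂ Y₂ Z₂ ×
    (Corr A B X₁ Y₁ a b x₁ y₁ ⊎ Corr A B X₁ Y₁ a b x₂ y₂) ×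
    (Corr A B X₂ Y₂ a b x₁ y₁ ⊎ Corr A B X₂ Y₂ a b x₂ y₂)

{-# OPTIONS --safe #-}
module Submission where

-- For a prime p dividing a and b, the least of the p-adic valuations of a^x, b^y, c^z is attained at least twice.
-- Comparing sizes of the p-free parts shows that a solution with βy = γz minimal (Type A) excludes one with αx = βy minimal,
-- so either two solutions have opposite types A and B at p, or two of their exponents are proportional.
-- In the proportional case put B = b^Y, C = c^Z: then C^i − B^i and C^j − B^j, with i < j coprime, are powers of a.
-- The primes of (C^i − B^i)/(C − B) would divide both i and j, so i = 1, and lifting the exponent bounds the coprime part
-- of C − B by 2, which gives families (i), (iii), (iv); proportional x and y lead in the same way to family (ii).
-- Outside the families all common primes therefore have the same opposite types, which makes (α, β, γ) proportional
-- and yields g. A third solution is proportional to one of the two; the same analysis, applied to the other one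
-- as well, leaves only exponential equations such as 2^k − 1 = a^e, settled by congruences and by lifting.

open import Defs
open import Data.Nat using (s≤s⁻¹; ℕ; zero; suc; _+_; _*_; _∸_; _^_; _≤_; _<_; _≟_; z≤n; s≤s; >-nonZero)
open import Data.Nat.Coprimality using (Coprime; coprime-divisor; coprime-Bézout; coprime⇒gcd≡1; gcd≡1⇒coprime) renaming (sym to coprime-sym)
open import Data.Nat.Divisibility
open import Data.Nat.DivMod using (_%_; _/_; m%n<n; m≡m%n+[m/n]*n)
open import Data.Nat.GCD using (gcd; gcd[m,n]∣m; gcd[m,n]∣n; gcd-greatest; gcd-comm; module Bézout)
open import Data.Nat.Induction using (<-rec)
open import Data.Nat.Primality using (Prime; prime[2]; prime?; ¬prime[1]; prime⇒nonZero; prime⇒irreducible; euclidsLemma)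
open import Data.Nat.Primality.Factorisation using (factorise)
open import Data.Nat.Properties
open import Data.Nat.Tactic.RingSolver using (solve-∀)
open import Data.Empty using (⊥; ⊥-elim)
open import Data.List using ([]; _∷_)
open import Data.List.Relation.Unary.All using (_∷_)
open import Data.Product using (Σ; ∃-syntax; _×_; _,_; proj₁; proj₂)
open import Data.Sum using (_⊎_; inj₁; inj₂) renaming (swap to swap-⊎; map to map-⊎)
open import Function using (_∘_; case_of_)
open import Relation.Binary.Definitions using (tri<; tri≈; tri>)
open import Relation.Nullary using (¬_; Dec; yes; no; contradiction)
open import Relation.Nullary.Decidable using (toWitness; toWitnessFalse)
open import Relation.Binary.PropositionalEquality using (_≡_; _≢_; refl; sym; trans; cong; cong₂; subst; subst₂; module ≡-Reasoning)

-- Powers, primes and valuations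

-- Lifting serves mostly as a size bound: a number whose primes all lift divides `geom x y k` only
-- if it divides `k`, while the numbers in question grow exponentially with `k`. The obstacle is the
-- prime 2, which lifts only over a difference divisible by 4. This is why `D = 2` survives next to
-- `D = 1`, and why even exponents are treated through squares, whose difference is divisible by 4.
-- The equation is symmetric in `a` and `b` and in the two solutions, but each family lists its
-- smaller solution first; statements are proved in one arrangement and carried to the others by
-- swapping. For a third solution the decisive fact is that the smaller member of a proportional
-- pair has equal valuations in all three terms at every odd common prime, against the strict
-- inequality in Types A and B. Only a power of 2 in the role of `a` escapes this, and there a Type
-- B solution reduces to `1 + 2^f b^y = c^z` with `b`, `c` odd.

^-pos : ∀ {m} k → 0 < m → 0 < m ^ k
^-pos {m} k 0<m = m^n>0 m {{>-nonZero 0<m}} k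

*-pos : ∀ {m n} → 0 < m → 0 < n → 0 < m * n
*-pos = *-mono-<

*-pos⁻ˡ : ∀ m n → 0 < m * n → 0 < m
*-pos⁻ˡ (suc m) n _ = s≤s z≤n

*-pos⁻ʳ : ∀ m n → 0 < m * n → 0 < n
*-pos⁻ʳ m n p = *-pos⁻ˡ n m (subst (0 <_) (*-comm m n) p)

pos≢0 : ∀ {n} → 0 < n → n ≢ 0
pos≢0 0<n refl = <-irrefl refl 0<n

*-cancelˡ : ∀ {m} {n o} → 0 < m → m * n ≡ m * o → n ≡ o
*-cancelˡ {m} {n} {o} 0<m = *-cancelˡ-≡ n o m {{>-nonZero 0<m}}

^-*-distrib : ∀ m n k → (m * n) ^ k ≡ m ^ k * n ^ k
^-*-distrib m n zero    = refl
^-*-distrib m n (suc k) = trans (cong (m * n *_) (^-*-distrib m n k)) (interchange m n (m ^ k) (n ^ k))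
  where
  interchange : ∀ a b c d → a * b * (c * d) ≡ a * c * (b * d)
  interchange = solve-∀

^-^-comm : ∀ m i j → (m ^ i) ^ j ≡ (m ^ j) ^ i
^-^-comm m i j = trans (^-*-assoc m i j) (trans (cong (m ^_) (*-comm i j)) (sym (^-*-assoc m j i)))

^-cancelˡ-< : ∀ k {m n} → m ^ k < n ^ k → m < n
^-cancelˡ-< k {m} {n} lt = ≰⇒> λ n≤m → <⇒≱ lt (^-monoˡ-≤ k n≤m)

^-injˡ : ∀ k {m n} → 0 < k → m ^ k ≡ n ^ k → m ≡ n
^-injˡ k {m} {n} 0<k eq with <-cmp m n
... | tri≈ _ m≡n _ = m≡n
... | tri< m<n _ _ = contradiction eq (<⇒≢ (^-monoˡ-< k {{>-nonZero 0<k}} m<n))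
... | tri> _ _ n<m = contradiction (sym eq) (<⇒≢ (^-monoˡ-< k {{>-nonZero 0<k}} n<m))

^-cancelʳ-< : ∀ {m} i j → 0 < m → m ^ i < m ^ j → i < j
^-cancelʳ-< {m} i j 0<m lt = ≰⇒> λ j≤i → <⇒≱ lt (^-monoʳ-≤ m {{>-nonZero 0<m}} j≤i)

^-injʳ : ∀ {m} i j → 1 < m → m ^ i ≡ m ^ j → i ≡ j
^-injʳ {m} i j 1<m eq with <-cmp i j
... | tri≈ _ i≡j _ = i≡j
... | tri< i<j _ _ = contradiction eq (<⇒≢ (^-monoʳ-< m 1<m i<j))
... | tri> _ _ j<i = contradiction (sym eq) (<⇒≢ (^-monoʳ-< m 1<m j<i))

1<^ : ∀ {m} k → 1 < m → 0 < k → 1 < m ^ k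
1<^ {m} k 1<m 0<k = ^-monoʳ-< m 1<m 0<k

m≤m^k : ∀ m k → 0 < k → m ≤ m ^ k
m≤m^k zero    k       _ = z≤n
m≤m^k (suc m) (suc k) _ = m≤m*n (suc m) (suc m ^ k) {{>-nonZero (^-pos k (s≤s z≤n))}}

^≡1⇒≡1 : ∀ m k → 0 < k → m ^ k ≡ 1 → m ≡ 1
^≡1⇒≡1 m k 0<k eq with m^n≡1⇒n≡0∨m≡1 m k eq
... | inj₁ k≡0 = contradiction k≡0 (pos≢0 0<k)
... | inj₂ m≡1 = m≡1

k<m^k : ∀ {m} k → 1 < m → k < m ^ k
k<m^k         zero    _   = s≤s z≤n
k<m^k {m} (suc k) 1<m = ≤-<-trans (k<m^k k 1<m) (^-monoʳ-< m 1<m (n<1+n k))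

<⇒∃+ : ∀ {m n} → m < n → ∃[ d ] (0 < d × n ≡ m + d)
<⇒∃+ {m} {n} m<n = n ∸ m , m<n⇒0<n∸m m<n , sym (m+[n∸m]≡n (<⇒≤ m<n))

∣⇒∃* : ∀ {m n} → m ∣ n → ∃[ q ] n ≡ m * q
∣⇒∃* {m} (divides q eq) = q , trans eq (*-comm q m)

∣-self^ : ∀ {d m} k → 0 < k → d ∣ m → d ∣ m ^ k
∣-self^ {m = m} (suc k) _ d∣m = ∣m⇒∣m*n (m ^ k) d∣m

^-mono-∣ : ∀ {m n} k → m ∣ n → m ^ k ∣ n ^ k
^-mono-∣ zero    _   = ∣-refl
^-mono-∣ (suc k) m∣n = *-pres-∣ m∣n (^-mono-∣ k m∣n)

1<prime : ∀ {p} → Prime p → 1 < p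
1<prime {p} pp with p | pp
... | 0           | pr = contradiction (prime⇒nonZero pr) λ ()
... | 1           | pr = contradiction pr ¬prime[1]
... | suc (suc _) | _  = s≤s (s≤s z≤n)

0<prime : ∀ {p} → Prime p → 0 < p
0<prime pp = <-trans (s≤s z≤n) (1<prime pp)

∤1 : ∀ {p} → Prime p → ¬ p ∣ 1
∤1 pp p∣1 = <⇒≢ (1<prime pp) (sym (∣1⇒≡1 p∣1))

primeDivisor : ∀ {n} → 1 < n → ∃[ p ] (Prime p × p ∣ n)
primeDivisor {n} 1<n with factorise n {{>-nonZero (<-trans (s≤s z≤n) 1<n)}}
... | record { factors = [] ; isFactorisation = eq } = contradiction eq (<⇒≢ 1<n ∘ sym)
... | record { factors = p ∷ ps ; isFactorisation = eq ; factorsPrime = pp ∷ _ } =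
      p , pp , subst (p ∣_) (sym eq) (m∣m*n _)

noPrimeDivisor⇒1 : ∀ {n} → 0 < n → (∀ p → Prime p → ¬ p ∣ n) → n ≡ 1
noPrimeDivisor⇒1 {suc zero}    _ _  = refl
noPrimeDivisor⇒1 {suc (suc n)} _ np with primeDivisor {suc (suc n)} (s≤s (s≤s z≤n))
... | p , pp , p∣n = ⊥-elim (np p pp p∣n)

prime∣^ : ∀ {p m} k → Prime p → p ∣ m ^ k → p ∣ m
prime∣^         zero    pp p∣1 = ⊥-elim (∤1 pp p∣1)
prime∣^ {m = m} (suc k) pp p∣  with euclidsLemma m (m ^ k) pp p∣
... | inj₁ h = h
... | inj₂ h = prime∣^ k pp h

∤-* : ∀ {p m n} → Prime p → ¬ p ∣ m → ¬ p ∣ n → ¬ p ∣ m * n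
∤-* {m = m} {n} pp p∤m p∤n p∣ with euclidsLemma m n pp p∣
... | inj₁ h = p∤m h
... | inj₂ h = p∤n h

∤-^ : ∀ {p m} k → Prime p → ¬ p ∣ m → ¬ p ∣ m ^ k
∤-^ k pp p∤m = p∤m ∘ prime∣^ k pp

prime∣prime : ∀ {p q} → Prime p → Prime q → p ∣ q → p ≡ q
prime∣prime pp pq p∣q with prime⇒irreducible pq p∣q
... | inj₁ p≡1 = contradiction (sym p≡1) (<⇒≢ (1<prime pp))
... | inj₂ p≡q = p≡q

prime∣2 : ∀ {p} → Prime p → p ∣ 2 → p ≡ 2
prime∣2 pp = prime∣prime pp prime[2]

coprimeFromPrimes : ∀ {m n} → 0 < m → (∀ p → Prime p → p ∣ m → ¬ p ∣ n) → Coprime m n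
coprimeFromPrimes {m} 0<m h {d} (d∣m , d∣n) = noPrimeDivisor⇒1 0<d
  λ p pp p∣d → h p pp (∣-trans p∣d d∣m) (∣-trans p∣d d∣n)
  where
  0<d : 0 < d
  0<d = n≢0⇒n>0 λ { refl → pos≢0 0<m (0∣⇒≡0 d∣m) }

coprime-∤ : ∀ {p m n} → Prime p → Coprime m n → p ∣ m → ¬ p ∣ n
coprime-∤ pp cop p∣m p∣n = <⇒≢ (1<prime pp) (sym (cop (p∣m , p∣n)))

coprime-^ : ∀ {m n} i j → 0 < m → Coprime m n → Coprime (m ^ i) (n ^ j)
coprime-^ i j 0<m cop = coprimeFromPrimes (^-pos i 0<m)
  λ p pp p∣m p∣n → coprime-∤ pp cop (prime∣^ i pp p∣m) (prime∣^ j pp p∣n)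

gcdSplit : ∀ m n → 0 < m → ∃[ g ] ∃[ m₀ ] ∃[ n₀ ] (0 < g × m ≡ g * m₀ × n ≡ g * n₀ × Coprime m₀ n₀)
gcdSplit m n 0<m with ∣⇒∃* (gcd[m,n]∣m m n) | ∣⇒∃* (gcd[m,n]∣n m n)
... | m₀ , eqm | n₀ , eqn = g , m₀ , n₀ , 0<g , eqm , eqn , cop
  where
  g = gcd m n
  0<g : 0 < g
  0<g = *-pos⁻ˡ g m₀ (subst (0 <_) eqm 0<m)
  cop : Coprime m₀ n₀
  cop {d} (d∣m₀ , d∣n₀) = ∣1⇒≡1 (*-cancelˡ-∣ g {{>-nonZero 0<g}} (subst (g * d ∣_) (sym (*-identityʳ g))
    (gcd-greatest (subst (g * d ∣_) (sym eqm) (*-monoʳ-∣ g d∣m₀)) (subst (g * d ∣_) (sym eqn) (*-monoʳ-∣ g d∣n₀)))))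

factorOut : ∀ p n → 1 < p → 0 < n → ∃[ k ] ∃[ n₁ ] (n ≡ p ^ k * n₁ × ¬ p ∣ n₁)
factorOut p n 1<p = <-rec P step n
  where
  P : ℕ → Set
  P n = 0 < n → ∃[ k ] ∃[ n₁ ] (n ≡ p ^ k * n₁ × ¬ p ∣ n₁)
  step : ∀ n → (∀ {m} → m < n → P m) → P n
  step n rec 0<n with p ∣? n
  ... | no p∤n = 0 , n , sym (*-identityˡ n) , p∤n
  ... | yes p∣n with ∣⇒∃* p∣n
  ... | q , refl with rec (m<n*m 0<q) 0<q
    where
    0<q : 0 < q
    0<q = *-pos⁻ʳ p q 0<n
    m<n*m : 0 < q → q < p * q
    m<n*m 0<q = subst (_< p * q) (*-identityˡ q) (*-monoˡ-< q {{>-nonZero 0<q}} 1<p)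
  ... | k , n₁ , eq , p∤n₁ = suc k , n₁ , trans (cong (p *_) eq) (sym (*-assoc p (p ^ k) n₁)) , p∤n₁

p^i*u≡p^[i+d]*v⇒p∣u : ∀ {p} i d {u v} → 0 < p → 0 < d → p ^ i * u ≡ p ^ (i + d) * v → p ∣ u
p^i*u≡p^[i+d]*v⇒p∣u {p} i (suc d) {u} {v} 0<p _ eq = subst (p ∣_) (sym (*-cancelˡ (^-pos i 0<p)
  (trans eq (trans (cong (_* v) (^-distribˡ-+-* p i (suc d))) (*-assoc (p ^ i) _ v)))))
  (∣m⇒∣m*n v (m∣m*n (p ^ d)))

factorOut-unique : ∀ {p} i j {u v} → 1 < p → ¬ p ∣ u → ¬ p ∣ v → p ^ i * u ≡ p ^ j * v → i ≡ j × u ≡ v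
factorOut-unique {p} i j 1<p p∤u p∤v eq with <-cmp i j
... | tri≈ _ refl _ = refl , *-cancelˡ (^-pos i (<-trans (s≤s z≤n) 1<p)) eq
... | tri< i<j _ _ with <⇒∃+ i<j
...   | d , 0<d , refl = ⊥-elim (p∤u (p^i*u≡p^[i+d]*v⇒p∣u i d (<-trans (s≤s z≤n) 1<p) 0<d eq))
factorOut-unique {p} i j 1<p p∤u p∤v eq | tri> _ _ j<i with <⇒∃+ j<i
...   | d , 0<d , refl = ⊥-elim (p∤v (p^i*u≡p^[i+d]*v⇒p∣u j d (<-trans (s≤s z≤n) 1<p) 0<d (sym eq)))

exactPower : ∀ {p k n n₁} → 0 < p → n ≡ p ^ k * n₁ → ¬ p ∣ n₁ → p ^ k ∥ n
exactPower {p} {k} {n} {n₁} 0<p refl p∤n₁ = m∣m*n n₁ , λ h →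
  p∤n₁ (*-cancelˡ-∣ (p ^ k) {{>-nonZero (^-pos k 0<p)}} (subst (_∣ p ^ k * n₁) (*-comm p (p ^ k)) h))

parity : ∀ n → 2 ∣ n ⊎ ∃[ m ] n ≡ 1 + 2 * m
parity zero = inj₁ (divides 0 refl)
parity (suc n) with parity n
... | inj₁ (divides q refl) = inj₂ (q , cong suc (*-comm q 2))
... | inj₂ (m , refl) = inj₁ (divides (suc m) (cong (2 +_) (*-comm 2 m)))

1+2m-odd : ∀ m → Odd (1 + 2 * m)
1+2m-odd m 2∣ = ∤1 prime[2] (∣m+n∣m⇒∣n (subst (2 ∣_) (+-comm 1 (2 * m)) 2∣) (m∣m*n m))

-- Geometric sums and lifting the exponent

-- geom x y k = Σ_{i<k} xⁱ yᵏ⁻¹⁻ⁱ = (xᵏ − yᵏ)/(x − y).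
geom : ℕ → ℕ → ℕ → ℕ
geom x y zero    = 0
geom x y (suc k) = x ^ k + y * geom x y k

^-diff : ∀ y d k → (y + d) ^ k ≡ y ^ k + d * geom (y + d) y k
^-diff y d zero    = sym (cong suc (*-zeroʳ d))
^-diff y d (suc k) = trans (*-distribʳ-+ ((y + d) ^ k) y d)
  (trans (cong (λ w → y * w + d * (y + d) ^ k) (^-diff y d k)) (rearrange y d (y ^ k) (geom (y + d) y k) ((y + d) ^ k)))
  where
  rearrange : ∀ y d a g b → y * (a + d * g) + d * b ≡ y * a + d * (b + y * g)
  rearrange = solve-∀

geom-+ : ∀ x y i j → geom x y (i + j) ≡ geom x y i * x ^ j + y ^ i * geom x y j
geom-+ x y zero    j = sym (*-identityˡ (geom x y j))
geom-+ x y (suc i) j = trans (cong₂ (λ u v → u + y * v) (^-distribˡ-+-* x i j) (geom-+ x y i j))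
  (rearrange y (x ^ i) (x ^ j) (geom x y i) (y ^ i) (geom x y j))
  where
  rearrange : ∀ y a b g c h → a * b + y * (g * b + c * h) ≡ (a + y * g) * b + y * c * h
  rearrange = solve-∀

geom-* : ∀ x y i j → geom x y (i * j) ≡ geom x y i * geom (x ^ i) (y ^ i) j
geom-* x y i zero    = trans (cong (geom x y) (*-zeroʳ i)) (sym (*-zeroʳ (geom x y i)))
geom-* x y i (suc j) = begin
  geom x y (i * suc j)                                   ≡⟨ cong (geom x y) (*-suc i j) ⟩
  geom x y (i + i * j)                                   ≡⟨ geom-+ x y i (i * j) ⟩
  g * x ^ (i * j) + y ^ i * geom x y (i * j)             ≡⟨ cong₂ (λ u v → g * u + y ^ i * v) (sym (^-*-assoc x i j)) (geom-* x y i j) ⟩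
  g * (x ^ i) ^ j + y ^ i * (g * h)                      ≡⟨ rearrange g ((x ^ i) ^ j) (y ^ i) h ⟩
  g * ((x ^ i) ^ j + y ^ i * h)                          ∎
  where
  open ≡-Reasoning
  g = geom x y i
  h = geom (x ^ i) (y ^ i) j
  rearrange : ∀ g a b h → g * a + b * (g * h) ≡ g * (a + b * h)
  rearrange = solve-∀

geom-mod : ∀ y d k → ∃[ r ] geom (y + d) y (suc k) ≡ suc k * y ^ k + d * r
geom-mod y d zero    = 0 , cong suc (trans (*-zeroʳ y) (sym (*-zeroʳ d)))
geom-mod y d (suc k) with geom-mod y d k
... | r , eq = geom (y + d) y (suc k) + y * r ,
  trans (cong₂ (λ u v → u + y * v) (^-diff y d (suc k)) eq) (rearrange y d (y ^ k) (geom (y + d) y (suc k)) k r)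
  where
  rearrange : ∀ y d a g k r → y * a + d * g + y * ((1 + k) * a + d * r) ≡ (2 + k) * (y * a) + d * (g + y * r)
  rearrange = solve-∀

-- The second-order term carries the binomial coefficient `k(k-1)/2`; doubling both sides keeps the
-- identity free of division.
geom-mod² : ∀ y d k → ∃[ r ] 2 * geom (y + d) y (2 + k) ≡ 2 * (2 + k) * y ^ (1 + k) + d * ((2 + k) * (1 + k) * y ^ k) + d * d * r
geom-mod² y d zero    = 0 , base y d
  where
  base : ∀ y d → 2 * ((y + d) * 1 + y * (1 + y * 0)) ≡ 2 * 2 * (y * 1) + d * (2 * 1 * 1) + d * d * 0
  base = solve-∀
geom-mod² y d (suc k) with geom-mod² y d k | geom-mod y d (suc k)
... | r , eq | r₁ , eq₁ = 2 * r₁ + y * r , (begin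
  2 * ((y + d) ^ (2 + k) + y * g)                                  ≡⟨ cong (λ w → 2 * (w + y * g)) (^-diff y d (2 + k)) ⟩
  2 * (y ^ (2 + k) + d * g + y * g)                                ≡⟨ rearrange₁ (y ^ (2 + k)) d g y ⟩
  2 * y ^ (2 + k) + 2 * d * g + y * (2 * g)                        ≡⟨ cong₂ (λ u v → 2 * y ^ (2 + k) + 2 * d * u + y * v) eq₁ eq ⟩
  _                                                                ≡⟨ rearrange₂ y d (y ^ k) k r r₁ ⟩
  _                                                                ∎)
  where
  open ≡-Reasoning
  g = geom (y + d) y (2 + k)
  rearrange₁ : ∀ a d g y → 2 * (a + d * g + y * g) ≡ 2 * a + 2 * d * g + y * (2 * g)
  rearrange₁ = solve-∀
  rearrange₂ : ∀ y d a k r r₁ →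
    2 * (y * (y * a)) + 2 * d * ((2 + k) * (y * a) + d * r₁) + y * (2 * (2 + k) * (y * a) + d * ((2 + k) * (1 + k) * a) + d * d * r)
    ≡ 2 * (3 + k) * (y * (y * a)) + d * ((3 + k) * (2 + k) * (y * a)) + d * d * (2 * r₁ + y * r)
  rearrange₂ = solve-∀

-- The clause for 2 is necessary: for odd `y` and `d ≡ 2 (mod 4)` the sum
-- `geom (y + d) y 2 = 2y + d` is divisible by 4, although the exponent is only 2.
Lifts : ℕ → ℕ → ℕ → Set
Lifts q d y = q ∣ d × ¬ q ∣ y × (q ≡ 2 → 4 ∣ d)

abstract
  -- Modulo `d` all terms of the sum agree, so it is `k` times a power of `y`. Divisibility of `d`
  -- by 2 alone suffices here, so the lemma also applies to `D = 2`.
  ∣geom⇒∣exponent : ∀ {q d y} k → Prime q → q ∣ d → ¬ q ∣ y → q ∣ geom (y + d) y k → q ∣ k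
  ∣geom⇒∣exponent {q} zero pq q∣d q∤y _ = q ∣0
  ∣geom⇒∣exponent {q} {d} {y} (suc k) pq q∣d q∤y q∣g with geom-mod y d k
  ... | r , eq with euclidsLemma (suc k) (y ^ k) pq
        (∣m+n∣m⇒∣n (subst (q ∣_) (trans eq (+-comm _ (d * r))) q∣g) (∣m⇒∣m*n r q∣d))
  ...   | inj₁ h = h
  ...   | inj₂ h = ⊥-elim (q∤y (prime∣^ k pq h))

geom-expand : ∀ y d k → 1 < k → ∃[ j ] ∃[ t ] ∃[ r₁ ] ∃[ r₂ ]
  (geom (y + d) y k ≡ k * y ^ j + d * r₁ × 2 * geom (y + d) y k ≡ 2 * k * y ^ j + (d * (k * t) + d * d * r₂))
geom-expand y d (suc zero) 1<1 = ⊥-elim (<-irrefl refl 1<1)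
geom-expand y d (suc (suc k)) _ with geom-mod y d (suc k) | geom-mod² y d k
... | r₁ , eq₁ | r₂ , eq₂ = suc k , suc k * y ^ k , r₁ , r₂ , eq₁ ,
  trans eq₂ (trans (cong (λ w → 2 * (2 + k) * y ^ (1 + k) + d * w + d * d * r₂) (*-assoc (2 + k) (1 + k) (y ^ k)))
    (+-assoc (2 * (2 + k) * y ^ (1 + k)) _ _))

-- For `q = 2` the sum is `2y + d` with `4 ∣ d`. For odd `q` the doubled second-order expansion with
-- `k = q` has both correction terms divisible by `q²`, so `q² ∣ geom` would force `q ∣ 2 y^j`.
prime∥geom : ∀ {q d y} → Prime q → Lifts q d y → ∃[ u ] (geom (y + d) y q ≡ q * u × ¬ q ∣ u)
prime∥geom {q} {d} {y} pq (q∣d , q∤y , 4∣d) with q ≟ 2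
... | yes refl with 4∣d refl
...   | divides e refl = y + 2 * e , two y e , λ h → q∤y (∣m+n∣m⇒∣n (subst (2 ∣_) (+-comm y (2 * e)) h) (m∣m*n e))
  where
  two : ∀ y e → (y + e * 4) * 1 + y * (1 + y * 0) ≡ 2 * (y + 2 * e)
  two = solve-∀
prime∥geom {q} {d} {y} pq (q∣d , q∤y , 4∣d) | no q≢2 with geom-expand y d q (1<prime pq)
... | j , t , r₁ , r₂ , eq₁ , eq₂
  with ∣⇒∃* (subst (q ∣_) (sym eq₁) (∣m∣n⇒∣m+n (m∣m*n (y ^ j)) (∣m⇒∣m*n r₁ q∣d)))
... | u , equ = u , equ , λ q∣u → ∤-* pq (q≢2 ∘ prime∣2 pq) (∤-^ j pq q∤y)
    (*-cancelˡ-∣ q {{prime⇒nonZero pq}} (subst (q * q ∣_) (rearrange q (y ^ j))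
      (∣m+n∣m⇒∣n (subst (q * q ∣_) (trans eq₂ (+-comm _ rest))
          (∣n⇒∣m*n 2 (subst (q * q ∣_) (sym equ) (*-monoʳ-∣ q q∣u))))
        (∣m∣n⇒∣m+n (*-pres-∣ q∣d (m∣m*n t)) (∣m⇒∣m*n r₂ (*-pres-∣ q∣d q∣d))))))
  where
  rest = d * (q * t) + d * d * r₂
  rearrange : ∀ q a → 2 * q * a ≡ q * (2 * a)
  rearrange = solve-∀

-- A form of lifting the exponent: a prime q dividing n contributes to geom x y k exactly the factor
-- it contributes to k, because geom x y (q m) = geom x y q · geom x^q y^q m and q exactly divides the first factor.
lifting : ∀ n {d y} k → 0 < n → (∀ q → Prime q → q ∣ n → Lifts q d y) → n ∣ geom (y + d) y k → n ∣ k
lifting n k 0<n = <-rec P step n 0<n _ _ k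
  where
  P : ℕ → Set
  P n = 0 < n → ∀ d y k → (∀ q → Prime q → q ∣ n → Lifts q d y) → n ∣ geom (y + d) y k → n ∣ k
  step : ∀ n → (∀ {m} → m < n → P m) → P n
  step (suc zero) _ _ _ _ k _ _ = 1∣ k
  step n@(suc (suc _)) rec 0<n d y k lifts n∣g with primeDivisor {n} (s≤s (s≤s z≤n))
  ... | q , pq , q∣n with ∣⇒∃* q∣n | lifts q pq q∣n
  ...   | n′ , n≡qn′ | (q∣d , q∤y , _)
    with ∣⇒∃* (∣geom⇒∣exponent k pq q∣d q∤y (∣-trans q∣n n∣g)) | prime∥geom pq (lifts q pq q∣n)
  ...   | m , refl | u , gq≡qu , q∤u =
      subst (_∣ q * m) (sym n≡qn′) (*-monoʳ-∣ q (rec n′<n 0<n′ (d * geom (y + d) y q) (y ^ q) m lifts′ n′∣geom))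
    where
    0<n′ : 0 < n′
    0<n′ = *-pos⁻ʳ q n′ (subst (0 <_) n≡qn′ 0<n)
    n′<n : n′ < n
    n′<n = subst (n′ <_) (sym n≡qn′) (subst (_< q * n′) (*-identityˡ n′) (*-monoˡ-< n′ {{>-nonZero 0<n′}} (1<prime pq)))
    n′∣n : n′ ∣ n
    n′∣n = subst (n′ ∣_) (sym n≡qn′) (n∣m*n q)
    -- A prime of `n′` dividing `u` divides `geom x y q`, hence the exponent `q`; it is then `q`
    -- itself, which does not divide `u`. So `u` can be cancelled.
    n′⊥u : Coprime n′ u
    n′⊥u = coprimeFromPrimes 0<n′ λ r pr r∣n′ r∣u →
      let r∣d , r∤y , _ = lifts r pr (∣-trans r∣n′ n′∣n)
          r≡q = prime∣prime pr pq (∣geom⇒∣exponent q pr r∣d r∤y (subst (r ∣_) (sym gq≡qu) (∣n⇒∣m*n q r∣u)))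
      in q∤u (subst (_∣ u) r≡q r∣u)
    lifts′ : ∀ r → Prime r → r ∣ n′ → Lifts r (d * geom (y + d) y q) (y ^ q)
    lifts′ r pr r∣n′ with lifts r pr (∣-trans r∣n′ n′∣n)
    ... | r∣d , r∤y , 4∣d = ∣m⇒∣m*n _ r∣d , ∤-^ q pr r∤y , λ r≡2 → ∣m⇒∣m*n _ (4∣d r≡2)
    G = geom ((y + d) ^ q) (y ^ q) m
    n′∣uG : n′ ∣ u * G
    n′∣uG = *-cancelˡ-∣ q {{prime⇒nonZero pq}} (subst₂ _∣_ n≡qn′
      (trans (geom-* (y + d) y q m) (trans (cong (_* G) gq≡qu) (*-assoc q u G))) n∣g)
    n′∣geom : n′ ∣ geom (y ^ q + d * geom (y + d) y q) (y ^ q) m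
    n′∣geom = subst (λ w → n′ ∣ geom w (y ^ q) m) (^-diff y d q) (coprime-divisor n′⊥u n′∣uG)

-- Congruences

-- Slack on both sides, so that no subtraction occurs.
record Mod (q m n : ℕ) : Set where
  constructor slack
  field
    i j   : ℕ
    equal : m + q * i ≡ n + q * j

Mod-refl : ∀ {q m} → Mod q m m
Mod-refl = slack 0 0 refl

Mod-sym : ∀ {q m n} → Mod q m n → Mod q n m
Mod-sym (slack i j eq) = slack j i (sym eq)

Mod-trans : ∀ {q m n o} → Mod q m n → Mod q n o → Mod q m o
Mod-trans {q} {m} {n} {o} (slack i j eq) (slack i′ j′ eq′) = slack (i + i′) (j′ + j) (begin
  m + q * (i + i′)        ≡⟨ assoc m q i i′ ⟩
  m + q * i + q * i′      ≡⟨ cong (_+ q * i′) eq ⟩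
  n + q * j + q * i′      ≡⟨ exchange n q j i′ ⟩
  n + q * i′ + q * j      ≡⟨ cong (_+ q * j) eq′ ⟩
  o + q * j′ + q * j      ≡⟨ sym (assoc o q j′ j) ⟩
  o + q * (j′ + j)        ∎)
  where
  open ≡-Reasoning
  assoc : ∀ m q i j → m + q * (i + j) ≡ m + q * i + q * j
  assoc = solve-∀
  exchange : ∀ n q i j → n + q * i + q * j ≡ n + q * j + q * i
  exchange = solve-∀

Mod-*ˡ : ∀ {q m n} a → Mod q m n → Mod q (a * m) (a * n)
Mod-*ˡ {q} {m} {n} a (slack i j eq) = slack (a * i) (a * j)
  (trans (factor a m q i) (trans (cong (a *_) eq) (sym (factor a n q j))))
  where
  factor : ∀ a m q i → a * m + q * (a * i) ≡ a * (m + q * i)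
  factor = solve-∀

Mod-* : ∀ {q m n m′ n′} → Mod q m n → Mod q m′ n′ → Mod q (m * m′) (n * n′)
Mod-* {q} {m} {n} {m′} {n′} e e′ = Mod-trans (Mod-*ˡ m e′)
  (subst₂ (Mod q) (*-comm n′ m) (*-comm n′ n) (Mod-*ˡ n′ e))

Mod-^ : ∀ {q m n} k → Mod q m n → Mod q (m ^ k) (n ^ k)
Mod-^ zero    e = Mod-refl
Mod-^ (suc k) e = Mod-* e (Mod-^ k e)

Mod-+ : ∀ {q m n m′ n′} → Mod q m n → Mod q m′ n′ → Mod q (m + m′) (n + n′)
Mod-+ {q} {m} {n} {m′} {n′} (slack i j eq) (slack i′ j′ eq′) = slack (i + i′) (j + j′)
  (trans (split m m′ q i i′) (trans (cong₂ _+_ eq eq′) (sym (split n n′ q j j′))))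
  where
  split : ∀ m m′ q i i′ → m + m′ + q * (i + i′) ≡ m + q * i + (m′ + q * i′)
  split = solve-∀

Mod-∣ : ∀ {q m n} → Mod q m n → q ∣ m → q ∣ n
Mod-∣ {q} {m} {n} (slack i j eq) q∣m = ∣m+n∣m⇒∣n (subst (q ∣_) (trans eq (+-comm n (q * j)))
  (∣m∣n⇒∣m+n q∣m (m∣m*n i))) (m∣m*n j)

∣⇒Mod : ∀ {q d} y → q ∣ d → Mod q (y + d) y
∣⇒Mod y (divides w refl) = slack 0 w (rearrange y w _)
  where
  rearrange : ∀ y w q → y + w * q + q * 0 ≡ y + q * w
  rearrange = solve-∀

Mod⇒∣ : ∀ {q d} y → Mod q (y + d) y → q ∣ d
Mod⇒∣ {q} {d} y (slack i j eq) = ∣m+n∣m⇒∣n (subst (q ∣_) (trans (sym eq′) (+-comm d (q * i))) (m∣m*n j)) (m∣m*n i)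
  where
  eq′ : d + q * i ≡ q * j
  eq′ = +-cancelˡ-≡ y _ _ (trans (sym (+-assoc y d (q * i))) eq)

Mod-cancelˡ : ∀ {q} m {a b} → Prime q → ¬ q ∣ m → Mod q (m * a) (m * b) → Mod q a b
Mod-cancelˡ {q} m {a} {b} pq q∤m e with ≤-total a b
... | inj₁ a≤b with m≤n⇒∃[o]m+o≡n a≤b
...   | d , refl with euclidsLemma m d pq (Mod⇒∣ (m * a) (Mod-sym (subst (Mod q (m * a)) (*-distribˡ-+ m a d) e)))
...     | inj₁ h = ⊥-elim (q∤m h)
...     | inj₂ h = Mod-sym (∣⇒Mod a h)
Mod-cancelˡ {q} m {a} {b} pq q∤m e | inj₂ b≤a with m≤n⇒∃[o]m+o≡n b≤a
...   | d , refl with euclidsLemma m d pq (Mod⇒∣ (m * b) (subst (λ w → Mod q w (m * b)) (*-distribˡ-+ m b d) e))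
...     | inj₁ h = ⊥-elim (q∤m h)
...     | inj₂ h = ∣⇒Mod b h

-- `x^(tj) x = x^(si) ≡ y^(si) = y^(tj) y ≡ x^(tj) y`, and the unit `x^(tj)` cancels. The Bézout
-- identity is written without negative coefficients.
Mod-Bézout : ∀ {q x y} s t i j → Prime q → ¬ q ∣ x → 1 + t * j ≡ s * i →
  Mod q (x ^ i) (y ^ i) → Mod q (x ^ j) (y ^ j) → Mod q x y
Mod-Bézout {q} {x} {y} s t i j pq q∤x eq ei ej = Mod-cancelˡ (x ^ (t * j)) pq (∤-^ (t * j) pq q∤x)
  (subst₂ (Mod q) (trans (pow x s i) (trans (cong (x ^_) (sym eq)) (*-comm x (x ^ (t * j))))) (*-comm y (x ^ (t * j)))
    (Mod-trans (Mod-^ s ei) (subst₂ (Mod q) (trans (cong (y ^_) eq) (sym (pow y s i))) refl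
      (Mod-*ˡ y (Mod-sym (subst₂ (Mod q) (pow x t j) (pow y t j) (Mod-^ t ej)))))))
  where
  pow : ∀ x s i → (x ^ i) ^ s ≡ x ^ (s * i)
  pow x s i = trans (^-*-assoc x i s) (cong (x ^_) (*-comm i s))

abstract
  Mod-coprimeExponents : ∀ {q x y} i j → Prime q → ¬ q ∣ x → Coprime i j →
    Mod q (x ^ i) (y ^ i) → Mod q (x ^ j) (y ^ j) → Mod q x y
  Mod-coprimeExponents i j pq q∤x cop ei ej with coprime-Bézout cop
  ... | Bézout.+- s t eq = Mod-Bézout s t i j pq q∤x eq ei ej
  ... | Bézout.-+ s t eq = Mod-Bézout t s j i pq q∤x eq ej ei

-- Solutions with proportional y and z

-- Contradicts `m^k ∣ 1 + k`. The bound fails at `m = 2`, `k = 1`, which is the room left for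
-- `D = 2`.
1+k<m^k : ∀ {m} k → 2 < m → 0 < k → 1 + k < m ^ k
1+k<m^k {m} (suc zero) 2<m _ = subst (2 <_) (sym (*-identityʳ m)) 2<m
1+k<m^k {m} (suc (suc k)) 2<m _ = begin-strict
  3 + k                    ≤⟨ m≤m+n (3 + k) (1 + k) ⟩
  3 + k + (1 + k)          ≡⟨ rearrange k ⟩
  2 * (2 + k)              <⟨ *-monoʳ-< 2 (1+k<m^k (suc k) 2<m (s≤s z≤n)) ⟩
  2 * m ^ suc k            ≤⟨ *-monoˡ-≤ (m ^ suc k) (<⇒≤ 2<m) ⟩
  m * m ^ suc k            ∎
  where
  open ≤-Reasoning
  rearrange : ∀ k → 3 + k + (1 + k) ≡ 2 * (2 + k)
  rearrange = solve-∀

oneOrTwo : ∀ {n} → 0 < n → (∀ q → Prime q → q ≢ 2 → ¬ q ∣ n) → ¬ 4 ∣ n → n ≡ 1 ⊎ n ≡ 2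
oneOrTwo {n} 0<n oddFree 4∤n with 2 ∣? n
... | no 2∤n = inj₁ (noPrimeDivisor⇒1 0<n λ q pq q∣n → case q ≟ 2 of λ
        { (yes refl) → 2∤n q∣n ; (no q≢2) → oddFree q pq q≢2 q∣n })
... | yes 2∣n with ∣⇒∃* 2∣n
...   | m , refl = inj₂ (cong (2 *_) (noPrimeDivisor⇒1 (*-pos⁻ʳ 2 m 0<n) λ q pq q∣m → case q ≟ 2 of λ
        { (yes refl) → 4∤n (*-monoʳ-∣ 2 q∣m) ; (no q≢2) → oddFree q pq q≢2 (∣n⇒∣m*n 2 q∣m) }))

-- `v = C^δ u + (C^δ - B^δ) B^i` exceeds `C^δ u`, and `u ≤ C^i`. Applied to two powers of `a`, the
-- inequality makes the exponent `e` of the normal form positive.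
difference-growth : ∀ {u v B C} i δ → 0 < i → 0 < δ → 0 < B → u + B ^ i ≡ C ^ i → v + B ^ (i + δ) ≡ C ^ (i + δ) →
  0 < u → u ^ (i + δ) < v ^ i
difference-growth {u} {v} {B} {C} i δ 0<i 0<δ 0<B equ eqv 0<u = begin-strict
  u ^ (i + δ)               ≡⟨ trans (^-distribˡ-+-* u i δ) (*-comm (u ^ i) (u ^ δ)) ⟩
  u ^ δ * u ^ i             ≤⟨ *-monoˡ-≤ (u ^ i) (^-monoˡ-≤ δ u≤Cⁱ) ⟩
  (C ^ i) ^ δ * u ^ i       ≡⟨ cong (_* u ^ i) (^-^-comm C i δ) ⟩
  (C ^ δ) ^ i * u ^ i       ≡⟨ sym (^-*-distrib (C ^ δ) u i) ⟩
  (C ^ δ * u) ^ i           <⟨ ^-monoˡ-< i {{>-nonZero 0<i}} Cδu<v ⟩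
  v ^ i                     ∎
  where
  open ≤-Reasoning
  u≤Cⁱ : u ≤ C ^ i
  u≤Cⁱ = subst (u ≤_) equ (m≤m+n u _)
  B<C : B < C
  B<C = ^-cancelˡ-< i (subst (B ^ i <_) equ (+-monoˡ-< (B ^ i) 0<u))
  split : v + B ^ (i + δ) ≡ C ^ δ * u + C ^ δ * B ^ i
  split = trans eqv (trans (^-distribˡ-+-* C i δ) (trans (*-comm (C ^ i) (C ^ δ))
    (trans (cong (C ^ δ *_) (sym equ)) (*-distribˡ-+ (C ^ δ) u (B ^ i)))))
  smaller : B ^ (i + δ) < C ^ δ * B ^ i
  smaller = subst (_< C ^ δ * B ^ i) (trans (*-comm (B ^ δ) (B ^ i)) (sym (^-distribˡ-+-* B i δ)))
    (*-monoˡ-< (B ^ i) {{>-nonZero (^-pos i 0<B)}} (^-monoˡ-< δ {{>-nonZero 0<δ}} B<C))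
  Cδu<v : C ^ δ * u < v
  Cδu<v = ≰⇒> λ v≤ → <⇒≢ (+-mono-≤-< v≤ smaller) split

x≤geom : ∀ x y k → 0 < x → x ≤ geom x y (2 + k)
x≤geom x y k 0<x = ≤-trans (m≤m^k x (suc k) (s≤s z≤n)) (m≤m+n _ _)

-- Normal form of the pair `a^x₁ + B = C`, `a^x₂ + B^k = C^k`: `G` is the greatest common divisor of
-- `B` and `C`, and `D` is `(C - B) / G`. The field `power` is the second equation divided by `G^k`,
-- using `a^x₂ = (G D)^k a^e`. `D = 1` leads to family (iii), `D = 2` to (i) and (iv).
record DiffStructure (a B C x₁ k x₂ : ℕ) : Set where
  field
    G B₀ D e : ℕ
    0<G      : 0 < G
    0<B₀     : 0 < B₀
    D≡1∨2    : D ≡ 1 ⊎ D ≡ 2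
    B₀⊥D     : Coprime B₀ D
    B≡       : B ≡ G * B₀
    C≡       : C ≡ G * (B₀ + D)
    aˣ≡      : a ^ x₁ ≡ G * D
    0<e      : 0 < e
    x₂≡      : x₂ ≡ k * x₁ + e
    power    : (B₀ + D) ^ k ≡ B₀ ^ k + D ^ k * a ^ e

-- If `m ∣ D` and all primes of `m` lift, then `m^δ` divides the geometric sum, hence `1 + δ`, which
-- is too small for `m > 2`. Taking for `m` an odd prime or 4 covers every `D > 2`.
geom≡⇒D≤2 : ∀ {a B₀ D e} δ → 0 < δ → 0 < D → Coprime B₀ D → geom (B₀ + D) B₀ (1 + δ) ≡ D ^ δ * a ^ e → D ≡ 1 ⊎ D ≡ 2
geom≡⇒D≤2 {a} {B₀} {D} {e} δ 0<δ 0<D cop eq = oneOrTwo 0<D oddFree 4∤D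
  where
  tooBig : ∀ m → 2 < m → m ∣ D → (∀ q → Prime q → q ∣ m → Lifts q D B₀) → ⊥
  tooBig m 2<m m∣D lifts = <⇒≱ (1+k<m^k δ 2<m 0<δ)
    (∣⇒≤ (lifting (m ^ δ) (1 + δ) (^-pos δ (<-trans (s≤s z≤n) 2<m)) (λ q pq q∣ → lifts q pq (prime∣^ δ pq q∣))
      (subst (m ^ δ ∣_) (sym eq) (∣m⇒∣m*n (a ^ e) (^-mono-∣ δ m∣D)))))
  oddFree : ∀ q → Prime q → q ≢ 2 → ¬ q ∣ D
  oddFree q pq q≢2 q∣D = tooBig q (≤∧≢⇒< (1<prime pq) (q≢2 ∘ sym)) q∣D
    λ r pr r∣q → ∣-trans r∣q q∣D , (λ r∣B₀ → coprime-∤ pr cop r∣B₀ (∣-trans r∣q q∣D)) ,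
      λ { refl → ⊥-elim (q≢2 (sym (prime∣prime pr pq r∣q))) }
  4∤D : ¬ 4 ∣ D
  4∤D 4∣D = tooBig 4 (s≤s (s≤s (s≤s z≤n))) 4∣D
    λ r pr r∣4 → ∣-trans r∣4 4∣D , (λ r∣B₀ → coprime-∤ pr cop r∣B₀ (∣-trans r∣4 4∣D)) , λ _ → 4∣D

-- Writing T i for geom C₀ B₀ i, the two equations give T₂^i = D^δ T₁^(i+δ) a^Δ with Δ > 0. A prime dividing T₁ would
-- divide T₂, hence D (coprime exponents), hence both exponents; so T₁ = 1 and i = 1.
diffCore : ∀ {a B C} x₁ x₂ i j → 1 < a → 0 < B → 0 < i → i < j → Coprime i j →
  a ^ x₁ + B ^ i ≡ C ^ i → a ^ x₂ + B ^ j ≡ C ^ j → i ≡ 1 × DiffStructure a B C x₁ j x₂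
diffCore {a} {B} {C} x₁ x₂ i j 1<a 0<B 0<i i<j cop eq₁ eq₂ with <⇒∃+ i<j | gcdSplit B C 0<B
... | δ , 0<δ , refl | G , B₀ , C₀ , 0<G , refl , refl , copB with <⇒∃+ B₀<C₀
  where
  B₀<C₀ : B₀ < C₀
  B₀<C₀ = *-cancelˡ-< G B₀ C₀ (^-cancelˡ-< i (subst ((G * B₀) ^ i <_) eq₁
    (+-monoˡ-< ((G * B₀) ^ i) (^-pos x₁ (<-trans (s≤s z≤n) 1<a)))))
...   | D , 0<D , refl = i≡1 , record
      { G = G ; B₀ = B₀ ; D = D ; e = e ; 0<G = 0<G ; 0<B₀ = 0<B₀ ; D≡1∨2 = geom≡⇒D≤2 {a} {B₀} {D} {e} δ 0<δ 0<D B₀⊥D T₂≡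
      ; B₀⊥D = B₀⊥D ; B≡ = refl ; C≡ = refl
      ; aˣ≡ = trans u≡ (trans (cong₂ (λ m n → G ^ m * (D * n)) i≡1 T₁≡1) (G*D G D))
      ; 0<e = 0<e
      ; x₂≡ = trans (sym (*-identityʳ x₂)) (trans (cong (x₂ *_) (sym i≡1)) (trans exponents (cong (_+ e) (*-comm x₁ j))))
      ; power = trans (^-diff B₀ D j) (cong (B₀ ^ j +_) DT₂≡) }
  where
  G*D : ∀ G D → G * 1 * (D * 1) ≡ G * D
  G*D = solve-∀
  0<a : 0 < a
  0<a = <-trans (s≤s z≤n) 1<a
  0<B₀ : 0 < B₀
  0<B₀ = *-pos⁻ʳ G B₀ 0<B
  T₁ = geom (B₀ + D) B₀ i
  T₂ = geom (B₀ + D) B₀ j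
  B₀⊥D : Coprime B₀ D
  B₀⊥D (d∣B , d∣D) = copB (d∣B , ∣m∣n⇒∣m+n d∣B d∣D)
  value : ∀ w k → w + (G * B₀) ^ k ≡ (G * (B₀ + D)) ^ k → w ≡ G ^ k * (D * geom (B₀ + D) B₀ k)
  value w k eq = +-cancelʳ-≡ ((G * B₀) ^ k) _ _ (begin
    w + (G * B₀) ^ k                            ≡⟨ eq ⟩
    (G * (B₀ + D)) ^ k                          ≡⟨ ^-*-distrib G (B₀ + D) k ⟩
    G ^ k * (B₀ + D) ^ k                        ≡⟨ cong (G ^ k *_) (trans (^-diff B₀ D k) (+-comm (B₀ ^ k) _)) ⟩
    G ^ k * (D * geom (B₀ + D) B₀ k + B₀ ^ k)   ≡⟨ *-distribˡ-+ (G ^ k) _ _ ⟩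
    G ^ k * (D * geom (B₀ + D) B₀ k) + G ^ k * B₀ ^ k ≡⟨ cong (G ^ k * (D * geom (B₀ + D) B₀ k) +_) (sym (^-*-distrib G B₀ k)) ⟩
    G ^ k * (D * geom (B₀ + D) B₀ k) + (G * B₀) ^ k ∎)
    where open ≡-Reasoning
  u≡ : a ^ x₁ ≡ G ^ i * (D * T₁)
  u≡ = value (a ^ x₁) i eq₁
  v≡ : a ^ x₂ ≡ G ^ j * (D * T₂)
  v≡ = value (a ^ x₂) j eq₂
  -- Pure size comparison: `(a^x₁)^j < (a^x₂)^i`, and both sides are powers of `a`.
  exponent-gap : ∃[ d ] (0 < d × x₂ * i ≡ x₁ * j + d)
  exponent-gap = <⇒∃+ (^-cancelʳ-< (x₁ * j) (x₂ * i) 0<a (subst₂ _<_ (^-*-assoc a x₁ j) (^-*-assoc a x₂ i)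
    (difference-growth i δ 0<i 0<δ 0<B eq₁ eq₂ (^-pos x₁ 0<a))))
  e = proj₁ exponent-gap
  0<e : 0 < e
  0<e = proj₁ (proj₂ exponent-gap)
  exponents : x₂ * i ≡ x₁ * j + e
  exponents = proj₂ (proj₂ exponent-gap)
  cross : (D * T₂) ^ i ≡ (D * T₁) ^ j * a ^ e
  cross = *-cancelˡ (^-pos i (^-pos j 0<G)) (begin
    (G ^ j) ^ i * (D * T₂) ^ i                  ≡⟨ sym (^-*-distrib (G ^ j) (D * T₂) i) ⟩
    (G ^ j * (D * T₂)) ^ i                      ≡⟨ cong (_^ i) (sym v≡) ⟩
    (a ^ x₂) ^ i                                ≡⟨ trans (^-*-assoc a x₂ i) (cong (a ^_) exponents) ⟩
    a ^ (x₁ * j + e)                            ≡⟨ trans (^-distribˡ-+-* a (x₁ * j) e) (cong (_* a ^ e) (sym (^-*-assoc a x₁ j))) ⟩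
    (a ^ x₁) ^ j * a ^ e                        ≡⟨ cong (λ w → w ^ j * a ^ e) u≡ ⟩
    (G ^ i * (D * T₁)) ^ j * a ^ e              ≡⟨ cong (_* a ^ e) (^-*-distrib (G ^ i) (D * T₁) j) ⟩
    (G ^ i) ^ j * (D * T₁) ^ j * a ^ e          ≡⟨ *-assoc ((G ^ i) ^ j) _ _ ⟩
    (G ^ i) ^ j * ((D * T₁) ^ j * a ^ e)        ≡⟨ cong (_* ((D * T₁) ^ j * a ^ e)) (^-^-comm G i j) ⟩
    (G ^ j) ^ i * ((D * T₁) ^ j * a ^ e)        ∎)
    where open ≡-Reasoning
  T₂ⁱ≡ : T₂ ^ i ≡ D ^ δ * (T₁ ^ j * a ^ e)
  T₂ⁱ≡ = *-cancelˡ (^-pos i 0<D) (begin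
    D ^ i * T₂ ^ i                              ≡⟨ sym (^-*-distrib D T₂ i) ⟩
    (D * T₂) ^ i                                ≡⟨ cross ⟩
    (D * T₁) ^ j * a ^ e                        ≡⟨ cong (_* a ^ e) (^-*-distrib D T₁ j) ⟩
    D ^ j * T₁ ^ j * a ^ e                      ≡⟨ cong (λ w → w * T₁ ^ j * a ^ e) (^-distribˡ-+-* D i δ) ⟩
    D ^ i * D ^ δ * T₁ ^ j * a ^ e              ≡⟨ assoc (D ^ i) (D ^ δ) (T₁ ^ j) (a ^ e) ⟩
    D ^ i * (D ^ δ * (T₁ ^ j * a ^ e))          ∎)
    where
    open ≡-Reasoning
    assoc : ∀ a b c d → a * b * c * d ≡ a * (b * (c * d))
    assoc = solve-∀
  0<T₁ : 0 < T₁
  0<T₁ = *-pos⁻ʳ D T₁ (*-pos⁻ʳ (G ^ i) (D * T₁) (subst (0 <_) u≡ (^-pos x₁ 0<a)))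
  T₁≡1 : T₁ ≡ 1
  T₁≡1 = noPrimeDivisor⇒1 0<T₁ λ q pq q∣T₁ →
    let q∣T₂ = prime∣^ i pq (subst (q ∣_) (sym T₂ⁱ≡) (∣n⇒∣m*n (D ^ δ) (∣m⇒∣m*n (a ^ e)
                 (∣-self^ j (<-trans 0<i i<j) q∣T₁))))
        congr = λ k q∣T → subst (λ w → Mod q w (B₀ ^ k)) (sym (^-diff B₀ D k)) (∣⇒Mod (B₀ ^ k) (∣n⇒∣m*n D q∣T))
        q∤C₀ = λ q∣C₀ → coprime-∤ pq copB (prime∣^ i pq (Mod-∣ (congr i q∣T₁) (∣-self^ i 0<i q∣C₀))) q∣C₀
        q∣D = Mod⇒∣ B₀ (Mod-coprimeExponents i j pq q∤C₀ cop (congr i q∣T₁) (congr j q∣T₂))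
        q∤B₀ = λ q∣B₀ → q∤C₀ (∣m∣n⇒∣m+n q∣B₀ q∣D)
    in coprime-∤ pq cop (∣geom⇒∣exponent i pq q∣D q∤B₀ q∣T₁) (∣geom⇒∣exponent j pq q∣D q∤B₀ q∣T₂)
  one : ∀ i → 0 < i → geom (B₀ + D) B₀ i ≡ 1 → i ≡ 1
  one 1             _ _  = refl
  one (suc (suc i)) _ eq = contradiction (subst (B₀ + D ≤_) eq (x≤geom (B₀ + D) B₀ i (<-≤-trans 0<B₀ (m≤m+n B₀ D))))
    (<⇒≱ (+-mono-≤ 0<B₀ 0<D))
  i≡1 : i ≡ 1
  i≡1 = one i 0<i T₁≡1
  T₂≡ : geom (B₀ + D) B₀ (1 + δ) ≡ D ^ δ * a ^ e
  T₂≡ = begin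
    geom (B₀ + D) B₀ (1 + δ)      ≡⟨ cong (λ w → geom (B₀ + D) B₀ (w + δ)) (sym i≡1) ⟩
    T₂                            ≡⟨ sym (^-identityʳ T₂) ⟩
    T₂ ^ 1                        ≡⟨ cong (T₂ ^_) (sym i≡1) ⟩
    T₂ ^ i                        ≡⟨ T₂ⁱ≡ ⟩
    D ^ δ * (T₁ ^ j * a ^ e)      ≡⟨ cong (λ w → D ^ δ * (w ^ j * a ^ e)) T₁≡1 ⟩
    D ^ δ * (1 ^ j * a ^ e)       ≡⟨ cong (λ w → D ^ δ * (w * a ^ e)) (^-zeroˡ j) ⟩
    D ^ δ * (1 * a ^ e)           ≡⟨ cong (D ^ δ *_) (*-identityˡ (a ^ e)) ⟩
    D ^ δ * a ^ e                 ∎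
    where open ≡-Reasoning
  DT₂≡ : D * T₂ ≡ D ^ j * a ^ e
  DT₂≡ = begin
    D * T₂                        ≡⟨ cong (λ w → D * geom (B₀ + D) B₀ (w + δ)) i≡1 ⟩
    D * geom (B₀ + D) B₀ (1 + δ)  ≡⟨ cong (D *_) T₂≡ ⟩
    D * (D ^ δ * a ^ e)           ≡⟨ sym (*-assoc D (D ^ δ) (a ^ e)) ⟩
    D ^ (1 + δ) * a ^ e           ≡⟨ cong (λ w → D ^ (w + δ) * a ^ e) (sym i≡1) ⟩
    D ^ j * a ^ e                 ∎
    where open ≡-Reasoning

4∣2^ : ∀ {m} → 1 < m → 4 ∣ 2 ^ m
4∣2^ {suc zero} 1<1 = ⊥-elim (<-irrefl refl 1<1)
4∣2^ {suc (suc k)} _ = divides (2 ^ k) (rearrange (2 ^ k))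
  where
  rearrange : ∀ w → 2 * (2 * w) ≡ w * 4
  rearrange = solve-∀

-- The smaller solution comes first. That the ratio `k` is an integer is the conclusion `i ≡ 1` of
-- `diffCore`.
ScaledSolution : (a b c x y z x′ y′ z′ : ℕ) → Set
ScaledSolution a b c x y z x′ y′ z′ = ∃[ k ] (1 < k × y′ ≡ k * y × z′ ≡ k * z × DiffStructure a (b ^ y) (c ^ z) x k x′)

sameRatio : ∀ {a b c x₁ y₁ z₁ x₂ y₂ z₂} → 1 < a → 1 < b → 1 < c → Sol a b c x₁ y₁ z₁ → Sol a b c x₂ y₂ z₂ → y₁ * z₂ ≡ y₂ * z₁ →
  (x₂ ≡ x₁ × y₂ ≡ y₁ × z₂ ≡ z₁) ⊎ ScaledSolution a b c x₁ y₁ z₁ x₂ y₂ z₂ ⊎ ScaledSolution a b c x₂ y₂ z₂ x₁ y₁ z₁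
sameRatio {a} {b} {c} {x₁} {y₁} {z₁} {x₂} {y₂} {z₂} 1<a 1<b 1<c (0<x₁ , 0<y₁ , 0<z₁ , eq₁) (0<x₂ , 0<y₂ , 0<z₂ , eq₂) ratio
  with gcdSplit y₁ y₂ 0<y₁
... | Y , i , j , 0<Y , refl , refl , cop with ∣⇒∃* (coprime-divisor cop (divides z₂ (trans (sym reduced) (*-comm i z₂))))
  where
  reduced : i * z₂ ≡ j * z₁
  reduced = *-cancelˡ 0<Y (trans (sym (*-assoc Y i z₂)) (trans ratio (*-assoc Y j z₁)))
... | Z , refl = conclude
  where
  0<i : 0 < i
  0<i = *-pos⁻ʳ Y i 0<y₁
  0<j : 0 < j
  0<j = *-pos⁻ʳ Y j 0<y₂
  z₂≡ : z₂ ≡ j * Z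
  z₂≡ = *-cancelˡ 0<i (*-cancelˡ 0<Y (trans (sym (*-assoc Y i z₂)) (trans ratio (rearrange Y i j Z))))
    where
    rearrange : ∀ Y i j Z → Y * j * (i * Z) ≡ Y * (i * (j * Z))
    rearrange = solve-∀
  0<b : 0 < b
  0<b = <-trans (s≤s z≤n) 1<b
  based : ∀ {x} k {z} → z ≡ k * Z → a ^ x + b ^ (Y * k) ≡ c ^ z → a ^ x + (b ^ Y) ^ k ≡ (c ^ Z) ^ k
  based {x} k refl eq = trans (cong (a ^ x +_) (^-*-assoc b Y k)) (trans eq
    (trans (cong (c ^_) (*-comm k Z)) (sym (^-*-assoc c Z k))))
  scaled : ∀ {x x′} i j {z z′} → 0 < i → i < j → Coprime i j → z ≡ i * Z → z′ ≡ j * Z → a ^ x + b ^ (Y * i) ≡ c ^ z →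
    a ^ x′ + b ^ (Y * j) ≡ c ^ z′ → ScaledSolution a b c x (Y * i) z x′ (Y * j) z′
  scaled {x} {x′} i j {z} {z′} 0<i i<j cop refl refl eq eq′
    with diffCore x x′ i j 1<a (^-pos Y 0<b) 0<i i<j cop (based {x} i refl eq) (based {x′} j refl eq′)
  ... | refl , S = j , i<j , trans (*-comm Y j) (cong (j *_) (sym (*-identityʳ Y))) , cong (j *_) (sym (*-identityˡ Z)) ,
        subst₂ (λ u v → DiffStructure a (b ^ u) (c ^ v) x j x′) (sym (*-identityʳ Y)) (sym (*-identityˡ Z)) S
  conclude : _
  conclude with <-cmp i j
  ... | tri< i<j _ _ = inj₂ (inj₁ (scaled i j 0<i i<j cop refl z₂≡ eq₁ eq₂))
  ... | tri> _ _ j<i = inj₂ (inj₂ (scaled j i 0<j j<i (coprime-sym cop) z₂≡ refl eq₂ eq₁))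
  ... | tri≈ _ refl _ = inj₁ (^-injʳ x₂ x₁ 1<a (+-cancelʳ-≡ (b ^ (Y * i)) _ _ (trans eq₂ (trans (cong (c ^_) z₂≡) (sym eq₁)))) , refl , z₂≡)

module _ {a B C x k x′} (S : DiffStructure a B C x k x′) where
  open DiffStructure S

  prime∣a⇒∤B₀ : ∀ {p} → 0 < k → Prime p → p ∣ a → ¬ p ∣ B₀
  prime∣a⇒∤B₀ {p} 0<k pp p∣a p∣B₀ = coprime-∤ pp B₀⊥D p∣B₀ (∣m+n∣m⇒∣n p∣C₀ p∣B₀)
    where
    p∣C₀ : p ∣ B₀ + D
    p∣C₀ = prime∣^ k pp (subst (p ∣_) (sym power) (∣m∣n⇒∣m+n (∣-self^ k 0<k p∣B₀) (∣n⇒∣m*n (D ^ k) (∣-self^ e 0<e p∣a))))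

  prime∣a⇒∤C₀ : ∀ {p} → 0 < k → Prime p → p ∣ a → ¬ p ∣ B₀ + D
  prime∣a⇒∤C₀ {p} 0<k pp p∣a p∣C₀ = prime∣a⇒∤B₀ 0<k pp p∣a (prime∣^ k pp (∣m+n∣m⇒∣n
    (subst (p ∣_) (trans power (+-comm (B₀ ^ k) _)) (∣-self^ k 0<k p∣C₀)) (∣n⇒∣m*n (D ^ k) (∣-self^ e 0<e p∣a))))

  -- One of the consecutive integers `B₀`, `B₀ + 1` is even, while primes of `a` divide neither.
  D≡1⇒odd : 0 < k → D ≡ 1 → Odd a
  D≡1⇒odd 0<k D≡1 2∣a with parity B₀
  ... | inj₁ 2∣B₀ = prime∣a⇒∤B₀ 0<k prime[2] 2∣a 2∣B₀
  ... | inj₂ (m , B₀≡) = prime∣a⇒∤C₀ 0<k prime[2] 2∣a (divides (1 + m) (trans (cong₂ _+_ B₀≡ D≡1) (rearrange m)))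
    where
    rearrange : ∀ m → 1 + 2 * m + 1 ≡ (1 + m) * 2
    rearrange = solve-∀

  module Even (0<k : 0 < k) (D≡2 : D ≡ 2) where
    2∣a : 2 ∣ a
    2∣a = prime∣^ x prime[2] (subst (2 ∣_) (sym aˣ≡) (subst (λ w → 2 ∣ G * w) (sym D≡2) (n∣m*n G)))

    2∤B₀ : Odd B₀
    2∤B₀ = prime∣a⇒∤B₀ 0<k prime[2] 2∣a

    power₂ : (B₀ + 2) ^ k ≡ B₀ ^ k + 2 ^ k * a ^ e
    power₂ = subst (λ w → (B₀ + w) ^ k ≡ B₀ ^ k + w ^ k * a ^ e) D≡2 power

    -- `2 geom = 2^k a^e` is divisible by 4, so the sum is even; with odd `B₀` the first-order
    -- congruence makes its exponent even.
    2∣k : 1 < k → 2 ∣ k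
    2∣k 1<k = ∣geom⇒∣exponent {2} {2} {B₀} k prime[2] ∣-refl 2∤B₀ (*-cancelˡ-∣ 2 (subst (4 ∣_) (sym twice)
        (∣m⇒∣m*n (a ^ e) (4∣2^ 1<k))))
      where
      twice : 2 * geom (B₀ + 2) B₀ k ≡ 2 ^ k * a ^ e
      twice = +-cancelˡ-≡ (B₀ ^ k) _ _ (trans (sym (^-diff B₀ 2 k)) power₂)

    -- `(B₀ + 2)² - B₀²`. The difference 2 itself does not lift at the prime 2, but this one is
    -- divisible by 4.
    d = 2 * (2 * B₀ + 2)

    lifts₂ : Lifts 2 d (B₀ ^ 2)
    lifts₂ = m∣m*n (2 * B₀ + 2) , ∤-^ 2 prime[2] 2∤B₀ , λ _ → divides (B₀ + 1) (rearrange B₀)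
      where
      rearrange : ∀ b → 2 * (2 * b + 2) ≡ (b + 1) * 4
      rearrange = solve-∀

    squares : (B₀ + 2) ^ 2 ≡ B₀ ^ 2 + d
    squares = rearrange B₀
      where
      rearrange : ∀ b → (b + 2) * ((b + 2) * 1) ≡ b * (b * 1) + 2 * (2 * b + 2)
      rearrange = solve-∀

    halved : ∀ l → k ≡ 2 * l → d * geom (B₀ ^ 2 + d) (B₀ ^ 2) l ≡ 2 ^ k * a ^ e
    halved l refl = +-cancelˡ-≡ (B₀ ^ k) _ _ (begin
      B₀ ^ (2 * l) + d * geom (B₀ ^ 2 + d) (B₀ ^ 2) l      ≡⟨ cong (_+ d * geom (B₀ ^ 2 + d) (B₀ ^ 2) l) (sym (^-*-assoc B₀ 2 l)) ⟩
      (B₀ ^ 2) ^ l + d * geom (B₀ ^ 2 + d) (B₀ ^ 2) l      ≡⟨ sym (^-diff (B₀ ^ 2) d l) ⟩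
      (B₀ ^ 2 + d) ^ l                                     ≡⟨ cong (_^ l) (sym squares) ⟩
      ((B₀ + 2) ^ 2) ^ l                                   ≡⟨ ^-*-assoc (B₀ + 2) 2 l ⟩
      (B₀ + 2) ^ (2 * l)                                   ≡⟨ power₂ ⟩
      B₀ ^ (2 * l) + 2 ^ (2 * l) * a ^ e                   ∎)
      where open ≡-Reasoning

prime∣2^⇒≡2 : ∀ {p} k → Prime p → p ∣ 2 ^ k → p ≡ 2
prime∣2^⇒≡2 k pp p∣ = prime∣2 pp (prime∣^ k pp p∣)

halve : ∀ {G A} n → G * 2 ≡ 2 ^ n * A → 0 < n → G ≡ 2 ^ (n ∸ 1) * A × n ≡ suc (n ∸ 1)
halve {G} {A} (suc n) eq _ = *-cancelˡ {2} (s≤s z≤n) (trans (*-comm 2 G) (trans eq (*-assoc 2 (2 ^ n) A))) , refl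

geom≤k⇒k≡1 : ∀ {x y} k → 0 < k → 2 < x → geom x y k ≤ k → k ≡ 1
geom≤k⇒k≡1 (suc zero)    _ _ _ = refl
geom≤k⇒k≡1 {x} (suc (suc k)) _ 2<x le = contradiction (≤-trans (m≤m+n (x ^ suc k) _) le) (<⇒≱ (1+k<m^k (suc k) 2<x (s≤s z≤n)))

module _ {a B C x k x′} (S : DiffStructure a B C x k x′) where
  open DiffStructure S

  -- With `k = 2l`, the product `d g = 2^k a^e` is a power of 2, so all primes of `g` lift and
  -- `g ∣ l`. A geometric sum this small has `l = 1`, and then `d = 4 (B₀ + 1)` gives
  -- `B₀ + 1 = a^e`.
  powerOf2-shape : ∀ i → 0 < x → 1 < k → D ≡ 2 → a ≡ 2 ^ i →
    k ≡ 2 × B₀ + 1 ≡ 2 ^ (i * e) × ∃[ u ] (G ≡ 2 ^ u × i * x ≡ suc u)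
  powerOf2-shape i 0<x 1<k D≡2 a≡ with ∣⇒∃* (Even.2∣k S (<-trans (s≤s z≤n) 1<k) D≡2 1<k)
  ... | l , k≡2l = trans k≡2l (cong (2 *_) l≡1) , B₀+1≡ , i * x ∸ 1 , trans (proj₁ halved-G) (*-identityʳ _) , proj₂ halved-G
    where
    open Even S (<-trans (s≤s z≤n) 1<k) D≡2
    g = geom (B₀ ^ 2 + d) (B₀ ^ 2) l
    dg≡ : d * g ≡ 2 ^ k * a ^ e
    dg≡ = halved l k≡2l
    0<a : 0 < a
    0<a = subst (0 <_) (sym a≡) (^-pos i (s≤s z≤n))
    0<g : 0 < g
    0<g = *-pos⁻ʳ d g (subst (0 <_) (sym dg≡) (*-pos (^-pos k (s≤s z≤n)) (^-pos e 0<a)))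
    0<l : 0 < l
    0<l = *-pos⁻ʳ 2 l (subst (0 <_) k≡2l (<-trans (s≤s z≤n) 1<k))
    primes : ∀ q → Prime q → q ∣ g → q ≡ 2
    primes q pq q∣g with euclidsLemma (2 ^ k) (a ^ e) pq (subst (q ∣_) dg≡ (∣n⇒∣m*n d q∣g))
    ... | inj₁ h = prime∣2^⇒≡2 k pq h
    ... | inj₂ h = prime∣2^⇒≡2 i pq (subst (q ∣_) a≡ (prime∣^ e pq h))
    g∣l : g ∣ l
    g∣l = lifting g l 0<g (λ q pq q∣g → subst (λ w → Lifts w d (B₀ ^ 2)) (sym (primes q pq q∣g)) lifts₂) ∣-refl
    l≡1 : l ≡ 1
    l≡1 = geom≤k⇒k≡1 l 0<l (≤-trans (s≤s (s≤s (s≤s z≤n))) (≤-trans (*-monoʳ-≤ 2 (m≤n+m 2 (2 * B₀))) (m≤n+m d (B₀ ^ 2))))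
      (∣⇒≤ {{>-nonZero 0<l}} g∣l)
    B₀+1≡ : B₀ + 1 ≡ 2 ^ (i * e)
    B₀+1≡ = *-cancelˡ {4} (s≤s z≤n) (begin
      4 * (B₀ + 1)                     ≡⟨ rearrange B₀ (B₀ ^ 2) ⟩
      d * (1 + B₀ ^ 2 * 0)             ≡⟨ cong (λ w → d * geom (B₀ ^ 2 + d) (B₀ ^ 2) w) (sym l≡1) ⟩
      d * g                            ≡⟨ dg≡ ⟩
      2 ^ k * a ^ e                    ≡⟨ cong₂ (λ m n → 2 ^ m * n ^ e) (trans k≡2l (cong (2 *_) l≡1)) a≡ ⟩
      4 * (2 ^ i) ^ e                  ≡⟨ cong (4 *_) (^-*-assoc 2 i e) ⟩
      4 * 2 ^ (i * e)                  ∎)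
      where
      open ≡-Reasoning
      rearrange : ∀ b c → 4 * (b + 1) ≡ 2 * (2 * b + 2) * (1 + c * 0)
      rearrange = solve-∀
    0<i : 0 < i
    0<i = n≢0⇒n>0 λ { refl → ∤1 prime[2] (subst (2 ∣_) a≡ 2∣a) }
    halved-G : G ≡ 2 ^ (i * x ∸ 1) * 1 × i * x ≡ suc (i * x ∸ 1)
    halved-G = halve (i * x) (trans (cong (G *_) (sym D≡2)) (trans (sym aˣ≡) (trans (cong (_^ x) a≡)
      (trans (^-*-assoc 2 i x) (sym (*-identityʳ _)))))) (*-pos 0<i 0<x)

  -- Kept abstract so that later with-abstractions do not normalise the proof.
  abstract
    powerOf2-structure : ∀ i → 0 < x → 1 < k → D ≡ 2 → a ≡ 2 ^ i →
      k ≡ 2 × B₀ + 1 ≡ 2 ^ (i * e) × ∃[ u ] (G ≡ 2 ^ u × i * x ≡ suc u)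
    powerOf2-structure = powerOf2-shape

-- Recognising families (i), (iii) and (iv)

FamilyPair : NineSet → (a b x y x′ y′ : ℕ) → Set
FamilyPair F a b x y x′ y′ = ∃[ A ] ∃[ B ] ∃[ C ] ∃[ X₁ ] ∃[ Y₁ ] ∃[ Z₁ ] ∃[ X₂ ] ∃[ Y₂ ] ∃[ Z₂ ]
  (F A B C X₁ Y₁ Z₁ X₂ Y₂ Z₂ × Corr A B X₁ Y₁ a b x y × Corr A B X₂ Y₂ a b x′ y′)

Exceptional : (a b x y x′ y′ : ℕ) → Set
Exceptional a b x y x′ y′ = FamilyPair F₁ a b x y x′ y′ ⊎ FamilyPair F₂ a b x y x′ y′ ⊎
  FamilyPair F₃ a b x y x′ y′ ⊎ FamilyPair F₄ a b x y x′ y′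

base-power : ∀ b y k {y′} → y′ ≡ k * y → (b ^ y) ^ k ≡ b ^ y′
base-power b y k refl = trans (^-*-assoc b y k) (cong (b ^_) (*-comm y k))

-- The parameters are `g = a`, `j = 1`, `u = x`, `d = B₀`, `w = e`; with `D = 1` the relation
-- `a^x = G D` reads `G = g^(ju)`.
scaled-odd⇒F₃ : ∀ {a b c x y z x′ y′ z′} → 1 < a → 0 < x → (S : ScaledSolution a b c x y z x′ y′ z′) →
  DiffStructure.D (proj₂ (proj₂ (proj₂ (proj₂ S)))) ≡ 1 → FamilyPair F₃ a b x y x′ y′
scaled-odd⇒F₃ {a} {b} {c} {x} {y} {z} {x′} 1<a 0<x (k , 1<k , y′≡ , z′≡ , S) D≡1 =
  a , b ^ y , c ^ z , x , 1 , 1 , x′ , k , k ,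
  (a , 1 , x , B₀ , k , e , s≤s z≤n , 0<x , 0<B₀ , 1<a , D≡1⇒odd S (<-trans (s≤s z≤n) 1<k) D≡1 ,
   power₁ , 0<e , 1<k , sym (*-identityʳ a) ,
   trans B≡ (cong (_* B₀) G≡) , trans C≡ (cong₂ (λ m n → m * (B₀ + n)) G≡ D≡1) , refl , refl , refl ,
   trans (*-identityˡ x′) (trans x₂≡ (cong (_+ e) (sym (*-identityˡ (k * x))))) , refl , refl) ,
  inj₁ (refl , *-identityʳ (b ^ y)) , inj₁ (refl , base-power b y k y′≡)
  where
  open DiffStructure S
  G≡ : G ≡ a ^ (1 * x)
  G≡ = trans (sym (*-identityʳ G)) (trans (cong (G *_) (sym D≡1)) (trans (sym aˣ≡) (cong (a ^_) (sym (*-identityˡ x)))))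
  power₁ : B₀ ^ k + a ^ e ≡ (B₀ + 1) ^ k
  power₁ = sym (trans (subst (λ w → (B₀ + w) ^ k ≡ B₀ ^ k + w ^ k * a ^ e) D≡1 power)
    (cong (B₀ ^ k +_) (trans (cong (_* a ^ e) (^-zeroˡ k)) (*-identityˡ (a ^ e)))))

gcd>1⇒commonPrime : ∀ {a b} → 1 < gcd a b → ∃[ p ] (Prime p × p ∣ a × p ∣ b)
gcd>1⇒commonPrime {a} {b} 1<g with primeDivisor 1<g
... | p , pp , p∣g = p , pp , ∣-trans p∣g (gcd[m,n]∣m a b) , ∣-trans p∣g (gcd[m,n]∣n a b)

F₁-pair : ∀ {a b c x y z x′ y′} u m → 0 < u → 0 < m → b ^ y ≡ 2 ^ u * (2 ^ m ∸ 1) → c ^ z ≡ 2 ^ u * (2 ^ m + 1) →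
  a ^ x ≡ 2 ^ (u + 1) → a ^ x′ ≡ 2 ^ (2 * u + suc m + 1) → y′ ≡ 2 * y → FamilyPair F₁ a b x y x′ y′
F₁-pair {a} {b} {c} {x} {y} {z} {x′} {y′} u m 0<u 0<m b≡ c≡ a≡ a≡′ y′≡ =
  2 , b ^ y , c ^ z , u + 1 , 1 , 1 , 2 * u + suc m + 1 , 2 , 2 ,
  (u , suc m , 0<u , s≤s 0<m , refl , b≡ , c≡ , refl , refl , refl , refl , refl , refl) ,
  inj₁ (sym a≡ , *-identityʳ (b ^ y)) , inj₁ (sym a≡′ , base-power b y 2 y′≡)

module _ {a B C x k x′} (S : DiffStructure a B C x k x′) where
  open DiffStructure S

  -- Here `m = i e` plays the role of `h - 1`. Positivity of `u` comes from `2 ∣ B`: since `B₀` is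
  -- odd, `G = 2^u` must be even. The last exponent is `i x′ = 2 i x + i e = 2 (u + 1) + m`.
  powerOf2-values : ∀ i → 0 < x → 1 < k → D ≡ 2 → a ≡ 2 ^ i → 2 ∣ B →
    k ≡ 2 × ∃[ u ] ∃[ m ] (0 < u × 0 < m × B ≡ 2 ^ u * (2 ^ m ∸ 1) × C ≡ 2 ^ u * (2 ^ m + 1) ×
      a ^ x ≡ 2 ^ (u + 1) × a ^ x′ ≡ 2 ^ (2 * u + suc m + 1))
  powerOf2-values i 0<x 1<k D≡2 a≡ 2∣B with powerOf2-structure S i 0<x 1<k D≡2 a≡
  ... | k≡2 , B₀+1≡ , u , G≡ , ix≡ = k≡2 , u , i * e , 0<u , 0<m ,
    trans B≡ (cong₂ _*_ G≡ (trans (sym (m+n∸n≡m B₀ 1)) (cong (_∸ 1) B₀+1≡))) ,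
    trans C≡ (cong₂ _*_ G≡ (trans (cong (B₀ +_) D≡2) (trans (sym (+-assoc B₀ 1 1)) (cong (_+ 1) B₀+1≡)))) ,
    trans (pow x) (cong (2 ^_) (trans ix≡ (+-comm 1 u))) , trans (pow x′) (cong (2 ^_) exponent)
    where
    open Even S (<-trans (s≤s z≤n) 1<k) D≡2 using (2∣a; 2∤B₀)
    pow : ∀ n → a ^ n ≡ 2 ^ (i * n)
    pow n = trans (cong (_^ n) a≡) (^-*-assoc 2 i n)
    0<m : 0 < i * e
    0<m = *-pos {i} {e} (n≢0⇒n>0 λ { refl → ∤1 prime[2] (subst (2 ∣_) a≡ 2∣a) }) 0<e
    0<u : 0 < u
    0<u with euclidsLemma G B₀ prime[2] (subst (2 ∣_) B≡ 2∣B)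
    ... | inj₁ h = n≢0⇒n>0 λ { refl → ∤1 prime[2] (subst (2 ∣_) G≡ h) }
    ... | inj₂ h = ⊥-elim (2∤B₀ h)
    exponent : i * x′ ≡ 2 * u + suc (i * e) + 1
    exponent = trans (cong (i *_) x₂≡) (trans (cong (λ w → i * (w * x + e)) k≡2)
      (trans (distrib i x e) (trans (cong (λ w → 2 * w + i * e) ix≡) (rearrange u (i * e)))))
      where
      distrib : ∀ i x e → i * (2 * x + e) ≡ 2 * (i * x) + i * e
      distrib = solve-∀
      rearrange : ∀ u m → 2 * (1 + u) + m ≡ 2 * u + (1 + m) + 1
      rearrange = solve-∀

odd+odd : ∀ {m n} → Odd m → Odd n → 2 ∣ m + n
odd+odd {m} {n} om on with parity m | parity n
... | inj₁ h | _ = ⊥-elim (om h)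
... | inj₂ _ | inj₁ h = ⊥-elim (on h)
... | inj₂ (i , refl) | inj₂ (j , refl) = divides (1 + i + j) (rearrange i j)
  where
  rearrange : ∀ i j → 1 + 2 * i + (1 + 2 * j) ≡ (1 + i + j) * 2
  rearrange = solve-∀

-- Halving the exponent splits off the factor `x + y`, which is even. This is the lower bound for
-- the power of 2 that `lifting` bounds from above.
2^∣geom : ∀ {x y} v m → Odd x → Odd y → 2 ^ v ∣ geom x y (2 ^ v * m)
2^∣geom         zero    m ox oy = 1∣ _
2^∣geom {x} {y} (suc v) m ox oy = subst (2 * 2 ^ v ∣_)
  (sym (trans (cong (geom x y) (*-assoc 2 (2 ^ v) m)) (geom-* x y 2 (2 ^ v * m))))
  (*-pres-∣ (subst (2 ∣_) (rearrange x y) (odd+odd ox oy)) (2^∣geom v m (∤-^ 2 prime[2] ox) (∤-^ 2 prime[2] oy)))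
  where
  rearrange : ∀ x y → x + y ≡ x * 1 + y * (1 + y * 0)
  rearrange = solve-∀

greatestOddDivisor : ∀ {N m} s → N ≡ 2 ^ s * m → 0 < m → Odd m → GreatestOddDivisor N m
greatestOddDivisor {N} {m} s N≡ 0<m om = om , subst (m ∣_) (sym N≡) (n∣m*n (2 ^ s)) , λ m′ om′ m′∣N →
  ∣⇒≤ {{>-nonZero 0<m}} (coprime-divisor (coprime-sym (coprimeFromPrimes (^-pos s (s≤s z≤n))
    λ p pp p∣2^s p∣m′ → om′ (subst (_∣ m′) (prime∣2^⇒≡2 s pp p∣2^s) p∣m′))) (subst (m′ ∣_) N≡ m′∣N))

module EvenExponents {a B C x k x′} (S : DiffStructure a B C x k x′) (0<k : 0 < k) (D≡2 : DiffStructure.D S ≡ 2) where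
  open DiffStructure S
  open Even S 0<k D≡2

  2^k*aᵉ≡ : ∀ {i A} → a ≡ 2 ^ i * A → 2 ^ k * a ^ e ≡ 2 ^ (k + i * e) * A ^ e
  2^k*aᵉ≡ {i} {A} a≡ = begin
    2 ^ k * a ^ e                       ≡⟨ cong (λ w → 2 ^ k * w ^ e) a≡ ⟩
    2 ^ k * (2 ^ i * A) ^ e             ≡⟨ cong (2 ^ k *_) (^-*-distrib (2 ^ i) A e) ⟩
    2 ^ k * ((2 ^ i) ^ e * A ^ e)       ≡⟨ cong (λ w → 2 ^ k * (w * A ^ e)) (^-*-assoc 2 i e) ⟩
    2 ^ k * (2 ^ (i * e) * A ^ e)       ≡⟨ sym (*-assoc (2 ^ k) (2 ^ (i * e)) (A ^ e)) ⟩
    2 ^ k * 2 ^ (i * e) * A ^ e         ≡⟨ cong (_* A ^ e) (sym (^-distribˡ-+-* 2 k (i * e))) ⟩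
    2 ^ (k + i * e) * A ^ e             ∎
    where open ≡-Reasoning

  -- The power of 2 in `(B₀ + 2)^k - B₀^k`, counted twice: in `d g` it is `1 + h + v`, because by
  -- lifting `g` contains no more factors 2 than `l`; in `2^k a^e` it is `k + i e`. This is the side
  -- condition of family (iv), `suc v` being the valuation of `k`.
  powerOf2-balance : ∀ {l h v o k₁ i A} → k ≡ 2 * l → 2 * B₀ + 2 ≡ 2 ^ h * o → Odd o → l ≡ 2 ^ v * k₁ → Odd k₁ →
    a ≡ 2 ^ i * A → Odd A → k + i * e ≡ h + suc v
  powerOf2-balance {l} {h} {v} {o} {k₁} {i} {A} k≡2l ho oo refl ok a≡ oA = finish (∣⇒∃* 2^v∣g)
    where
    g = geom (B₀ ^ 2 + d) (B₀ ^ 2) l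
    oddY : Odd (B₀ ^ 2)
    oddY = ∤-^ 2 prime[2] 2∤B₀
    2^v∣g : 2 ^ v ∣ g
    2^v∣g = 2^∣geom v k₁ (λ h → oddY (∣m+n∣m⇒∣n (subst (2 ∣_) (+-comm (B₀ ^ 2) d) h) (proj₁ lifts₂))) oddY
    finish : ∃[ τ ] g ≡ 2 ^ v * τ → k + i * e ≡ h + suc v
    finish (τ , g≡) = trans (sym (proj₁ (factorOut-unique (1 + h + v) (k + i * e) (s≤s (s≤s z≤n)) (∤-* prime[2] oo oτ) (∤-^ e prime[2] oA)
      (trans lhs (trans (halved l k≡2l) (2^k*aᵉ≡ {i} a≡)))))) (sym (+-suc h v))
      where
      oτ : Odd τ
      oτ 2∣τ = ok (*-cancelˡ-∣ (2 ^ v) {{>-nonZero (^-pos v (s≤s z≤n))}} (subst (_∣ l) (*-comm 2 (2 ^ v))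
        (lifting (2 * 2 ^ v) l (^-pos (suc v) (s≤s z≤n))
          (λ q pq q∣ → subst (λ w → Lifts w d (B₀ ^ 2)) (sym (prime∣2^⇒≡2 (suc v) pq q∣)) lifts₂)
          (subst₂ _∣_ (*-comm (2 ^ v) 2) (sym g≡) (*-monoʳ-∣ (2 ^ v) 2∣τ)))))
      lhs : 2 ^ (1 + h + v) * (o * τ) ≡ d * g
      lhs = trans (cong (λ w → 2 * w * (o * τ)) (^-distribˡ-+-* 2 h v))
        (trans (rearrange (2 ^ h) (2 ^ v) o τ) (sym (cong₂ (λ m n → 2 * m * n) ho g≡)))
        where
        rearrange : ∀ s t o τ → 2 * (s * t) * (o * τ) ≡ 2 * (s * o) * (t * τ)
        rearrange = solve-∀

-- The parameters are `g = A` (the odd part of `a`), `j = 1`, `u = x`, `d = B₀`, `w = e`. The factor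
-- `2^(iu - 1)` arises because `2 G = a^x`.
scaled-even⇒F₄ : ∀ {a b c x y z x′ y′ z′} i A → 0 < x → (S : ScaledSolution a b c x y z x′ y′ z′) →
  DiffStructure.D (proj₂ (proj₂ (proj₂ (proj₂ S)))) ≡ 2 → a ≡ 2 ^ i * A → Odd A → 1 < A → FamilyPair F₄ a b x y x′ y′
scaled-even⇒F₄ {a} {b} {c} {x} {y} {z} {x′} {y′} i A 0<x (k , 1<k , y′≡ , z′≡ , S) D≡2 a≡ oA 1<A
  = build (∣⇒∃* (2∣k 1<k)) (factorOut 2 (2 * B₀ + 2) (s≤s (s≤s z≤n)) (m≤n⇒m≤o+n (2 * B₀) (s≤s z≤n)))
  where
  open DiffStructure S
  0<k : 0 < k
  0<k = <-trans (s≤s z≤n) 1<k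
  open Even S 0<k D≡2
  open EvenExponents S 0<k D≡2
  0<A : 0 < A
  0<A = <-trans (s≤s z≤n) 1<A
  0<i : 0 < i
  0<i = n≢0⇒n>0 λ { refl → oA (subst (2 ∣_) (trans a≡ (*-identityˡ A)) 2∣a) }
  G≡ : G ≡ 2 ^ (i * x ∸ 1) * A ^ (1 * x)
  G≡ = proj₁ (halve (i * x) (trans (cong (G *_) (sym D≡2)) (trans (sym aˣ≡) (trans (cong (_^ x) a≡)
    (trans (^-*-distrib (2 ^ i) A x) (cong₂ _*_ (^-*-assoc 2 i x) (cong (A ^_) (sym (*-identityˡ x)))))))) (*-pos {i} {x} 0<i 0<x))
  N≡ : (B₀ + 2) ^ k ∸ B₀ ^ k ≡ 2 ^ (k + i * e) * A ^ e
  N≡ = trans (cong (_∸ B₀ ^ k) power₂) (trans (m+n∸m≡n (B₀ ^ k) (2 ^ k * a ^ e)) (2^k*aᵉ≡ {i} a≡))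
  build : ∃[ l ] k ≡ 2 * l → ∃[ h ] ∃[ o ] (2 * B₀ + 2 ≡ 2 ^ h * o × Odd o) → FamilyPair F₄ a b x y x′ y′
  build (l , k≡2l) (h , o , ho , oo) = withValuation (factorOut 2 l (s≤s (s≤s z≤n)) (*-pos⁻ʳ 2 l (subst (0 <_) k≡2l 0<k)))
    where
    withValuation : ∃[ v ] ∃[ k₁ ] (l ≡ 2 ^ v * k₁ × Odd k₁) → FamilyPair F₄ a b x y x′ y′
    withValuation (v , k₁ , l≡ , ok) =
      a , b ^ y , c ^ z , x , 1 , 1 , x′ , k , k ,
      (A , i , 1 , x , B₀ , k , e , h , suc v ,
       0<i , s≤s z≤n , 0<x , 0<B₀ , 2∤B₀ , 1<A , oA ,
       greatestOddDivisor (k + i * e) N≡ (^-pos e 0<A) (∤-^ e prime[2] oA) , 0<e , 0<k , 2∣k 1<k ,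
       exactPower {2} {h} (s≤s z≤n) ho oo ,
       exactPower {2} {suc v} (s≤s z≤n) (trans k≡2l (trans (cong (2 *_) l≡) (sym (*-assoc 2 (2 ^ v) k₁)))) ok ,
       trans (cong (_+ i * e) (*-identityˡ k)) (trans (powerOf2-balance {l} {h} {v} {i = i} k≡2l ho oo l≡ ok a≡ oA)
         (sym (cong₂ _+_ (*-identityˡ h) (*-identityˡ (suc v))))) ,
       trans a≡ (cong (2 ^ i *_) (sym (*-identityʳ A))) ,
       trans B≡ (cong (_* B₀) G≡) , trans C≡ (cong₂ (λ m n → m * (B₀ + n)) G≡ D≡2) ,
       refl , refl , refl ,
       trans (*-identityˡ x′) (trans x₂≡ (cong (_+ e) (sym (*-identityˡ (k * x))))) , refl , refl) ,
      inj₁ (refl , *-identityʳ (b ^ y)) , inj₁ (refl , base-power b y k y′≡)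

oddPart≡1 : ∀ {a i A} → a ≡ 2 ^ i * A → A ≡ 1 → a ≡ 2 ^ i
oddPart≡1 {i = i} a≡ A≡1 = trans a≡ (trans (cong (2 ^ i *_) A≡1) (*-identityʳ (2 ^ i)))

commonPrime-powerOf2 : ∀ {a b i} → 1 < gcd a b → a ≡ 2 ^ i → 2 ∣ b
commonPrime-powerOf2 {a} {b} {i} 1<gcd a≡ with gcd>1⇒commonPrime {a} {b} 1<gcd
... | p , pp , p∣a , p∣b = subst (_∣ b) (prime∣2^⇒≡2 i pp (subst (p ∣_) a≡ p∣a)) p∣b

scaled⇒Exceptional : ∀ {a b c x y z x′ y′ z′} → 1 < a → 1 < gcd a b → 0 < x → 0 < y →
  ScaledSolution a b c x y z x′ y′ z′ → Exceptional a b x y x′ y′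
scaled⇒Exceptional {a} {b} {c} {x} {y} {z} {x′} {y′} {z′} 1<a 1<gcd 0<x 0<y S@(k , 1<k , y′≡ , z′≡ , St) with DiffStructure.D≡1∨2 St
... | inj₁ D≡1 = inj₂ (inj₂ (inj₁ (scaled-odd⇒F₃ {c = c} {z = z} {z′ = z′} 1<a 0<x S D≡1)))
... | inj₂ D≡2 with factorOut 2 a (s≤s (s≤s z≤n)) (<-trans (s≤s z≤n) 1<a)
...   | i , A , a≡ , oA with A ≟ 1
...     | no A≢1 = inj₂ (inj₂ (inj₂ (scaled-even⇒F₄ {c = c} {z = z} {z′ = z′} i A 0<x S D≡2 a≡ oA
            (≤∧≢⇒< (n≢0⇒n>0 λ { refl → oA (2 ∣0) }) (A≢1 ∘ sym)))))
...     | yes A≡1 with powerOf2-values St i 0<x 1<k D≡2 (oddPart≡1 {i = i} a≡ A≡1)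
                        (∣-self^ y 0<y (commonPrime-powerOf2 {a} {b} {i} 1<gcd (oddPart≡1 {i = i} a≡ A≡1)))
...       | k≡2 , u , m , 0<u , 0<m , b≡ , c≡ , aˣ≡ , aˣ′≡ =
            inj₁ (F₁-pair {a} {b} {c} {x} {y} {z} {x′} u m 0<u 0<m b≡ c≡ aˣ≡ aˣ′≡ (trans y′≡ (cong (_* y) k≡2)))

Corr-swap : ∀ A B X Y a b x y → Corr A B X Y b a y x → Corr A B X Y a b x y
Corr-swap _ _ _ _ _ _ _ _ = swap-⊎

FamilyPair-swap : ∀ F a b x y x′ y′ → FamilyPair F b a y x y′ x′ → FamilyPair F a b x y x′ y′
FamilyPair-swap F a b x y x′ y′ (A , B , C , X₁ , Y₁ , Z₁ , X₂ , Y₂ , Z₂ , f , c₁ , c₂) =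
  A , B , C , X₁ , Y₁ , Z₁ , X₂ , Y₂ , Z₂ , f , Corr-swap A B X₁ Y₁ a b x y c₁ , Corr-swap A B X₂ Y₂ a b x′ y′ c₂

Exceptional-swap : ∀ {a b x y x′ y′} → Exceptional b a y x y′ x′ → Exceptional a b x y x′ y′
Exceptional-swap {a} {b} {x} {y} {x′} {y′} = map-⊎ (swap F₁) (map-⊎ (swap F₂) (map-⊎ (swap F₃) (swap F₄)))
  where
  swap : ∀ F → FamilyPair F b a y x y′ x′ → FamilyPair F a b x y x′ y′
  swap F = FamilyPair-swap F a b x y x′ y′

Sol-swap : ∀ {a b c x y z} → Sol a b c x y z → Sol b a c y x z
Sol-swap {a} {b} {c} {x} {y} (0<x , 0<y , 0<z , eq) = 0<y , 0<x , 0<z , trans (+-comm (b ^ y) (a ^ x)) eq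

-- Solutions with proportional x and y

-- Replace `δ` factors of each summand by the larger base `M`, and use `M^i < A^i + B^i`. For sums
-- the inequality runs opposite to `difference-growth`, so the surplus power of `c` falls on the
-- side of the smaller exponents.
sum-growth : ∀ {A B M} i δ → 0 < δ → 0 < A → A ≤ M → B ≤ M → M ^ i < A ^ i + B ^ i →
  (A ^ (i + δ) + B ^ (i + δ)) ^ i < (A ^ i + B ^ i) ^ (i + δ)
sum-growth {A} {B} {M} i δ 0<δ 0<A A≤M B≤M M<S = begin-strict
  (A ^ (i + δ) + B ^ (i + δ)) ^ i                ≤⟨ ^-monoˡ-≤ i (+-mono-≤ (bound A A≤M) (bound B B≤M)) ⟩
  (A ^ i * M ^ δ + B ^ i * M ^ δ) ^ i            ≡⟨ cong (_^ i) (sym (*-distribʳ-+ (M ^ δ) (A ^ i) (B ^ i))) ⟩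
  (S * M ^ δ) ^ i                                ≡⟨ trans (^-*-distrib S (M ^ δ) i) (cong (S ^ i *_) (^-^-comm M δ i)) ⟩
  S ^ i * (M ^ i) ^ δ                            <⟨ *-monoʳ-< (S ^ i) {{>-nonZero (^-pos i (m<n⇒0<n M<S))}} (^-monoˡ-< δ {{>-nonZero 0<δ}} M<S) ⟩
  S ^ i * S ^ δ                                  ≡⟨ sym (^-distribˡ-+-* S i δ) ⟩
  S ^ (i + δ)                                    ∎
  where
  open ≤-Reasoning
  S = A ^ i + B ^ i
  bound : ∀ X → X ≤ M → X ^ (i + δ) ≤ X ^ i * M ^ δ
  bound X X≤M = subst (_≤ X ^ i * M ^ δ) (sym (^-distribˡ-+-* X i δ)) (*-monoʳ-≤ (X ^ i) (^-monoˡ-≤ δ X≤M))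

sum∣sum^odd : ∀ x y m → x + y ∣ x ^ (1 + 2 * m) + y ^ (1 + 2 * m)
sum∣sum^odd x y zero    = ∣-reflexive (sym (cong₂ _+_ (*-identityʳ x) (*-identityʳ y)))
sum∣sum^odd x y (suc m) = subst (λ w → x + y ∣ x ^ (1 + w) + y ^ (1 + w)) (sym (*-suc 2 m))
  (∣m+n∣m⇒∣n (subst (x + y ∣_) (recurrence x y (x ^ (1 + 2 * m)) (y ^ (1 + 2 * m))) (m∣m*n _)) (∣n⇒∣m*n (x * y) (sum∣sum^odd x y m)))
  where
  recurrence : ∀ x y a b → (x + y) * (x * a + y * b) ≡ x * y * (a + b) + (x * (x * a) + y * (y * b))
  recurrence = solve-∀

sum-bound-large : ∀ {x y} n → 2 < x → y ≤ x → (x + y) * (3 + n) < x ^ (3 + n) + y ^ (3 + n)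
sum-bound-large {x} {y} n 2<x y≤x = begin-strict
  (x + y) * (3 + n)                    ≤⟨ *-monoˡ-≤ (3 + n) (+-monoʳ-≤ x y≤x) ⟩
  (x + x) * (3 + n)                    ≡⟨ rearrange x n ⟩
  x * (2 * (3 + n))                    <⟨ *-monoʳ-< x {{>-nonZero (<-trans (s≤s z≤n) 2<x)}} (*-monoˡ-< (3 + n) {2} {3} (s≤s (s≤s (s≤s z≤n)))) ⟩
  x * (3 * (3 + n))                    ≤⟨ *-monoʳ-≤ x (*-mono-≤ 2<x (1+k<m^k (suc n) 2<x (s≤s z≤n))) ⟩
  x ^ (3 + n)                          ≤⟨ m≤m+n (x ^ (3 + n)) (y ^ (3 + n)) ⟩
  x ^ (3 + n) + y ^ (3 + n)            ∎
  where
  open ≤-Reasoning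
  rearrange : ∀ x n → (x + x) * (3 + n) ≡ x * (2 * (3 + n))
  rearrange = solve-∀

sum-bound-two : ∀ n → 0 < n → 3 * (3 + n) < 2 ^ (3 + n) + 1 ^ (3 + n)
sum-bound-two n 0<n = begin-strict
  3 * (3 + n)                          ≡⟨ *-distribˡ-+ 3 3 n ⟩
  9 + 3 * n                            <⟨ +-mono-≤-< {9} {8 + n} (+-monoʳ-≤ 8 0<n) (*-monoˡ-< n {{>-nonZero 0<n}} {3} {7} (s≤s (s≤s (s≤s (s≤s z≤n))))) ⟩
  8 + n + 7 * n                        ≡⟨ rearrange n ⟩
  8 * (1 + n)                          ≤⟨ *-monoʳ-≤ 8 (k<m^k n (s≤s (s≤s z≤n))) ⟩
  8 * 2 ^ n                            ≡⟨ sym (^-distribˡ-+-* 2 3 n) ⟩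
  2 ^ (3 + n)                          ≤⟨ m≤m+n (2 ^ (3 + n)) (1 ^ (3 + n)) ⟩
  2 ^ (3 + n) + 1 ^ (3 + n)            ∎
  where
  open ≤-Reasoning
  rearrange : ∀ n → 8 + n + 7 * n ≡ 8 * (1 + n)
  rearrange = solve-∀

-- Equality `2³ + 1 = (2 + 1) · 3` is the single case in which the bound is attained; it is the
-- origin of family (ii).
sum-bound : ∀ {x y} n → 0 < y → y < x → x ^ (3 + n) + y ^ (3 + n) ≤ (x + y) * (3 + n) → n ≡ 0 × x ≡ 2 × y ≡ 1
sum-bound {x} {y} n 0<y y<x le with x ≟ 2
... | no x≢2 = contradiction le (<⇒≱ (sum-bound-large n (≤∧≢⇒< (≤-trans (s≤s 0<y) y<x) (x≢2 ∘ sym)) (<⇒≤ y<x)))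
... | yes refl with ≤-antisym (s≤s⁻¹ y<x) 0<y
...   | refl with n ≟ 0
...     | yes n≡0 = n≡0 , refl , refl
...     | no n≢0 = contradiction le (<⇒≱ (sum-bound-two n (n≢0⇒n>0 n≢0)))

-- Both sides are `(x^(2j) - y^(2j)) / (x² - y²)` with `x = y + d`. In this way a sum of powers is
-- turned into a geometric sum, to which lifting applies.
oddSum-cofactor : ∀ y d j T → 0 < y → 0 < d → (y + d) ^ j + y ^ j ≡ (y + d + y) * T →
  geom (y ^ 2 + d * (y + d + y)) (y ^ 2) j ≡ geom (y + d) y j * T
oddSum-cofactor y d j T 0<y 0<d eq = *-cancelˡ {D} (*-pos {d} 0<d (≤-trans 0<y (m≤n+m y (y + d)))) (+-cancelˡ-≡ ((y ^ 2) ^ j) _ _ (begin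
  (y ^ 2) ^ j + D * geom (y ^ 2 + D) (y ^ 2) j       ≡⟨ sym (^-diff (y ^ 2) D j) ⟩
  (y ^ 2 + D) ^ j                                    ≡⟨ cong (_^ j) (square y d) ⟩
  ((y + d) ^ 2) ^ j                                  ≡⟨ ^-^-comm (y + d) 2 j ⟩
  (X ^ 2)                                            ≡⟨ expand X ⟩
  X * X                                              ≡⟨ cong (X *_) (^-diff y d j) ⟩
  X * (y ^ j + d * g)                                ≡⟨ *-distribˡ-+ X (y ^ j) (d * g) ⟩
  X * y ^ j + X * (d * g)                            ≡⟨ cong (λ w → w * y ^ j + X * (d * g)) (^-diff y d j) ⟩
  (y ^ j + d * g) * y ^ j + X * (d * g)              ≡⟨ collect (y ^ j) (d * g) X ⟩
  y ^ j * y ^ j + d * g * (X + y ^ j)                ≡⟨ cong (λ w → y ^ j * y ^ j + d * g * w) eq ⟩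
  y ^ j * y ^ j + d * g * ((y + d + y) * T)          ≡⟨ cong₂ _+_ (trans (sym (expand (y ^ j))) (^-^-comm y j 2)) (rearrange d g (y + d + y) T) ⟩
  (y ^ 2) ^ j + D * (g * T)                          ∎))
  where
  open ≡-Reasoning
  D = d * (y + d + y)
  X = (y + d) ^ j
  g = geom (y + d) y j
  square : ∀ y d → y * (y * 1) + d * (y + d + y) ≡ (y + d) * ((y + d) * 1)
  square = solve-∀
  expand : ∀ m → m * (m * 1) ≡ m * m
  expand = solve-∀
  collect : ∀ a b c → (a + b) * a + c * b ≡ a * a + b * (c + a)
  collect = solve-∀
  rearrange : ∀ d g s T → d * g * (s * T) ≡ d * s * (g * T)
  rearrange = solve-∀

-- The cofactor T of x + y in xʲ + yʲ divides geom x² y² j, so lifting bounds it by j.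
oddSum-case : ∀ y d j n T → 0 < y → 0 < d → j ≡ 3 + n → (y + d) ^ j + y ^ j ≡ (y + d + y) * T →
  (∀ q → Prime q → q ∣ (y + d) ^ j + y ^ j → Mod q ((y + d) ^ 2) (y ^ 2) × ¬ q ∣ y) →
  n ≡ 0 × y + d ≡ 2 × y ≡ 1
oddSum-case y d j n T 0<y 0<d j≡ eq primes = sum-bound {y + d} {y} n 0<y (m<m+n y 0<d)
    (subst (λ w → (y + d) ^ w + y ^ w ≤ (y + d + y) * w) j≡
      (subst (_≤ (y + d + y) * j) (sym eq) (*-monoʳ-≤ (y + d + y) (∣⇒≤ {{>-nonZero 0<j}} T∣j))))
  where
  0<j : 0 < j
  0<j = subst (0 <_) (sym j≡) (s≤s z≤n)
  D = d * (y + d + y)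
  square : (y + d) ^ 2 ≡ y ^ 2 + D
  square = rearrange y d
    where
    rearrange : ∀ y d → (y + d) * ((y + d) * 1) ≡ y * (y * 1) + d * (y + d + y)
    rearrange = solve-∀
  s≡ : y + d + y ≡ 2 * y + d
  s≡ = rearrange y d
    where
    rearrange : ∀ y d → y + d + y ≡ 2 * y + d
    rearrange = solve-∀
  0<T : 0 < T
  0<T = *-pos⁻ʳ (y + d + y) T (subst (0 <_) eq (≤-trans (^-pos j 0<y) (m≤n+m (y ^ j) ((y + d) ^ j))))
  -- In `D = d (2y + d)` the two factors have the same parity.
  4∣D : 2 ∣ D → 4 ∣ D
  4∣D 2∣D = *-pres-∣ 2∣d (subst (2 ∣_) (sym s≡) (∣m∣n⇒∣m+n (m∣m*n y) 2∣d))
    where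
    2∣d : 2 ∣ d
    2∣d with euclidsLemma d (y + d + y) prime[2] 2∣D
    ... | inj₁ h = h
    ... | inj₂ h = ∣m+n∣m⇒∣n (subst (2 ∣_) s≡ h) (m∣m*n y)
  lifts : ∀ q → Prime q → q ∣ T → Lifts q D (y ^ 2)
  lifts q pq q∣T with primes q pq (subst (q ∣_) (sym eq) (∣n⇒∣m*n (y + d + y) q∣T))
  ... | x²≈y² , q∤y = q∣D , ∤-^ 2 pq q∤y , λ q≡2 → 4∣D (subst (_∣ D) q≡2 q∣D)
    where
    q∣D : q ∣ D
    q∣D = Mod⇒∣ (y ^ 2) (subst (λ w → Mod q w (y ^ 2)) square x²≈y²)
  T∣j : T ∣ j
  T∣j = lifting T j 0<T lifts (subst (T ∣_) (sym (oddSum-cofactor y d j T 0<y 0<d eq)) (n∣m*n (geom (y + d) y j)))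

-- Replaces `X ≡ -Y` by a congruence between natural numbers, to which the coprime-exponent argument
-- applies.
squares-Mod : ∀ {q X Y} → q ∣ X + Y → Mod q (X ^ 2) (Y ^ 2)
squares-Mod {q} {X} {Y} (divides w eq) = slack (Y * w) (X * w)
  (trans (left X Y q w) (trans (cong (λ s → X * (X * 1) + Y * s) (sym eq)) (trans (middle X Y)
    (trans (cong (λ s → Y * (Y * 1) + X * s) eq) (sym (left Y X q w))))))
  where
  left : ∀ X Y q w → X * (X * 1) + q * (Y * w) ≡ X * (X * 1) + Y * (w * q)
  left = solve-∀
  middle : ∀ X Y → X * (X * 1) + Y * (X + Y) ≡ Y * (Y * 1) + X * (X + Y)
  middle = solve-∀

odd²≈1 : ∀ {m} → Odd m → Mod 4 (m ^ 2) 1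
odd²≈1 {m} om with parity m
... | inj₁ h = ⊥-elim (om h)
... | inj₂ (n , refl) = slack 0 (n + n * n) (rearrange n)
  where
  rearrange : ∀ n → (1 + 2 * n) * ((1 + 2 * n) * 1) + 0 ≡ 1 + 4 * (n + n * n)
  rearrange = solve-∀

sum≡2⇒≡1 : ∀ {m n} → 0 < m → 0 < n → m + n ≡ 2 → m ≡ 1 × n ≡ 1
sum≡2⇒≡1 {suc zero}    {suc zero}    _ _ _ = refl , refl
sum≡2⇒≡1 {suc zero}    {suc (suc n)} _ _ ()
sum≡2⇒≡1 {suc (suc m)} {suc n}       _ _ eq with trans (sym (+-suc m n)) (cong (_∸ 2) eq)
... | ()

-- Primes of A₀ʲ + B₀ʲ that also divide A₀ⁱ + B₀ⁱ satisfy A₀² ≡ B₀²; this leaves A₀ = B₀ = 1, or 2 + 1 = 3 and 8 + 1 = 9.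
coprimeSums : ∀ A₀ B₀ i j → 0 < A₀ → 0 < B₀ → Coprime A₀ B₀ → 0 < i → i < j → Coprime i j →
  (∀ q → Prime q → q ∣ A₀ ^ j + B₀ ^ j → q ∣ A₀ ^ i + B₀ ^ i) →
  (A₀ ≡ 1 × B₀ ≡ 1) ⊎ (j ≡ 3 × (A₀ ≡ 2 × B₀ ≡ 1 ⊎ A₀ ≡ 1 × B₀ ≡ 2))
coprimeSums A₀ B₀ i j 0<A 0<B cop 0<i i<j copᵢⱼ primes = byParity (parity j)
  where
  0<j : 0 < j
  0<j = <-trans 0<i i<j
  common : ∀ q → Prime q → q ∣ A₀ ^ j + B₀ ^ j → ¬ q ∣ A₀ × ¬ q ∣ B₀ × Mod q (A₀ ^ 2) (B₀ ^ 2)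
  common q pq q∣N = q∤A , q∤B , Mod-coprimeExponents i j pq (∤-^ 2 pq q∤A) copᵢⱼ
      (subst₂ (Mod q) (^-^-comm A₀ i 2) (^-^-comm B₀ i 2) (squares-Mod {q} {A₀ ^ i} {B₀ ^ i} (primes q pq q∣N)))
      (subst₂ (Mod q) (^-^-comm A₀ j 2) (^-^-comm B₀ j 2) (squares-Mod {q} {A₀ ^ j} {B₀ ^ j} q∣N))
    where
    q∤A : ¬ q ∣ A₀
    q∤A q∣A = coprime-∤ pq cop q∣A (prime∣^ j pq (∣m+n∣m⇒∣n q∣N (∣-self^ j 0<j q∣A)))
    q∤B : ¬ q ∣ B₀
    q∤B q∣B = q∤A (prime∣^ j pq (∣m+n∣m⇒∣n (subst (q ∣_) (+-comm (A₀ ^ j) (B₀ ^ j)) q∣N) (∣-self^ j 0<j q∣B)))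
  Goal = (A₀ ≡ 1 × B₀ ≡ 1) ⊎ (j ≡ 3 × (A₀ ≡ 2 × B₀ ≡ 1 ⊎ A₀ ≡ 1 × B₀ ≡ 2))
  -- For even `j`, `A₀² ≡ B₀²` gives `A₀^j ≡ B₀^j`, so an odd common prime would divide `2 B₀^j`;
  -- and a sum of two odd squares is 2 modulo 4. The sum is therefore at most 2.
  even : ∀ l → j ≡ 2 * l → Goal
  even l j≡ = finish (oneOrTwo {A₀ ^ j + B₀ ^ j} (≤-trans (^-pos j 0<A) (m≤m+n _ _))
      (λ q pq q≢2 q∣N → only2 q pq q≢2 q∣N (common q pq q∣N))
      (λ 4∣N → no4 4∣N (common 2 prime[2] (∣-trans (divides 2 refl) 4∣N))))
    where
    pow : ∀ x → (x ^ 2) ^ l ≡ x ^ j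
    pow x = trans (^-*-assoc x 2 l) (cong (x ^_) (sym j≡))
    only2 : ∀ q → Prime q → q ≢ 2 → q ∣ A₀ ^ j + B₀ ^ j → ¬ q ∣ A₀ × ¬ q ∣ B₀ × Mod q (A₀ ^ 2) (B₀ ^ 2) → ⊥
    only2 q pq q≢2 q∣N (_ , q∤B , m) = ∤-* pq (q≢2 ∘ prime∣2 pq) (∤-^ j pq q∤B) (subst (q ∣_) (rearrange (B₀ ^ j))
        (Mod-∣ (Mod-+ (subst₂ (Mod q) (pow A₀) (pow B₀) (Mod-^ l m)) (Mod-refl {q} {B₀ ^ j})) q∣N))
      where
      rearrange : ∀ b → b + b ≡ 2 * b
      rearrange = solve-∀
    no4 : 4 ∣ A₀ ^ j + B₀ ^ j → ¬ 2 ∣ A₀ × ¬ 2 ∣ B₀ × Mod 2 (A₀ ^ 2) (B₀ ^ 2) → ⊥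
    no4 4∣N (2∤A , 2∤B , _) = <⇒≱ (s≤s (s≤s (s≤s z≤n))) (∣⇒≤ (Mod-∣ (Mod-+ (one A₀ 2∤A) (one B₀ 2∤B)) 4∣N))
      where
      one : ∀ x → Odd x → Mod 4 (x ^ j) 1
      one x ox = subst₂ (Mod 4) (pow x) (^-zeroˡ l) (Mod-^ l (odd²≈1 ox))
    finish : A₀ ^ j + B₀ ^ j ≡ 1 ⊎ A₀ ^ j + B₀ ^ j ≡ 2 → Goal
    finish (inj₁ N≡1) = contradiction N≡1 (<⇒≢ (+-mono-≤ (^-pos j 0<A) (^-pos j 0<B)) ∘ sym)
    finish (inj₂ N≡2) with sum≡2⇒≡1 (^-pos j 0<A) (^-pos j 0<B) N≡2
    ... | A≡1 , B≡1 = inj₁ (^≡1⇒≡1 A₀ j 0<j A≡1 , ^≡1⇒≡1 B₀ j 0<j B≡1)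
  odd : ∀ m → j ≡ 1 + 2 * m → Goal
  odd zero    j≡ = contradiction (subst (i <_) j≡ i<j) (<⇒≱ (s≤s 0<i))
  odd (suc n) j≡ = compare (∣⇒∃* (subst (λ w → A₀ + B₀ ∣ A₀ ^ w + B₀ ^ w) (sym j≡) (sum∣sum^odd A₀ B₀ (suc n))))
    where
    j≡′ : j ≡ 3 + 2 * n
    j≡′ = trans j≡ (cong suc (*-suc 2 n))
    j≡3 : 2 * n ≡ 0 → j ≡ 3
    j≡3 2n≡0 = trans j≡′ (cong (3 +_) 2n≡0)
    compare : ∃[ T ] A₀ ^ j + B₀ ^ j ≡ (A₀ + B₀) * T → Goal
    compare (T , eq) with <-cmp A₀ B₀
    ... | tri≈ _ A≡B _ = inj₁ (cop (∣-refl , ∣-reflexive A≡B) , cop (∣-reflexive (sym A≡B) , ∣-refl))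
    ... | tri> _ _ B<A = finish (<⇒∃+ B<A)
      where
      finish : ∃[ d ] (0 < d × A₀ ≡ B₀ + d) → Goal
      finish (d , 0<d , A≡) =
        let 2n≡0 , A≡2 , B≡1 = oddSum-case B₀ d j (2 * n) T 0<B 0<d j≡′ (subst (λ w → w ^ j + B₀ ^ j ≡ (w + B₀) * T) A≡ eq)
              (λ q pq q∣N → let _ , q∤B , m = common q pq (subst (λ w → q ∣ w ^ j + B₀ ^ j) (sym A≡) q∣N)
                            in subst (λ w → Mod q (w ^ 2) (B₀ ^ 2)) A≡ m , q∤B)
        in inj₂ (j≡3 2n≡0 , inj₁ (trans A≡ A≡2 , B≡1))
    ... | tri< A<B _ _ = finish (<⇒∃+ A<B)
      where
      flip : ∀ {x y} → x ^ j + y ^ j ≡ (x + y) * T → y ^ j + x ^ j ≡ (y + x) * T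
      flip {x} {y} h = trans (+-comm (y ^ j) (x ^ j)) (trans h (cong (_* T) (+-comm x y)))
      finish : ∃[ d ] (0 < d × B₀ ≡ A₀ + d) → Goal
      finish (d , 0<d , B≡) =
        let 2n≡0 , B≡2 , A≡1 = oddSum-case A₀ d j (2 * n) T 0<A 0<d j≡′ (subst (λ w → w ^ j + A₀ ^ j ≡ (w + A₀) * T) B≡ (flip {A₀} {B₀} eq))
              (λ q pq q∣N → let q∤A , _ , m = common q pq (subst (q ∣_) (+-comm (B₀ ^ j) (A₀ ^ j)) (subst (λ w → q ∣ w ^ j + A₀ ^ j) (sym B≡) q∣N))
                            in subst (λ w → Mod q (w ^ 2) (A₀ ^ 2)) B≡ (Mod-sym m) , q∤A)
        in inj₂ (j≡3 2n≡0 , inj₂ (A≡1 , trans B≡ B≡2))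
  byParity : 2 ∣ j ⊎ ∃[ m ] j ≡ 1 + 2 * m → Goal
  byParity (inj₁ 2∣j) = even (proj₁ (∣⇒∃* 2∣j)) (proj₂ (∣⇒∃* 2∣j))
  byParity (inj₂ (m , j≡)) = odd m j≡

-- Comparing `c^(z₁ j)` with `c^(z₂ i)` and cancelling `G^(ij)` gives `Nᵢ^j = Nⱼ^i c^e` with
-- `e > 0`. Hence every prime of `Nⱼ`, and every prime of `c`, divides `Nᵢ`.
sumCore : ∀ {A B c} z₁ z₂ i j → 1 < c → 0 < A → 0 < B → 0 < i → i < j → Coprime i j →
  A ^ i + B ^ i ≡ c ^ z₁ → A ^ j + B ^ j ≡ c ^ z₂ →
  (A ≡ B × (∀ q → Prime q → q ∣ c → q ≡ 2)) ⊎
  (i ≡ 1 × j ≡ 3 × c ≡ 3 × ∃[ G ] (0 < G × (A ≡ G * 2 × B ≡ G * 1 ⊎ A ≡ G * 1 × B ≡ G * 2)))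
sumCore {A} {B} {c} z₁ z₂ i j 1<c 0<A 0<B 0<i i<j cop eq₁ eq₂ with gcdSplit A B 0<A
... | G , A₀ , B₀ , 0<G , refl , refl , copAB = conclude (coprimeSums A₀ B₀ i j (*-pos⁻ʳ G A₀ 0<A) (*-pos⁻ʳ G B₀ 0<B) copAB 0<i i<j cop
      λ q pq q∣N → prime∣^ j pq (subst (q ∣_) (sym cross) (∣m⇒∣m*n (c ^ e) (∣-self^ i 0<i q∣N))))
  where
  0<c : 0 < c
  0<c = <-trans (s≤s z≤n) 1<c
  Nᵢ = A₀ ^ i + B₀ ^ i
  Nⱼ = A₀ ^ j + B₀ ^ j
  value : ∀ k → (G * A₀) ^ k + (G * B₀) ^ k ≡ G ^ k * (A₀ ^ k + B₀ ^ k)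
  value k = trans (cong₂ _+_ (^-*-distrib G A₀ k) (^-*-distrib G B₀ k)) (sym (*-distribˡ-+ (G ^ k) (A₀ ^ k) (B₀ ^ k)))
  growth : ((G * A₀) ^ j + (G * B₀) ^ j) ^ i < ((G * A₀) ^ i + (G * B₀) ^ i) ^ j
  growth with <⇒∃+ i<j | ≤-total (G * A₀) (G * B₀)
  ... | δ , 0<δ , refl | inj₁ A≤B = sum-growth i δ 0<δ 0<A A≤B ≤-refl (m<n+m _ (^-pos i 0<A))
  ... | δ , 0<δ , refl | inj₂ B≤A = sum-growth i δ 0<δ 0<A ≤-refl B≤A (m<m+n _ (^-pos i 0<B))
  gap : ∃[ e ] (0 < e × z₁ * j ≡ z₂ * i + e)
  gap = <⇒∃+ (^-cancelʳ-< (z₂ * i) (z₁ * j) 0<c (subst₂ _<_ (trans (cong (_^ i) eq₂) (^-*-assoc c z₂ i))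
    (trans (cong (_^ j) eq₁) (^-*-assoc c z₁ j)) growth))
  e = proj₁ gap
  cross : Nᵢ ^ j ≡ Nⱼ ^ i * c ^ e
  cross = *-cancelˡ (^-pos j (^-pos i 0<G)) (begin
    (G ^ i) ^ j * Nᵢ ^ j              ≡⟨ sym (^-*-distrib (G ^ i) Nᵢ j) ⟩
    (G ^ i * Nᵢ) ^ j                  ≡⟨ cong (_^ j) (trans (sym (value i)) eq₁) ⟩
    (c ^ z₁) ^ j                      ≡⟨ trans (^-*-assoc c z₁ j) (cong (c ^_) (proj₂ (proj₂ gap))) ⟩
    c ^ (z₂ * i + e)                  ≡⟨ trans (^-distribˡ-+-* c (z₂ * i) e) (cong (_* c ^ e) (sym (^-*-assoc c z₂ i))) ⟩
    (c ^ z₂) ^ i * c ^ e              ≡⟨ cong (λ w → w ^ i * c ^ e) (trans (sym eq₂) (value j)) ⟩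
    (G ^ j * Nⱼ) ^ i * c ^ e          ≡⟨ cong (_* c ^ e) (trans (^-*-distrib (G ^ j) Nⱼ i) (cong (_* Nⱼ ^ i) (^-^-comm G j i))) ⟩
    (G ^ i) ^ j * Nⱼ ^ i * c ^ e      ≡⟨ *-assoc ((G ^ i) ^ j) (Nⱼ ^ i) (c ^ e) ⟩
    (G ^ i) ^ j * (Nⱼ ^ i * c ^ e)    ∎)
    where open ≡-Reasoning
  Goal = (G * A₀ ≡ G * B₀ × (∀ q → Prime q → q ∣ c → q ≡ 2)) ⊎
    (i ≡ 1 × j ≡ 3 × c ≡ 3 × ∃[ H ] (0 < H × (G * A₀ ≡ H * 2 × G * B₀ ≡ H * 1 ⊎ G * A₀ ≡ H * 1 × G * B₀ ≡ H * 2)))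
  c∣cross : ∀ q → q ∣ c → q ∣ Nᵢ ^ j
  c∣cross q q∣c = subst (q ∣_) (sym cross) (∣n⇒∣m*n (Nⱼ ^ i) (∣-self^ e (proj₁ (proj₂ gap)) q∣c))
  cube : i < 3 → (∀ k → A₀ ^ k + B₀ ^ k ≡ 2 ^ k + 1) → j ≡ 3 → i ≡ 1 × c ≡ 3
  cube i<3 N≡ j≡3 = oneCase i 0<i i<3 (subst₂ (λ m n → m ^ 3 ≡ n ^ i * c ^ e) (N≡ i) (trans (N≡ j) (cong (λ w → 2 ^ w + 1) j≡3))
    (subst (λ w → Nᵢ ^ w ≡ Nⱼ ^ i * c ^ e) j≡3 cross))
    where
    -- For `i = 1` the relation is `27 = 9 c^e`; for `i = 2` it is `125 = 81 c^e`, impossible modulo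
    -- 3.
    oneCase : ∀ i → 0 < i → i < 3 → (2 ^ i + 1) ^ 3 ≡ 9 ^ i * c ^ e → i ≡ 1 × c ≡ 3
    oneCase 1 _ _ eq = refl , c≡3
      where
      c^e≡3 : c ^ e ≡ 3
      c^e≡3 = *-cancelˡ {9} {c ^ e} {3} (s≤s z≤n) (sym eq)
      c≡3 : c ≡ 3
      c≡3 with prime⇒irreducible (toWitness {a? = prime? 3} _) (subst (c ∣_) c^e≡3 (∣-self^ e (proj₁ (proj₂ gap)) ∣-refl))
      ... | inj₁ c≡1 = contradiction c≡1 (<⇒≢ 1<c ∘ sym)
      ... | inj₂ h = h
    oneCase 2 _ _ eq = contradiction (subst (3 ∣_) (sym eq) (∣m⇒∣m*n (c ^ e) (divides 27 refl))) (toWitnessFalse {a? = 3 ∣? 125} _)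
    oneCase (suc (suc (suc i))) _ (s≤s (s≤s (s≤s ()))) _
  conclude : (A₀ ≡ 1 × B₀ ≡ 1) ⊎ (j ≡ 3 × (A₀ ≡ 2 × B₀ ≡ 1 ⊎ A₀ ≡ 1 × B₀ ≡ 2)) → Goal
  conclude (inj₁ (A≡1 , B≡1)) = inj₁ (cong (G *_) (trans A≡1 (sym B≡1)) , λ q pq q∣c → prime∣2 pq (subst (q ∣_) Nᵢ≡2 (prime∣^ j pq (c∣cross q q∣c))))
    where
    Nᵢ≡2 : Nᵢ ≡ 2
    Nᵢ≡2 = cong₂ _+_ (trans (cong (_^ i) A≡1) (^-zeroˡ i)) (trans (cong (_^ i) B≡1) (^-zeroˡ i))
  conclude (inj₂ (j≡3 , inj₁ (A≡2 , B≡1))) =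
    let i≡1 , c≡3 = cube (subst (i <_) j≡3 i<j) (λ k → cong₂ _+_ (cong (_^ k) A≡2) (trans (cong (_^ k) B≡1) (^-zeroˡ k))) j≡3
    in inj₂ (i≡1 , j≡3 , c≡3 , G , 0<G , inj₁ (cong (G *_) A≡2 , cong (G *_) B≡1))
  conclude (inj₂ (j≡3 , inj₂ (A≡1 , B≡2))) =
    let i≡1 , c≡3 = cube (subst (i <_) j≡3 i<j)
          (λ k → trans (+-comm (A₀ ^ k) (B₀ ^ k)) (cong₂ _+_ (cong (_^ k) B≡2) (trans (cong (_^ k) A≡1) (^-zeroˡ k)))) j≡3
    in inj₂ (i≡1 , j≡3 , c≡3 , G , 0<G , inj₂ (cong (G *_) A≡1 , cong (G *_) B≡2))

onlyPrime2⇒powerOf2 : ∀ {n} → 0 < n → (∀ q → Prime q → q ∣ n → q ≡ 2) → IsPowerOf2 n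
onlyPrime2⇒powerOf2 {n} 0<n only with factorOut 2 n (s≤s (s≤s z≤n)) 0<n
... | k , m , refl , om = k , trans (cong (2 ^ k *_) m≡1) (*-identityʳ (2 ^ k))
  where
  m≡1 : m ≡ 1
  m≡1 = noPrimeDivisor⇒1 (*-pos⁻ʳ (2 ^ k) m 0<n) λ q pq q∣m →
    om (subst (_∣ m) (only q pq (∣n⇒∣m*n (2 ^ k) q∣m)) q∣m)

F₂-pair : ∀ {a b x y x′ y′} t → 0 < t → a ^ x ≡ 2 * 3 ^ t → b ^ y ≡ 3 ^ t → x′ ≡ 3 * x → y′ ≡ 3 * y → FamilyPair F₂ a b x y x′ y′
F₂-pair {a} {b} {x} {y} t 0<t a≡ b≡ refl refl =
  2 * 3 ^ t , 3 , 3 , 1 , t , t + 1 , 3 , 3 * t , 3 * t + 2 ,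
  (t , 0<t , refl , refl , refl , refl , refl , refl , refl , refl , refl) ,
  inj₁ (trans (*-identityʳ (2 * 3 ^ t)) (sym a≡) , sym b≡) ,
  inj₁ (trans (cong (_^ 3) (sym a≡)) (base-power a x 3 refl) ,
        trans (cong (3 ^_) (*-comm 3 t)) (trans (sym (^-*-assoc 3 t 3)) (trans (cong (_^ 3) (sym b≡)) (base-power b y 3 refl))))

-- The alternative `A = B` of `sumCore` makes 2 the only prime of `a`, `b` and `c`, which is the
-- excluded case of three powers of 2. The other alternative is family (ii), possibly with `a` and
-- `b` exchanged.
sumRatio-scaled : ∀ {a b c z₁ z₂} X Y i j → 1 < a → 1 < b → 1 < c → ¬ (IsPowerOf2 a × IsPowerOf2 b × IsPowerOf2 c) →
  0 < X → 0 < Y → 0 < z₁ → 0 < i → i < j → Coprime i j →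
  a ^ (X * i) + b ^ (Y * i) ≡ c ^ z₁ → a ^ (X * j) + b ^ (Y * j) ≡ c ^ z₂ →
  FamilyPair F₂ a b (X * i) (Y * i) (X * j) (Y * j)
sumRatio-scaled {a} {b} {c} {z₁} {z₂} X Y i j 1<a 1<b 1<c notPow2 0<X 0<Y 0<z₁ 0<i i<j cop eq₁ eq₂ =
  finish (sumCore z₁ z₂ i j 1<c (^-pos X 0<a) (^-pos Y 0<b) 0<i i<j cop (based i eq₁) (based j eq₂))
  where
  0<a : 0 < a
  0<a = <-trans (s≤s z≤n) 1<a
  0<b : 0 < b
  0<b = <-trans (s≤s z≤n) 1<b
  A = a ^ X
  B = b ^ Y
  based : ∀ k {w} → a ^ (X * k) + b ^ (Y * k) ≡ w → A ^ k + B ^ k ≡ w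
  based k eq = trans (cong₂ _+_ (^-*-assoc a X k) (^-*-assoc b Y k)) eq
  threePower : ∀ {G} z → 0 < z → G * 3 ≡ 3 ^ z → ∃[ t ] G ≡ 3 ^ t
  threePower {G} (suc t) _ eq = t , *-cancelˡ {3} (s≤s z≤n) (trans (*-comm 3 G) eq)
  0<t : ∀ t {n k} → 1 < n → 0 < k → n ^ k ≡ 3 ^ t → 0 < t
  0<t t {n} {k} 1<n 0<k eq = n≢0⇒n>0 λ { refl → <⇒≢ (1<^ k 1<n 0<k) (sym eq) }
  triple : ∀ m → i ≡ 1 → j ≡ 3 → m * j ≡ 3 * (m * i)
  triple m refl refl = trans (*-comm m 3) (cong (3 *_) (sym (*-identityʳ m)))
  unit : ∀ n m {w} → i ≡ 1 → n ^ m ≡ w → n ^ (m * i) ≡ w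
  unit n m refl eq = trans (cong (n ^_) (*-identityʳ m)) eq
  finish : _ → FamilyPair F₂ a b (X * i) (Y * i) (X * j) (Y * j)
  finish (inj₁ (A≡B , only)) = ⊥-elim (notPow2 (onlyPrime2⇒powerOf2 0<a (λ q pq q∣a → base q pq (∣-self^ X 0<X q∣a)) ,
      onlyPrime2⇒powerOf2 0<b (λ q pq q∣b → base q pq (subst (q ∣_) (sym A≡B) (∣-self^ Y 0<Y q∣b))) ,
      onlyPrime2⇒powerOf2 (<-trans (s≤s z≤n) 1<c) only))
    where
    base : ∀ q → Prime q → q ∣ A → q ≡ 2
    base q pq q∣A = only q pq (prime∣^ z₁ pq (subst (q ∣_) (based i eq₁)
      (∣m∣n⇒∣m+n (∣-self^ i 0<i q∣A) (∣-self^ i 0<i (subst (q ∣_) A≡B q∣A)))))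
  finish (inj₂ (i≡1 , j≡3 , c≡3 , G , 0<G , shape)) = byShape shape
    where
    sum₁ : A + B ≡ 3 ^ z₁
    sum₁ = trans (sym (cong₂ _+_ (*-identityʳ A) (*-identityʳ B))) (trans (subst (λ w → A ^ w + B ^ w ≡ c ^ z₁) i≡1 (based i eq₁)) (cong (_^ z₁) c≡3))
    byShape : (A ≡ G * 2 × B ≡ G * 1 ⊎ A ≡ G * 1 × B ≡ G * 2) → FamilyPair F₂ a b (X * i) (Y * i) (X * j) (Y * j)
    byShape (inj₁ (A≡ , B≡)) =
      let t , G≡ = threePower z₁ 0<z₁ (trans (*-distribˡ-+ G 2 1) (trans (sym (cong₂ _+_ A≡ B≡)) sum₁))
          B≡3ᵗ = trans B≡ (trans (*-identityʳ G) G≡)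
      in F₂-pair {a} {b} {X * i} {Y * i} t (0<t t {b} {Y} 1<b 0<Y B≡3ᵗ) (unit a X i≡1 (trans A≡ (trans (*-comm G 2) (cong (2 *_) G≡))))
           (unit b Y i≡1 B≡3ᵗ) (triple X i≡1 j≡3) (triple Y i≡1 j≡3)
    byShape (inj₂ (A≡ , B≡)) =
      let t , G≡ = threePower z₁ 0<z₁ (trans (*-distribˡ-+ G 1 2) (trans (sym (cong₂ _+_ A≡ B≡)) sum₁))
          A≡3ᵗ = trans A≡ (trans (*-identityʳ G) G≡)
      in FamilyPair-swap F₂ a b (X * i) (Y * i) (X * j) (Y * j)
           (F₂-pair {b} {a} {Y * i} {X * i} t (0<t t {a} {X} 1<a 0<X A≡3ᵗ) (unit b Y i≡1 (trans B≡ (trans (*-comm G 2) (cong (2 *_) G≡))))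
             (unit a X i≡1 A≡3ᵗ) (triple Y i≡1 j≡3) (triple X i≡1 j≡3))

sumRatio : ∀ {a b c x₁ y₁ z₁ x₂ y₂ z₂} → 1 < a → 1 < b → 1 < c → ¬ (IsPowerOf2 a × IsPowerOf2 b × IsPowerOf2 c) →
  Sol a b c x₁ y₁ z₁ → Sol a b c x₂ y₂ z₂ → x₁ * y₂ ≡ x₂ * y₁ →
  (x₁ ≡ x₂ × y₁ ≡ y₂) ⊎ FamilyPair F₂ a b x₁ y₁ x₂ y₂ ⊎ FamilyPair F₂ a b x₂ y₂ x₁ y₁
sumRatio {a} {b} {c} {x₁} {y₁} {z₁} {x₂} {y₂} {z₂} 1<a 1<b 1<c notPow2 (0<x₁ , 0<y₁ , 0<z₁ , eq₁) (0<x₂ , 0<y₂ , 0<z₂ , eq₂) ratio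
  with gcdSplit x₁ x₂ 0<x₁
... | X , i , j , 0<X , refl , refl , cop = finish (∣⇒∃* (coprime-divisor cop (divides y₂ (trans (sym reduced) (*-comm i y₂)))))
  where
  reduced : i * y₂ ≡ j * y₁
  reduced = *-cancelˡ 0<X (trans (sym (*-assoc X i y₂)) (trans ratio (*-assoc X j y₁)))
  0<i : 0 < i
  0<i = *-pos⁻ʳ X i 0<x₁
  0<j : 0 < j
  0<j = *-pos⁻ʳ X j 0<x₂
  finish : ∃[ Y ] y₁ ≡ i * Y → (X * i ≡ X * j × y₁ ≡ y₂) ⊎ FamilyPair F₂ a b (X * i) y₁ (X * j) y₂ ⊎ FamilyPair F₂ a b (X * j) y₂ (X * i) y₁
  finish (Y , y₁≡′) = compare (<-cmp i j)
    where
    y₁≡ : y₁ ≡ Y * i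
    y₁≡ = trans y₁≡′ (*-comm i Y)
    y₂≡ : y₂ ≡ Y * j
    y₂≡ = *-cancelˡ 0<i (trans reduced (trans (cong (j *_) y₁≡) (rearrange j Y i)))
      where
      rearrange : ∀ j Y i → j * (Y * i) ≡ i * (Y * j)
      rearrange = solve-∀
    0<Y : 0 < Y
    0<Y = *-pos⁻ˡ Y i (subst (0 <_) y₁≡ 0<y₁)
    eq₁′ : a ^ (X * i) + b ^ (Y * i) ≡ c ^ z₁
    eq₁′ = subst (λ w → a ^ (X * i) + b ^ w ≡ c ^ z₁) y₁≡ eq₁
    eq₂′ : a ^ (X * j) + b ^ (Y * j) ≡ c ^ z₂
    eq₂′ = subst (λ w → a ^ (X * j) + b ^ w ≡ c ^ z₂) y₂≡ eq₂
    compare : _ → (X * i ≡ X * j × y₁ ≡ y₂) ⊎ FamilyPair F₂ a b (X * i) y₁ (X * j) y₂ ⊎ FamilyPair F₂ a b (X * j) y₂ (X * i) y₁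
    compare (tri≈ _ i≡j _) = inj₁ (cong (X *_) i≡j , trans y₁≡ (trans (cong (Y *_) i≡j) (sym y₂≡)))
    compare (tri< i<j _ _) = inj₂ (inj₁ (subst₂ (λ u v → FamilyPair F₂ a b (X * i) u (X * j) v) (sym y₁≡) (sym y₂≡)
      (sumRatio-scaled {z₁ = z₁} {z₂} X Y i j 1<a 1<b 1<c notPow2 0<X 0<Y 0<z₁ 0<i i<j cop eq₁′ eq₂′)))
    compare (tri> _ _ j<i) = inj₂ (inj₂ (subst₂ (λ u v → FamilyPair F₂ a b (X * j) u (X * i) v) (sym y₂≡) (sym y₁≡)
      (sumRatio-scaled {z₁ = z₂} {z₁} X Y j i 1<a 1<b 1<c notPow2 0<X 0<Y 0<z₂ 0<j j<i (coprime-sym cop) eq₂′ eq₁′)))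

-- Types of a solution at a prime

record Valuations (p a b c : ℕ) : Set where
  field
    α β γ a₁ b₁ c₁ : ℕ
    a≡ : a ≡ p ^ α * a₁
    b≡ : b ≡ p ^ β * b₁
    c≡ : c ≡ p ^ γ * c₁
    p∤a₁ : ¬ p ∣ a₁
    p∤b₁ : ¬ p ∣ b₁
    p∤c₁ : ¬ p ∣ c₁

valuations : ∀ {p a b c} → Prime p → 0 < a → 0 < b → 0 < c → Valuations p a b c
valuations {p} {a} {b} {c} pp 0<a 0<b 0<c
  with factorOut p a (1<prime pp) 0<a | factorOut p b (1<prime pp) 0<b | factorOut p c (1<prime pp) 0<c
... | α , a₁ , a≡ , p∤a₁ | β , b₁ , b≡ , p∤b₁ | γ , c₁ , c≡ , p∤c₁ = record
  { α = α ; β = β ; γ = γ ; a₁ = a₁ ; b₁ = b₁ ; c₁ = c₁ ; a≡ = a≡ ; b≡ = b≡ ; c≡ = c≡ ; p∤a₁ = p∤a₁ ; p∤b₁ = p∤b₁ ; p∤c₁ = p∤c₁ }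

Valuations-swap : ∀ {p a b c} → Valuations p a b c → Valuations p b a c
Valuations-swap V = record { α = β ; β = α ; γ = γ ; a₁ = b₁ ; b₁ = a₁ ; c₁ = c₁ ; a≡ = b≡ ; b≡ = a≡ ; c≡ = c≡ ; p∤a₁ = p∤b₁ ; p∤b₁ = p∤a₁ ; p∤c₁ = p∤c₁ }
  where open Valuations V

^-split : ∀ {p α n n₁} k → n ≡ p ^ α * n₁ → n ^ k ≡ p ^ (α * k) * n₁ ^ k
^-split {p} {α} {n₁ = n₁} k refl = trans (^-*-distrib (p ^ α) n₁ k) (cong (_* n₁ ^ k) (^-*-assoc p α k))

factor-+ : ∀ p i d u v → p ^ i * u + p ^ (i + d) * v ≡ p ^ i * (u + p ^ d * v)
factor-+ p i d u v = trans (cong (λ w → p ^ i * u + w * v) (^-distribˡ-+-* p i d)) (rearrange (p ^ i) (p ^ d) u v)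
  where
  rearrange : ∀ s t u v → s * u + s * t * v ≡ s * (u + t * v)
  rearrange = solve-∀

-- When `i = j`, the sum `u + v` may be divisible by `p`; this can raise the valuation `k` above `i`
-- but not lower it.
minimum-twice : ∀ {p} i j k {u v w} → Prime p → ¬ p ∣ u → ¬ p ∣ v → ¬ p ∣ w → p ^ i * u + p ^ j * v ≡ p ^ k * w →
  (j < i × j ≡ k) ⊎ (i < j × i ≡ k) ⊎ (i < k × i ≡ j) ⊎ (i ≡ j × i ≡ k)
minimum-twice {p} i j k {u} {v} {w} pp p∤u p∤v p∤w eq = byOrder (<-cmp i j)
  where
  unequal : ∀ i j {u v} → ¬ p ∣ u → p ^ i * u + p ^ j * v ≡ p ^ k * w → i < j → i ≡ k
  unequal i j {u} {v} p∤u eq i<j = step (<⇒∃+ i<j)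
    where
    step : ∃[ d ] (0 < d × j ≡ i + d) → i ≡ k
    step (d , 0<d , j≡) = proj₁ (factorOut-unique i k (1<prime pp)
      (λ h → p∤u (∣m+n∣m⇒∣n (subst (p ∣_) (+-comm u (p ^ d * v)) h) (∣m⇒∣m*n v (∣-self^ d 0<d ∣-refl)))) p∤w
      (trans (sym (factor-+ p i d u v)) (subst (λ t → p ^ i * u + p ^ t * v ≡ p ^ k * w) j≡ eq)))
  byOrder : _ → (j < i × j ≡ k) ⊎ (i < j × i ≡ k) ⊎ (i < k × i ≡ j) ⊎ (i ≡ j × i ≡ k)
  byOrder (tri< i<j _ _) = inj₂ (inj₁ (i<j , unequal i j p∤u eq i<j))
  byOrder (tri> _ _ j<i) = inj₁ (j<i , unequal j i p∤v (trans (+-comm (p ^ j * v) (p ^ i * u)) eq) j<i)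
  byOrder (tri≈ _ i≡j _) = inj₂ (inj₂ (third (<-cmp i k)))
    where
    eq′ : p ^ i * (u + v) ≡ p ^ k * w
    eq′ = trans (*-distribˡ-+ (p ^ i) u v) (subst (λ t → p ^ i * u + p ^ t * v ≡ p ^ k * w) (sym i≡j) eq)
    third : _ → (i < k × i ≡ j) ⊎ (i ≡ j × i ≡ k)
    third (tri< i<k _ _) = inj₁ (i<k , i≡j)
    third (tri≈ _ i≡k _) = inj₂ (i≡j , i≡k)
    third (tri> _ _ k<i) = let d , 0<d , i≡ = <⇒∃+ k<i in
      ⊥-elim (p∤w (p^i*u≡p^[i+d]*v⇒p∣u k d (0<prime pp) 0<d (trans (sym eq′) (cong (λ t → p ^ t * (u + v)) i≡))))

cross-≡ : ∀ {m n} u₁ v₁ u₂ v₂ → 0 < m → 0 < n → m * u₁ ≡ n * v₁ → m * u₂ ≡ n * v₂ → u₁ * v₂ ≡ u₂ * v₁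
cross-≡ {m} {n} u₁ v₁ u₂ v₂ 0<m 0<n e₁ e₂ = *-cancelˡ 0<m (*-cancelˡ 0<n
  (trans (left n m u₁ v₂) (trans (cong₂ _*_ e₁ (sym e₂)) (right n m v₁ u₂))))
  where
  left : ∀ n m u v → n * (m * (u * v)) ≡ m * u * (n * v)
  left = solve-∀
  right : ∀ n m v u → n * v * (m * u) ≡ n * (m * (u * v))
  right = solve-∀

cross-≤ : ∀ {m n} u₁ v₁ u₂ v₂ → 0 < m → 0 < n → n * v₁ ≤ m * u₁ → m * u₂ ≤ n * v₂ → v₁ * u₂ ≤ u₁ * v₂
cross-≤ {m} {n} u₁ v₁ u₂ v₂ 0<m 0<n e₁ e₂ = *-cancelˡ-≤ (n * m) {{>-nonZero (*-pos 0<n 0<m)}}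
  (subst₂ _≤_ (left n m v₁ u₂) (right n m u₁ v₂) (*-mono-≤ e₁ e₂))
  where
  left : ∀ n m v u → n * v * (m * u) ≡ n * m * (v * u)
  left = solve-∀
  right : ∀ n m u v → m * u * (n * v) ≡ n * m * (u * v)
  right = solve-∀

-- Raise to the power `x₂`, use that `z₂ / x₂` is at least `z₁ / x₁`, and take `x₁`-th roots.
^-transfer-< : ∀ {m n} x₁ z₁ x₂ z₂ → 0 < n → 0 < x₂ → m ^ x₁ < n ^ z₁ → z₁ * x₂ ≤ x₁ * z₂ → m ^ x₂ < n ^ z₂
^-transfer-< {m} {n} x₁ z₁ x₂ z₂ 0<n 0<x₂ lt le = ^-cancelˡ-< x₁ (begin-strict
  (m ^ x₂) ^ x₁    ≡⟨ ^-^-comm m x₂ x₁ ⟩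
  (m ^ x₁) ^ x₂    <⟨ ^-monoˡ-< x₂ {{>-nonZero 0<x₂}} lt ⟩
  (n ^ z₁) ^ x₂    ≡⟨ ^-*-assoc n z₁ x₂ ⟩
  n ^ (z₁ * x₂)    ≤⟨ ^-monoʳ-≤ n {{>-nonZero 0<n}} le ⟩
  n ^ (x₁ * z₂)    ≡⟨ trans (cong (n ^_) (*-comm x₁ z₂)) (sym (^-*-assoc n z₂ x₁)) ⟩
  (n ^ z₂) ^ x₁    ∎)
  where open ≤-Reasoning

module Types {p a b c} (pp : Prime p) (p∣a : p ∣ a) (p∣b : p ∣ b) (p∣c : p ∣ c) (V : Valuations p a b c) where
  open Valuations V public

  -- `TypeC` is cancellation between the summands. `TypeO` is the threefold tie; it satisfies all
  -- the equalities at once and so shares an exponent ratio with a solution of any type.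
  TypeA TypeB TypeC TypeO : ℕ → ℕ → ℕ → Set
  TypeA x y z = β * y < α * x × β * y ≡ γ * z
  TypeB x y z = α * x < β * y × α * x ≡ γ * z
  TypeC x y z = α * x < γ * z × α * x ≡ β * y
  TypeO x y z = α * x ≡ β * y × α * x ≡ γ * z

  valuation-pos : ∀ {k n n₁} → n ≡ p ^ k * n₁ → ¬ p ∣ n₁ → p ∣ n → 0 < k
  valuation-pos {n₁ = n₁} n≡ p∤n₁ p∣n = n≢0⇒n>0 λ { refl → p∤n₁ (subst (p ∣_) (trans n≡ (*-identityˡ n₁)) p∣n) }

  0<α : 0 < α
  0<α = valuation-pos a≡ p∤a₁ p∣a
  0<β : 0 < β
  0<β = valuation-pos b≡ p∤b₁ p∣b
  0<γ : 0 < γ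
  0<γ = valuation-pos c≡ p∤c₁ p∣c

  split-equation : ∀ {x y z} → Sol a b c x y z → p ^ (α * x) * a₁ ^ x + p ^ (β * y) * b₁ ^ y ≡ p ^ (γ * z) * c₁ ^ z
  split-equation {x} {y} {z} (_ , _ , _ , eq) = trans (sym (cong₂ _+_ (^-split {p} {α} x a≡) (^-split {p} {β} y b≡))) (trans eq (^-split {p} {γ} z c≡))

  classify : ∀ {x y z} → Sol a b c x y z → TypeA x y z ⊎ TypeB x y z ⊎ TypeC x y z ⊎ TypeO x y z
  classify {x} {y} {z} s = minimum-twice (α * x) (β * y) (γ * z) pp (∤-^ x pp p∤a₁) (∤-^ y pp p∤b₁) (∤-^ z pp p∤c₁) (split-equation {x} {y} {z} s)

  TypeA⇒TypeAp : ∀ {x y z} → TypeA x y z → TypeAp p a b c x y z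
  TypeA⇒TypeAp (lt , eq) = p∣a , p∣b , p∣c , α , β , γ , exactPower {p} {α} (0<prime pp) a≡ p∤a₁ ,
    exactPower {p} {β} (0<prime pp) b≡ p∤b₁ , exactPower {p} {γ} (0<prime pp) c≡ p∤c₁ , lt , eq

  TypeB⇒TypeBp : ∀ {x y z} → TypeB x y z → TypeBp p a b c x y z
  TypeB⇒TypeBp (lt , eq) = p∣a , p∣b , p∣c , α , β , γ , exactPower {p} {α} (0<prime pp) a≡ p∤a₁ ,
    exactPower {p} {β} (0<prime pp) b≡ p∤b₁ , exactPower {p} {γ} (0<prime pp) c≡ p∤c₁ , lt , eq

  -- Size: the p-free parts of both summands of the Type C solution lie below the p-free part of c ^ z₂,
  -- so their sum is below 2 c₁ ^ z₂ ≤ p c₁ ^ z₂.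
  TypeA-TypeC-incompatible : ∀ {x₁ y₁ z₁ x₂ y₂ z₂} → 0 < c → 0 < a → 0 < b → Sol a b c x₁ y₁ z₁ → TypeA x₁ y₁ z₁ →
    Sol a b c x₂ y₂ z₂ → TypeC x₂ y₂ z₂ → ⊥
  TypeA-TypeC-incompatible {x₁} {y₁} {z₁} {x₂} {y₂} {z₂} 0<c 0<a 0<b s₁@(0<x₁ , 0<y₁ , 0<z₁ , eq₁) (βy<αx , βy≡γz)
    s₂@(0<x₂ , 0<y₂ , 0<z₂ , eq₂) (αx<γz , αx≡βy) = <⇒≢ tooSmall equation₂
    where
    open ≤-Reasoning
    0<p : 0 < p
    0<p = 0<prime pp
    0<c₁ : 0 < c₁
    0<c₁ = *-pos⁻ʳ (p ^ γ) c₁ (subst (0 <_) c≡ 0<c)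
    a₁<c₁ : a₁ ^ x₁ < c₁ ^ z₁
    a₁<c₁ = *-cancelˡ-< (p ^ (γ * z₁)) _ _ (begin-strict
      p ^ (γ * z₁) * a₁ ^ x₁    ≤⟨ *-monoˡ-≤ (a₁ ^ x₁) (^-monoʳ-≤ p {{>-nonZero 0<p}} (subst (_≤ α * x₁) βy≡γz (<⇒≤ βy<αx))) ⟩
      p ^ (α * x₁) * a₁ ^ x₁    ≡⟨ sym (^-split {p} {α} x₁ a≡) ⟩
      a ^ x₁                    <⟨ m<m+n (a ^ x₁) (^-pos y₁ 0<b) ⟩
      a ^ x₁ + b ^ y₁           ≡⟨ trans eq₁ (^-split {p} {γ} z₁ c≡) ⟩
      p ^ (γ * z₁) * c₁ ^ z₁    ∎)
    b₁<c₁ : b₁ ^ y₁ < c₁ ^ z₁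
    b₁<c₁ = *-cancelˡ-< (p ^ (γ * z₁)) _ _ (begin-strict
      p ^ (γ * z₁) * b₁ ^ y₁    ≡⟨ cong (λ w → p ^ w * b₁ ^ y₁) (sym βy≡γz) ⟩
      p ^ (β * y₁) * b₁ ^ y₁    ≡⟨ sym (^-split {p} {β} y₁ b≡) ⟩
      b ^ y₁                    <⟨ m<n+m (b ^ y₁) (^-pos x₁ 0<a) ⟩
      a ^ x₁ + b ^ y₁           ≡⟨ trans eq₁ (^-split {p} {γ} z₁ c≡) ⟩
      p ^ (γ * z₁) * c₁ ^ z₁    ∎)
    a₁<c₁′ : a₁ ^ x₂ < c₁ ^ z₂
    a₁<c₁′ = ^-transfer-< x₁ z₁ x₂ z₂ 0<c₁ 0<x₂ a₁<c₁ (cross-≤ x₁ z₁ x₂ z₂ 0<α 0<γ (subst (_≤ α * x₁) βy≡γz (<⇒≤ βy<αx)) (<⇒≤ αx<γz))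
    b₁<c₁′ : b₁ ^ y₂ < c₁ ^ z₂
    b₁<c₁′ = ^-transfer-< y₁ z₁ y₂ z₂ 0<c₁ 0<y₂ b₁<c₁ (cross-≤ y₁ z₁ y₂ z₂ 0<β 0<γ (≤-reflexive (sym βy≡γz)) (subst (_≤ γ * z₂) αx≡βy (<⇒≤ αx<γz)))
    equation₂ : p ^ (α * x₂) * (a₁ ^ x₂ + b₁ ^ y₂) ≡ p ^ (γ * z₂) * c₁ ^ z₂
    equation₂ = trans (*-distribˡ-+ (p ^ (α * x₂)) (a₁ ^ x₂) (b₁ ^ y₂))
      (subst (λ w → p ^ (α * x₂) * a₁ ^ x₂ + p ^ w * b₁ ^ y₂ ≡ p ^ (γ * z₂) * c₁ ^ z₂) (sym αx≡βy) (split-equation {x₂} {y₂} {z₂} s₂))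
    tooSmall : p ^ (α * x₂) * (a₁ ^ x₂ + b₁ ^ y₂) < p ^ (γ * z₂) * c₁ ^ z₂
    tooSmall = begin-strict
      p ^ (α * x₂) * (a₁ ^ x₂ + b₁ ^ y₂)    <⟨ *-monoʳ-< (p ^ (α * x₂)) {{>-nonZero (^-pos (α * x₂) 0<p)}} (+-mono-< a₁<c₁′ b₁<c₁′) ⟩
      p ^ (α * x₂) * (c₁ ^ z₂ + c₁ ^ z₂)    ≡⟨ rearrange (p ^ (α * x₂)) (c₁ ^ z₂) ⟩
      2 * p ^ (α * x₂) * c₁ ^ z₂            ≤⟨ *-monoˡ-≤ (c₁ ^ z₂) (*-monoˡ-≤ (p ^ (α * x₂)) (1<prime pp)) ⟩
      p ^ suc (α * x₂) * c₁ ^ z₂            ≤⟨ *-monoˡ-≤ (c₁ ^ z₂) (^-monoʳ-≤ p {{>-nonZero 0<p}} αx<γz) ⟩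
      p ^ (γ * z₂) * c₁ ^ z₂                ∎
      where
      rearrange : ∀ s t → s * (t + t) ≡ 2 * s * t
      rearrange = solve-∀

-- Two solutions outside the families have opposite types

record Setup (a b c x₁ y₁ z₁ x₂ y₂ z₂ : ℕ) : Set where
  field
    1<a : 1 < a
    1<b : 1 < b
    1<c : 1 < c
    1<gcd : 1 < gcd a b
    notPow2 : ¬ (IsPowerOf2 a × IsPowerOf2 b × IsPowerOf2 c)
    sol₁ : Sol a b c x₁ y₁ z₁
    sol₂ : Sol a b c x₂ y₂ z₂
    notCorr : ¬ Corr a b x₁ y₁ a b x₂ y₂
    -- `Exceptional` is ordered, smaller solution first, whereas `InFamily` allows either order;
    -- both exclusions are kept so that the setup is invariant under swapping the solutions.
    notExc₁₂ : ¬ Exceptional a b x₁ y₁ x₂ y₂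
    notExc₂₁ : ¬ Exceptional a b x₂ y₂ x₁ y₁

  0<a : 0 < a
  0<a = <-trans (s≤s z≤n) 1<a
  0<b : 0 < b
  0<b = <-trans (s≤s z≤n) 1<b
  0<c : 0 < c
  0<c = <-trans (s≤s z≤n) 1<c

Corr-sym : ∀ a b x y x′ y′ → Corr a b x y a b x′ y′ → Corr a b x′ y′ a b x y
Corr-sym _ _ _ _ _ _ (inj₁ (p , q)) = inj₁ (sym p , sym q)
Corr-sym _ _ _ _ _ _ (inj₂ (p , q)) = inj₂ (sym q , sym p)

Corr-swapBases : ∀ a b x y x′ y′ → Corr b a y x b a y′ x′ → Corr a b x y a b x′ y′
Corr-swapBases _ _ _ _ _ _ (inj₁ (p , q)) = inj₁ (q , p)
Corr-swapBases _ _ _ _ _ _ (inj₂ (p , q)) = inj₂ (q , p)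

module _ {a b c x₁ y₁ z₁ x₂ y₂ z₂} (H : Setup a b c x₁ y₁ z₁ x₂ y₂ z₂) where
  open Setup H

  swapOrder : Setup a b c x₂ y₂ z₂ x₁ y₁ z₁
  swapOrder = record { 1<a = 1<a ; 1<b = 1<b ; 1<c = 1<c ; 1<gcd = 1<gcd ; notPow2 = notPow2 ; sol₁ = sol₂ ; sol₂ = sol₁
    ; notCorr = notCorr ∘ Corr-sym a b x₂ y₂ x₁ y₁ ; notExc₁₂ = notExc₂₁ ; notExc₂₁ = notExc₁₂ }

  swapBases : Setup b a c y₁ x₁ z₁ y₂ x₂ z₂
  swapBases = record { 1<a = 1<b ; 1<b = 1<a ; 1<c = 1<c ; 1<gcd = subst (1 <_) (gcd-comm a b) 1<gcd
    ; notPow2 = λ { (pb , pa , pc) → notPow2 (pa , pb , pc) }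
    ; sol₁ = Sol-swap {a} {b} {c} {x₁} {y₁} {z₁} sol₁ ; sol₂ = Sol-swap {a} {b} {c} {x₂} {y₂} {z₂} sol₂
    ; notCorr = notCorr ∘ Corr-swapBases a b x₁ y₁ x₂ y₂
    ; notExc₁₂ = notExc₁₂ ∘ Exceptional-swap {a} {b} {x₁} {y₁} {x₂} {y₂} ; notExc₂₁ = notExc₂₁ ∘ Exceptional-swap {a} {b} {x₂} {y₂} {x₁} {y₁} }

  ratioA-impossible : y₁ * z₂ ≢ y₂ * z₁
  ratioA-impossible ratio = go (sameRatio {a} {b} {c} {x₁} {y₁} {z₁} {x₂} {y₂} {z₂} 1<a 1<b 1<c sol₁ sol₂ ratio)
    where
    go : _ → ⊥
    go (inj₁ (x≡ , y≡ , _)) = notCorr (inj₁ (cong (a ^_) (sym x≡) , cong (b ^_) (sym y≡)))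
    go (inj₂ (inj₁ S)) = notExc₁₂ (scaled⇒Exceptional {a} {b} {c} {x₁} {y₁} {z₁} {x₂} {y₂} {z₂} 1<a 1<gcd (proj₁ sol₁) (proj₁ (proj₂ sol₁)) S)
    go (inj₂ (inj₂ S)) = notExc₂₁ (scaled⇒Exceptional {a} {b} {c} {x₂} {y₂} {z₂} {x₁} {y₁} {z₁} 1<a 1<gcd (proj₁ sol₂) (proj₁ (proj₂ sol₂)) S)

  ratioC-impossible : x₁ * y₂ ≢ x₂ * y₁
  ratioC-impossible ratio = go (sumRatio {a} {b} {c} {x₁} {y₁} {z₁} {x₂} {y₂} {z₂} 1<a 1<b 1<c notPow2 sol₁ sol₂ ratio)
    where
    go : _ → ⊥
    go (inj₁ (x≡ , y≡)) = notCorr (inj₁ (cong (a ^_) x≡ , cong (b ^_) y≡))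
    go (inj₂ (inj₁ f)) = notExc₁₂ (inj₂ (inj₁ f))
    go (inj₂ (inj₂ f)) = notExc₂₁ (inj₂ (inj₁ f))

ratioB-impossible : ∀ {a b c x₁ y₁ z₁ x₂ y₂ z₂} → Setup a b c x₁ y₁ z₁ x₂ y₂ z₂ → x₁ * z₂ ≢ x₂ * z₁
ratioB-impossible H = ratioA-impossible (swapBases H)

commonPrime∣c : ∀ {p a b c x y z} → Prime p → Sol a b c x y z → p ∣ a → p ∣ b → p ∣ c
commonPrime∣c {p} {x = x} {y} {z} pp (0<x , 0<y , _ , eq) p∣a p∣b =
  prime∣^ z pp (subst (p ∣_) eq (∣m∣n⇒∣m+n (∣-self^ x 0<x p∣a) (∣-self^ y 0<y p∣b)))

module _ {p a b c x₁ y₁ z₁ x₂ y₂ z₂} (H : Setup a b c x₁ y₁ z₁ x₂ y₂ z₂)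
  (pp : Prime p) (p∣a : p ∣ a) (p∣b : p ∣ b) (p∣c : p ∣ c) (V : Valuations p a b c) where
  open Setup H
  open Types pp p∣a p∣b p∣c V
  module Swapped = Types pp p∣b p∣a p∣c (Valuations-swap V)

  -- Of the sixteen combinations, those sharing an equality die by proportionality, which includes
  -- every one with `TypeO`; A or B against C dies by size. Only A against B remains.
  oppositeTypes : (TypeA x₁ y₁ z₁ × TypeB x₂ y₂ z₂) ⊎ (TypeB x₁ y₁ z₁ × TypeA x₂ y₂ z₂)
  oppositeTypes = go (classify {x₁} {y₁} {z₁} sol₁) (classify {x₂} {y₂} {z₂} sol₂)
    where
    RA : β * y₁ ≡ γ * z₁ → β * y₂ ≡ γ * z₂ → ⊥
    RA e₁ e₂ = ratioA-impossible H (cross-≡ y₁ z₁ y₂ z₂ 0<β 0<γ e₁ e₂)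
    RB : α * x₁ ≡ γ * z₁ → α * x₂ ≡ γ * z₂ → ⊥
    RB e₁ e₂ = ratioB-impossible H (cross-≡ x₁ z₁ x₂ z₂ 0<α 0<γ e₁ e₂)
    RC : α * x₁ ≡ β * y₁ → α * x₂ ≡ β * y₂ → ⊥
    RC e₁ e₂ = ratioC-impossible H (cross-≡ x₁ y₁ x₂ y₂ 0<α 0<β e₁ e₂)
    AC₁₂ : TypeA x₁ y₁ z₁ → TypeC x₂ y₂ z₂ → ⊥
    AC₁₂ A C = TypeA-TypeC-incompatible {x₁} {y₁} {z₁} {x₂} {y₂} {z₂} 0<c 0<a 0<b sol₁ A sol₂ C
    AC₂₁ : TypeA x₂ y₂ z₂ → TypeC x₁ y₁ z₁ → ⊥
    AC₂₁ A C = TypeA-TypeC-incompatible {x₂} {y₂} {z₂} {x₁} {y₁} {z₁} 0<c 0<a 0<b sol₂ A sol₁ C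
    BC₁₂ : TypeB x₁ y₁ z₁ → TypeC x₂ y₂ z₂ → ⊥
    BC₁₂ B (lt , eq) = Swapped.TypeA-TypeC-incompatible {y₁} {x₁} {z₁} {y₂} {x₂} {z₂} 0<c 0<b 0<a
      (Sol-swap {a} {b} {c} {x₁} {y₁} {z₁} sol₁) B (Sol-swap {a} {b} {c} {x₂} {y₂} {z₂} sol₂) (subst (_< γ * z₂) eq lt , sym eq)
    BC₂₁ : TypeB x₂ y₂ z₂ → TypeC x₁ y₁ z₁ → ⊥
    BC₂₁ B (lt , eq) = Swapped.TypeA-TypeC-incompatible {y₂} {x₂} {z₂} {y₁} {x₁} {z₁} 0<c 0<b 0<a
      (Sol-swap {a} {b} {c} {x₂} {y₂} {z₂} sol₂) B (Sol-swap {a} {b} {c} {x₁} {y₁} {z₁} sol₁) (subst (_< γ * z₁) eq lt , sym eq)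
    go : TypeA x₁ y₁ z₁ ⊎ TypeB x₁ y₁ z₁ ⊎ TypeC x₁ y₁ z₁ ⊎ TypeO x₁ y₁ z₁ →
         TypeA x₂ y₂ z₂ ⊎ TypeB x₂ y₂ z₂ ⊎ TypeC x₂ y₂ z₂ ⊎ TypeO x₂ y₂ z₂ →
         (TypeA x₁ y₁ z₁ × TypeB x₂ y₂ z₂) ⊎ (TypeB x₁ y₁ z₁ × TypeA x₂ y₂ z₂)
    go (inj₁ A) (inj₂ (inj₁ B)) = inj₁ (A , B)
    go (inj₂ (inj₁ B)) (inj₁ A) = inj₂ (B , A)
    go (inj₁ (_ , e)) (inj₁ (_ , e′)) = ⊥-elim (RA e e′)
    go (inj₁ A) (inj₂ (inj₂ (inj₁ C))) = ⊥-elim (AC₁₂ A C)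
    go (inj₁ (_ , e)) (inj₂ (inj₂ (inj₂ (o , o′)))) = ⊥-elim (RA e (trans (sym o) o′))
    go (inj₂ (inj₁ (_ , e))) (inj₂ (inj₁ (_ , e′))) = ⊥-elim (RB e e′)
    go (inj₂ (inj₁ B)) (inj₂ (inj₂ (inj₁ C))) = ⊥-elim (BC₁₂ B C)
    go (inj₂ (inj₁ (_ , e))) (inj₂ (inj₂ (inj₂ (_ , o′)))) = ⊥-elim (RB e o′)
    go (inj₂ (inj₂ (inj₁ C))) (inj₁ A) = ⊥-elim (AC₂₁ A C)
    go (inj₂ (inj₂ (inj₁ C))) (inj₂ (inj₁ B)) = ⊥-elim (BC₂₁ B C)
    go (inj₂ (inj₂ (inj₁ (_ , e)))) (inj₂ (inj₂ (inj₁ (_ , e′)))) = ⊥-elim (RC e e′)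
    go (inj₂ (inj₂ (inj₁ (_ , e)))) (inj₂ (inj₂ (inj₂ (o , _)))) = ⊥-elim (RC e o)
    go (inj₂ (inj₂ (inj₂ (o , o′)))) (inj₁ (_ , e)) = ⊥-elim (RA (trans (sym o) o′) e)
    go (inj₂ (inj₂ (inj₂ (_ , o′)))) (inj₂ (inj₁ (_ , e))) = ⊥-elim (RB o′ e)
    go (inj₂ (inj₂ (inj₂ (o , _)))) (inj₂ (inj₂ (inj₁ (_ , e)))) = ⊥-elim (RC o e)
    go (inj₂ (inj₂ (inj₂ (o , _)))) (inj₂ (inj₂ (inj₂ (o′ , _)))) = ⊥-elim (RC o o′)

-- The common factor g

cross-< : ∀ {m n} u₁ v₁ u₂ v₂ → n * v₁ < m * u₁ → m * u₂ < n * v₂ → v₁ * u₂ < u₁ * v₂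
cross-< {m} {n} u₁ v₁ u₂ v₂ e₁ e₂ = *-cancelˡ-< (n * m) _ _ (subst₂ _<_ (left n m v₁ u₂) (right n m u₁ v₂) (*-mono-< e₁ e₂))
  where
  left : ∀ n m v u → n * v * (m * u) ≡ n * m * (v * u)
  left = solve-∀
  right : ∀ n m u v → m * u * (n * v) ≡ n * m * (u * v)
  right = solve-∀

OrientedAt : (p a b c x₁ y₁ z₁ x₂ y₂ z₂ : ℕ) → Valuations p a b c → Set
OrientedAt p a b c x₁ y₁ z₁ x₂ y₂ z₂ V = (β * y₁ < α * x₁ × β * y₁ ≡ γ * z₁) × (α * x₂ < β * y₂ × α * x₂ ≡ γ * z₂)
  where open Valuations V

-- Quantified over every `V`, so that it applies to whichever factorisation a later step has at
-- hand.
Oriented : (a b c x₁ y₁ z₁ x₂ y₂ z₂ : ℕ) → Set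
Oriented a b c x₁ y₁ z₁ x₂ y₂ z₂ = ∀ p → Prime p → p ∣ a → p ∣ b → (V : Valuations p a b c) → OrientedAt p a b c x₁ y₁ z₁ x₂ y₂ z₂ V

-- Type A for the first and Type B for the second solution at any prime imply `y₁ x₂ < x₁ y₂`, an
-- inequality that no longer mentions the prime. Two primes with opposite orientations would give it
-- in both directions.
orientation : ∀ {a b c x₁ y₁ z₁ x₂ y₂ z₂} → Setup a b c x₁ y₁ z₁ x₂ y₂ z₂ →
  Oriented a b c x₁ y₁ z₁ x₂ y₂ z₂ ⊎ Oriented a b c x₂ y₂ z₂ x₁ y₁ z₁
orientation {a} {b} {c} {x₁} {y₁} {z₁} {x₂} {y₂} {z₂} H = start (gcd>1⇒commonPrime {a} {b} 1<gcd)
  where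
  open Setup H
  Alternative : ∀ {p} → Valuations p a b c → Set
  Alternative {p} V = OrientedAt p a b c x₁ y₁ z₁ x₂ y₂ z₂ V ⊎ OrientedAt p a b c x₂ y₂ z₂ x₁ y₁ z₁ V
  at : ∀ p → Prime p → p ∣ a → p ∣ b → (V : Valuations p a b c) → Alternative V
  at p pp p∣a p∣b V = map-⊎ (λ t → t) (λ { (B , A) → A , B })
    (oppositeTypes H pp p∣a p∣b (commonPrime∣c {p} {a} {b} {c} {x₁} {y₁} {z₁} pp sol₁ p∣a p∣b) V)
  clash : ∀ {p q} (V : Valuations p a b c) (W : Valuations q a b c) →
    OrientedAt p a b c x₁ y₁ z₁ x₂ y₂ z₂ V → OrientedAt q a b c x₂ y₂ z₂ x₁ y₁ z₁ W → ⊥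
  clash V W ((lt₁ , _) , (lt₂ , _)) ((lt₃ , _) , (lt₄ , _)) = <-asym (cross-< {Valuations.α V} {Valuations.β V} x₁ y₁ x₂ y₂ lt₁ lt₂)
    (subst₂ _<_ (*-comm y₂ x₁) (*-comm x₂ y₁) (cross-< {Valuations.α W} {Valuations.β W} x₂ y₂ x₁ y₁ lt₃ lt₄))
  start : ∃[ p ] (Prime p × p ∣ a × p ∣ b) → _
  start (p , pp , p∣a , p∣b) = decide (valuations pp 0<a 0<b 0<c)
    where
    decide : Valuations p a b c → Oriented a b c x₁ y₁ z₁ x₂ y₂ z₂ ⊎ Oriented a b c x₂ y₂ z₂ x₁ y₁ z₁
    decide V = spread (at p pp p∣a p∣b V)
      where
      spread : Alternative V → Oriented a b c x₁ y₁ z₁ x₂ y₂ z₂ ⊎ Oriented a b c x₂ y₂ z₂ x₁ y₁ z₁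
      spread (inj₁ o) = inj₁ λ q pq q∣a q∣b W → case at q pq q∣a q∣b W of λ
        { (inj₁ o′) → o′ ; (inj₂ o′) → ⊥-elim (clash V W o o′) }
      spread (inj₂ o) = inj₂ λ q pq q∣a q∣b W → case at q pq q∣a q∣b W of λ
        { (inj₁ o′) → ⊥-elim (clash W V o′ o) ; (inj₂ o′) → o′ }

-- Repeated division by `gcd n d` until it becomes 1; the product of the divisors removed is `m`.
splitPart : ∀ d n → 0 < n → ∃[ m ] ∃[ n₁ ] (n ≡ m * n₁ × Coprime n₁ d × (∀ p → Prime p → p ∣ m → p ∣ d))
splitPart d n = <-rec P step n
  where
  P : ℕ → Set
  P n = 0 < n → ∃[ m ] ∃[ n₁ ] (n ≡ m * n₁ × Coprime n₁ d × (∀ p → Prime p → p ∣ m → p ∣ d))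
  step : ∀ n → (∀ {m} → m < n → P m) → P n
  step n rec 0<n = byGcd (∣⇒∃* (gcd[m,n]∣m n d)) (gcd n d ≟ 1)
    where
    byGcd : ∃[ q ] n ≡ gcd n d * q → _ → ∃[ m ] ∃[ n₁ ] (n ≡ m * n₁ × Coprime n₁ d × (∀ p → Prime p → p ∣ m → p ∣ d))
    byGcd _ (yes g≡1) = 1 , n , sym (*-identityˡ n) , gcd≡1⇒coprime g≡1 , λ p pp p∣1 → ⊥-elim (∤1 pp p∣1)
    byGcd (q , n≡) (no g≢1) = extend (rec q<n 0<q)
      where
      g = gcd n d
      0<q : 0 < q
      0<q = *-pos⁻ʳ g q (subst (0 <_) n≡ 0<n)
      1<g : 1 < g
      1<g = ≤∧≢⇒< (*-pos⁻ˡ g q (subst (0 <_) n≡ 0<n)) (g≢1 ∘ sym)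
      q<n : q < n
      q<n = subst (q <_) (sym n≡) (subst (_< g * q) (*-identityˡ q) (*-monoˡ-< q {{>-nonZero 0<q}} 1<g))
      extend : ∃[ m ] ∃[ n₁ ] (q ≡ m * n₁ × Coprime n₁ d × (∀ p → Prime p → p ∣ m → p ∣ d)) →
        ∃[ m ] ∃[ n₁ ] (n ≡ m * n₁ × Coprime n₁ d × (∀ p → Prime p → p ∣ m → p ∣ d))
      extend (m , n₁ , q≡ , cop , ps) = g * m , n₁ , trans n≡ (trans (cong (g *_) q≡) (sym (*-assoc g m n₁))) , cop ,
        λ p pp p∣gm → case euclidsLemma g m pp p∣gm of λ { (inj₁ h) → ∣-trans h (gcd[m,n]∣n n d) ; (inj₂ h) → ps p pp h }

SameValuation : ℕ → ℕ → ℕ → Set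
SameValuation p m n = ∃[ k ] ∃[ u ] ∃[ v ] (m ≡ p ^ k * u × n ≡ p ^ k * v × ¬ p ∣ u × ¬ p ∣ v)

SameValuation-sym : ∀ {p m n} → SameValuation p m n → SameValuation p n m
SameValuation-sym (k , u , v , m≡ , n≡ , p∤u , p∤v) = k , v , u , n≡ , m≡ , p∤v , p∤u

sameValuations-cofactor : ∀ {g m₀ n₀} → 0 < g → 0 < m₀ → Coprime m₀ n₀ →
  (∀ p → Prime p → SameValuation p (g * m₀) (g * n₀)) → m₀ ≡ 1
sameValuations-cofactor {g} {m₀} {n₀} 0<g 0<m₀ cop same = noPrimeDivisor⇒1 0<m₀ λ p pp p∣m₀ →
  let t , g′ , g≡ , p∤g′ = factorOut p g (1<prime pp) 0<g
      s , m′ , m₀≡ , p∤m′ = factorOut p m₀ (1<prime pp) 0<m₀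
      k , u , v , m≡ , n≡ , p∤u , p∤v = same p pp
      t+s≡k = proj₁ (factorOut-unique {p} (t + s) k (1<prime pp) (∤-* pp p∤g′ p∤m′) p∤u
                (trans (trans (cong (_* (g′ * m′)) (^-distribˡ-+-* p t s)) (trans (interchange (p ^ t) (p ^ s) g′ m′) (sym (cong₂ _*_ g≡ m₀≡)))) m≡))
      t≡k = proj₁ (factorOut-unique {p} t k (1<prime pp) (∤-* pp p∤g′ (coprime-∤ pp cop p∣m₀)) p∤v
              (trans (trans (sym (*-assoc (p ^ t) g′ n₀)) (cong (_* n₀) (sym g≡))) n≡))
      s≡0 = +-cancelˡ-≡ t s 0 (trans t+s≡k (trans (sym t≡k) (sym (+-identityʳ t))))
  in p∤m′ (subst (p ∣_) (trans m₀≡ (trans (cong (λ w → p ^ w * m′) s≡0) (*-identityˡ m′))) p∣m₀)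
  where
  interchange : ∀ a b c d → a * b * (c * d) ≡ a * c * (b * d)
  interchange = solve-∀

sameValuations⇒≡ : ∀ {m n} → 0 < m → 0 < n → (∀ p → Prime p → SameValuation p m n) → m ≡ n
sameValuations⇒≡ {m} {n} 0<m 0<n same with gcdSplit m n 0<m
... | g , m₀ , n₀ , 0<g , refl , refl , cop = cong (g *_) (trans
      (sameValuations-cofactor 0<g (*-pos⁻ʳ g m₀ 0<m) cop same)
      (sym (sameValuations-cofactor 0<g (*-pos⁻ʳ g n₀ 0<n) (coprime-sym cop) (λ p pp → SameValuation-sym {p} {g * m₀} {g * n₀} (same p pp)))))

^-cancel-∣ : ∀ {m n} k → 0 < k → 0 < n → n ^ k ∣ m ^ k → n ∣ m
^-cancel-∣ {m} {n} k 0<k 0<n h with gcdSplit n m 0<n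
... | g , n₀ , m₀ , 0<g , refl , refl , cop = *-monoʳ-∣ g (subst (_∣ m₀) (sym n₀≡1) (1∣ m₀))
  where
  n₀^k∣m₀^k : n₀ ^ k ∣ m₀ ^ k
  n₀^k∣m₀^k = *-cancelˡ-∣ (g ^ k) {{>-nonZero (^-pos k 0<g)}} (subst₂ _∣_ (^-*-distrib g n₀ k) (^-*-distrib g m₀ k) h)
  n₀≡1 : n₀ ≡ 1
  n₀≡1 = ^≡1⇒≡1 n₀ k 0<k (coprime-^ k k (*-pos⁻ʳ g n₀ 0<n) cop (∣-refl , n₀^k∣m₀^k))

CommonBase : ℕ → ℕ → Set
CommonBase m n = ∃[ r ] ∃[ s ] ∃[ t ] (0 < s × 0 < t × m ≡ r ^ s × n ≡ r ^ t)

-- From `n^y ∣ m^y` follows `n ∣ m`; writing `m = n q` leaves `q^y = n^d`, with exponent sum lowered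
-- by `y`.
commonBase-step : ∀ {m n} y d → 0 < m → 0 < n → 0 < y → m ^ y ≡ n ^ (y + d) →
  (∀ q → 0 < q → q ^ y ≡ n ^ d → CommonBase q n) → CommonBase m n
commonBase-step {m} {n} y d 0<m 0<n 0<y eq rec = go (∣⇒∃* (^-cancel-∣ y 0<y 0<n
    (subst (n ^ y ∣_) (trans (sym (^-distribˡ-+-* n y d)) (sym eq)) (m∣m*n (n ^ d)))))
  where
  go : ∃[ q ] m ≡ n * q → CommonBase m n
  go (q , refl) = combine (rec q (*-pos⁻ʳ n q 0<m) (*-cancelˡ (^-pos y 0<n)
      (trans (sym (^-*-distrib n q y)) (trans eq (^-distribˡ-+-* n y d)))))
    where
    combine : CommonBase q n → CommonBase (n * q) n
    combine (r , s , t , 0<s , 0<t , q≡ , n≡) = r , t + s , t , <-≤-trans 0<t (m≤m+n t s) , 0<t ,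
      trans (cong₂ _*_ n≡ q≡) (sym (^-distribˡ-+-* r t s)) , n≡

-- Euclid's algorithm on the exponents.
commonBase : ∀ {m n} y z → 0 < m → 0 < n → 0 < y → 0 < z → m ^ y ≡ n ^ z → CommonBase m n
commonBase y z 0<m 0<n 0<y 0<z eq = <-rec P step (y + z) refl 0<m 0<n 0<y 0<z eq
  where
  P : ℕ → Set
  P N = ∀ {m n y z} → y + z ≡ N → 0 < m → 0 < n → 0 < y → 0 < z → m ^ y ≡ n ^ z → CommonBase m n
  step : ∀ N → (∀ {M} → M < N → P M) → P N
  step N rec {m} {n} {y} {z} refl 0<m 0<n 0<y 0<z eq = compare (<-cmp y z)
    where
    compare : _ → CommonBase m n
    compare (tri≈ _ y≡z _) = m , 1 , 1 , s≤s z≤n , s≤s z≤n , sym (*-identityʳ m) ,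
      trans (sym (^-injˡ y 0<y (trans eq (cong (n ^_) (sym y≡z))))) (sym (*-identityʳ m))
    compare (tri< y<z _ _) = less (<⇒∃+ y<z)
      where
      less : ∃[ d ] (0 < d × z ≡ y + d) → CommonBase m n
      less (d , 0<d , refl) = commonBase-step y d 0<m 0<n 0<y eq λ q 0<q eq′ →
        rec {y + d} (m<n+m (y + d) 0<y) {q} {n} {y} {d} refl 0<q 0<n 0<y 0<d eq′
    compare (tri> _ _ z<y) = less (<⇒∃+ z<y)
      where
      flip : CommonBase n m → CommonBase m n
      flip (r , s , t , 0<s , 0<t , n≡ , m≡) = r , t , s , 0<t , 0<s , m≡ , n≡
      less : ∃[ d ] (0 < d × y ≡ z + d) → CommonBase m n
      less (d , 0<d , refl) = flip (commonBase-step z d 0<n 0<m 0<z (sym eq) λ q 0<q eq′ →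
        rec {z + d} (m<m+n (z + d) 0<z) {q} {m} {z} {d} refl 0<q 0<m 0<z 0<d eq′)

^-pos⁻ : ∀ {m} k → 0 < k → 0 < m ^ k → 0 < m
^-pos⁻ {zero}  (suc k) _ ()
^-pos⁻ {suc m} _       _ _ = s≤s z≤n

CommonFactorisation : (a b c : ℕ) → ℕ → Set
CommonFactorisation a b c g = ∃[ αg ] ∃[ βg ] ∃[ γg ] ∃[ a₁ ] ∃[ b₁ ] ∃[ c₁ ]
  (0 < g × 0 < αg × 0 < βg × 0 < γg × 0 < a₁ × 0 < b₁ × 0 < c₁ ×
   a ≡ g ^ αg * a₁ × b ≡ g ^ βg * b₁ × c ≡ g ^ γg * c₁ × gcd g (a₁ * b₁ * c₁) ≡ 1 × gcd a₁ b₁ ≡ 1)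

valuation-of-part : ∀ {p n m n₁ k r} → Prime p → 0 < m → n ≡ m * n₁ → ¬ p ∣ n₁ → n ≡ p ^ k * r → ¬ p ∣ r →
  ∃[ w ] (m ≡ p ^ k * w × ¬ p ∣ w)
valuation-of-part {p} {n} {m} {n₁} {k} {r} pp 0<m n≡ p∤n₁ n≡′ p∤r with factorOut p m (1<prime pp) 0<m
... | s , w , m≡ , p∤w = w , trans m≡ (cong (λ t → p ^ t * w) s≡k) , p∤w
  where
  s≡k : s ≡ k
  s≡k = proj₁ (factorOut-unique s k (1<prime pp) (∤-* pp p∤w p∤n₁) p∤r
    (trans (sym (*-assoc (p ^ s) w n₁)) (trans (cong (_* n₁) (sym m≡)) (trans (sym n≡) n≡′))))

-- The Type A and Type B equalities make the parts of b ^ y₁ and c ^ z₁ (of a ^ x₂ and c ^ z₂) supported on the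
-- common primes equal, so these parts of a, b, c are powers of one integer g.
commonFactorisation : ∀ {a b c x₁ y₁ z₁ x₂ y₂ z₂} → Setup a b c x₁ y₁ z₁ x₂ y₂ z₂ → Oriented a b c x₁ y₁ z₁ x₂ y₂ z₂ →
  ∃[ g ] (CommonFactorisation a b c g × TypeAg g a b c x₁ y₁ z₁ × TypeBg g a b c x₂ y₂ z₂)
commonFactorisation {a} {b} {c} {x₁} {y₁} {z₁} {x₂} {y₂} {z₂} H oriented = go (splitPart d a 0<a) (splitPart d b 0<b) (splitPart d c 0<c)
  where
  open Setup H
  d = gcd a b
  0<x₂ : 0 < x₂
  0<x₂ = proj₁ sol₂
  0<y₁ : 0 < y₁
  0<y₁ = proj₁ (proj₂ sol₁)
  Part : ℕ → Set
  Part n = ∃[ m ] ∃[ n₁ ] (n ≡ m * n₁ × Coprime n₁ d × (∀ p → Prime p → p ∣ m → p ∣ d))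
  p∣d⇒p∣a : ∀ {p} → p ∣ d → p ∣ a
  p∣d⇒p∣a h = ∣-trans h (gcd[m,n]∣m a b)
  p∣d⇒p∣b : ∀ {p} → p ∣ d → p ∣ b
  p∣d⇒p∣b h = ∣-trans h (gcd[m,n]∣n a b)
  p∣d⇒p∣c : ∀ {p} → Prime p → p ∣ d → p ∣ c
  p∣d⇒p∣c {p} pp h = commonPrime∣c {p} {a} {b} {c} {x₁} {y₁} {z₁} pp sol₁ (p∣d⇒p∣a h) (p∣d⇒p∣b h)
  EqualValuations : (p n k n′ k′ : ℕ) → Set
  EqualValuations p n k n′ k′ = ∃[ i ] ∃[ j ] ∃[ r ] ∃[ r′ ] (n ≡ p ^ i * r × n′ ≡ p ^ j * r′ × ¬ p ∣ r × ¬ p ∣ r′ × i * k ≡ j * k′)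
  sameParts : ∀ {n m n₁ n′ m′ n₁′} k k′ → 0 < n → 0 < n′ →
    n ≡ m * n₁ → Coprime n₁ d → (∀ p → Prime p → p ∣ m → p ∣ d) →
    n′ ≡ m′ * n₁′ → Coprime n₁′ d → (∀ p → Prime p → p ∣ m′ → p ∣ d) →
    (∀ p → Prime p → p ∣ d → EqualValuations p n k n′ k′) → m ^ k ≡ m′ ^ k′
  sameParts {n} {m} {n₁} {n′} {m′} {n₁′} k k′ 0<n 0<n′ n≡ cop ps n≡′ cop′ ps′ vals =
    sameValuations⇒≡ (^-pos k 0<m) (^-pos k′ 0<m′) same
    where
    0<m : 0 < m
    0<m = *-pos⁻ˡ m n₁ (subst (0 <_) n≡ 0<n)
    0<m′ : 0 < m′
    0<m′ = *-pos⁻ˡ m′ n₁′ (subst (0 <_) n≡′ 0<n′)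
    same : ∀ p → Prime p → SameValuation p (m ^ k) (m′ ^ k′)
    same p pp with p ∣? d
    ... | no p∤d = 0 , m ^ k , m′ ^ k′ , sym (*-identityˡ _) , sym (*-identityˡ _) ,
          ∤-^ k pp (p∤d ∘ ps p pp) , ∤-^ k′ pp (p∤d ∘ ps′ p pp)
    ... | yes p∣d = build (vals p pp p∣d)
      where
      build : EqualValuations p n k n′ k′ → SameValuation p (m ^ k) (m′ ^ k′)
      build (i , j , r , r′ , n≡ᵖ , n′≡ᵖ , p∤r , p∤r′ , eq) =
        let w , m≡ , p∤w = valuation-of-part {k = i} pp 0<m n≡ (λ h → coprime-∤ pp cop h p∣d) n≡ᵖ p∤r
            w′ , m≡′ , p∤w′ = valuation-of-part {k = j} pp 0<m′ n≡′ (λ h → coprime-∤ pp cop′ h p∣d) n′≡ᵖ p∤r′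
        in i * k , w ^ k , w′ ^ k′ , ^-split {p} {i} k m≡ ,
           trans (^-split {p} {j} k′ m≡′) (cong (λ t → p ^ t * w′ ^ k′) (sym eq)) , ∤-^ k pp p∤w , ∤-^ k′ pp p∤w′
  equalB : ∀ p → Prime p → p ∣ d → EqualValuations p b y₁ c z₁
  equalB p pp p∣d = β , γ , b₁ , c₁ , b≡ , c≡ , p∤b₁ , p∤c₁ , proj₂ (proj₁ (oriented p pp (p∣d⇒p∣a p∣d) (p∣d⇒p∣b p∣d) V))
    where
    V = valuations pp 0<a 0<b 0<c
    open Valuations V
  equalA : ∀ p → Prime p → p ∣ d → EqualValuations p a x₂ c z₂
  equalA p pp p∣d = α , γ , a₁ , c₁ , a≡ , c≡ , p∤a₁ , p∤c₁ , proj₂ (proj₂ (oriented p pp (p∣d⇒p∣a p∣d) (p∣d⇒p∣b p∣d) V))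
    where
    V = valuations pp 0<a 0<b 0<c
    open Valuations V
  go : Part a → Part b → Part c → ∃[ g ] (CommonFactorisation a b c g × TypeAg g a b c x₁ y₁ z₁ × TypeBg g a b c x₂ y₂ z₂)
  go (a′ , a₁ , a≡ , copa , pa) (b′ , b₁ , b≡ , copb , pb) (c′ , c₁ , c≡ , copc , pc) =
    withBase (commonBase y₁ z₁ 0<b′ 0<c′ 0<y₁ (proj₁ (proj₂ (proj₂ sol₁))) b′c′)
    where
    0<a′ : 0 < a′
    0<a′ = *-pos⁻ˡ a′ a₁ (subst (0 <_) a≡ 0<a)
    0<b′ : 0 < b′
    0<b′ = *-pos⁻ˡ b′ b₁ (subst (0 <_) b≡ 0<b)
    0<c′ : 0 < c′
    0<c′ = *-pos⁻ˡ c′ c₁ (subst (0 <_) c≡ 0<c)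
    b′c′ : b′ ^ y₁ ≡ c′ ^ z₁
    b′c′ = sameParts y₁ z₁ 0<b 0<c b≡ copb pb c≡ copc pc equalB
    a′c′ : a′ ^ x₂ ≡ c′ ^ z₂
    a′c′ = sameParts x₂ z₂ 0<a 0<c a≡ copa pa c≡ copc pc equalA
    withBase : CommonBase b′ c′ → _
    -- `r` is a base of `b′` and `c′`; the Type B equality gives `a′^x₂ = r^(t z₂)`, so a common
    -- base of `a′` and `r` serves all three.
    withBase (r , s , t , 0<s , 0<t , b′≡ , c′≡) = finish (commonBase x₂ (t * z₂) 0<a′ 0<r 0<x₂ (*-pos {t} {z₂} 0<t (proj₁ (proj₂ (proj₂ sol₂))))
        (trans a′c′ (trans (cong (_^ z₂) c′≡) (^-*-assoc r t z₂))))
      where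
      0<r : 0 < r
      0<r = ^-pos⁻ s 0<s (subst (0 <_) b′≡ 0<b′)
      finish : CommonBase a′ r → ∃[ g ] (CommonFactorisation a b c g × TypeAg g a b c x₁ y₁ z₁ × TypeBg g a b c x₂ y₂ z₂)
      finish (g , A , R , 0<A , 0<R , a′≡ , r≡) = g ,
        (A , R * s , R * t , a₁ , b₁ , c₁ , 0<g , 0<A , *-pos {R} {s} 0<R 0<s , *-pos {R} {t} 0<R 0<t ,
         *-pos⁻ʳ a′ a₁ (subst (0 <_) a≡ 0<a) , *-pos⁻ʳ b′ b₁ (subst (0 <_) b≡ 0<b) , *-pos⁻ʳ c′ c₁ (subst (0 <_) c≡ 0<c) ,
         trans a≡ (cong (_* a₁) a′≡) ,
         trans b≡ (cong (_* b₁) (trans b′≡ (trans (cong (_^ s) r≡) (^-*-assoc g R s)))) ,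
         trans c≡ (cong (_* c₁) (trans c′≡ (trans (cong (_^ t) r≡) (^-*-assoc g R t)))) ,
         coprime⇒gcd≡1 (coprimeFromPrimes 0<g λ p pp p∣g → ∤-* pp (∤-* pp (λ h → coprime-∤ pp copa h (g⇒d p pp p∣g))
           (λ h → coprime-∤ pp copb h (g⇒d p pp p∣g))) (λ h → coprime-∤ pp copc h (g⇒d p pp p∣g))) ,
         coprime⇒gcd≡1 (coprimeFromPrimes (*-pos⁻ʳ a′ a₁ (subst (0 <_) a≡ 0<a)) λ p pp p∣a₁ p∣b₁ →
           coprime-∤ pp copa p∣a₁ (gcd-greatest (subst (p ∣_) (sym a≡) (∣n⇒∣m*n a′ p∣a₁)) (subst (p ∣_) (sym b≡) (∣n⇒∣m*n b′ p∣b₁))))) ,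
        (1<g , λ p pp p∣g → let p∣d = g⇒d p pp p∣g ; V = valuations pp 0<a 0<b 0<c in
          Types.TypeA⇒TypeAp pp (p∣d⇒p∣a p∣d) (p∣d⇒p∣b p∣d) (p∣d⇒p∣c pp p∣d) V {x₁} {y₁} {z₁}
            (proj₁ (oriented p pp (p∣d⇒p∣a p∣d) (p∣d⇒p∣b p∣d) V))) ,
        (1<g , λ p pp p∣g → let p∣d = g⇒d p pp p∣g ; V = valuations pp 0<a 0<b 0<c in
          Types.TypeB⇒TypeBp pp (p∣d⇒p∣a p∣d) (p∣d⇒p∣b p∣d) (p∣d⇒p∣c pp p∣d) V {x₂} {y₂} {z₂}
            (proj₂ (oriented p pp (p∣d⇒p∣a p∣d) (p∣d⇒p∣b p∣d) V)))
        where
        g⇒d : ∀ p → Prime p → p ∣ g → p ∣ d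
        g⇒d p pp p∣g = pa p pp (subst (p ∣_) (sym a′≡) (∣-self^ A 0<A p∣g))
        0<g : 0 < g
        0<g = ^-pos⁻ A 0<A (subst (0 <_) a′≡ 0<a′)
        1<g : 1 < g
        1<g = let p , pp , p∣d = primeDivisor 1<gcd in
          ≤-trans (1<prime pp) (∣⇒≤ {{>-nonZero 0<g}} (prime∣^ A pp (subst (p ∣_) a′≡ (case euclidsLemma a′ a₁ pp (subst (p ∣_) a≡ (p∣d⇒p∣a p∣d)) of λ
            { (inj₁ h) → h ; (inj₂ h) → ⊥-elim (coprime-∤ pp copa h p∣d) }))))

-- Exponential equations with powers of 2

-- The equation is `3^k = 1 + 2^k a^e`. With `k = 2 (n + 1)` it reads `8 g = 4 · 4^n a^e`; as `a` is
-- even, `4^n ∣ g`, hence `4^n ∣ n + 1` by lifting and `n = 0`.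
B₀≡1⇒aᵉ≡2 : ∀ {a B C x k x′} (S : DiffStructure a B C x k x′) → 1 < k →
  DiffStructure.D S ≡ 2 → DiffStructure.B₀ S ≡ 1 → a ^ DiffStructure.e S ≡ 2
B₀≡1⇒aᵉ≡2 {a} {k = k} S 1<k D≡2 B₀≡1 = byHalf (∣⇒∃* (2∣k 1<k))
  where
  open DiffStructure S
  open Even S (<-trans (s≤s z≤n) 1<k) D≡2
  byHalf : ∃[ l ] k ≡ 2 * l → a ^ e ≡ 2
  byHalf (zero  , k≡) = contradiction (subst (1 <_) k≡ 1<k) λ ()
  byHalf (suc n , k≡) = *-cancelˡ {4} (s≤s z≤n) (trans (sym (trans eq (trans (cong (λ w → 4 * (4 ^ w * a ^ e)) n≡0) (cong (4 *_) (*-identityˡ (a ^ e)))))) g≡1)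
    where
    g = geom (B₀ ^ 2 + d) (B₀ ^ 2) (suc n)
    d≡8 : d ≡ 8
    d≡8 = cong (λ w → 2 * (2 * w + 2)) B₀≡1
    2^k≡ : 2 ^ k ≡ 4 * 4 ^ n
    2^k≡ = trans (cong (2 ^_) k≡) (sym (^-*-assoc 2 2 (suc n)))
    eq : 8 * g ≡ 4 * (4 ^ n * a ^ e)
    eq = trans (cong (_* g) (sym d≡8)) (trans (halved (suc n) k≡) (trans (cong (_* a ^ e) 2^k≡) (*-assoc 4 (4 ^ n) (a ^ e))))
    4ⁿ∣g : 4 ^ n ∣ g
    4ⁿ∣g = *-cancelˡ-∣ 8 (subst (8 * 4 ^ n ∣_) (sym eq) (subst (_∣ 4 * (4 ^ n * a ^ e)) (rearrange (4 ^ n))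
      (*-monoʳ-∣ 4 (*-monoʳ-∣ (4 ^ n) (∣-self^ e 0<e 2∣a)))))
      where
      rearrange : ∀ w → 4 * (w * 2) ≡ 8 * w
      rearrange = solve-∀
    4ⁿ∣1+n : 4 ^ n ∣ suc n
    4ⁿ∣1+n = lifting (4 ^ n) (suc n) (^-pos n (s≤s z≤n)) (λ q pq q∣ → subst (λ w → Lifts w d (B₀ ^ 2))
      (sym (prime∣2^⇒≡2 2 pq (prime∣^ n pq q∣))) lifts₂) 4ⁿ∣g
    n≡0 : n ≡ 0
    n≡0 with n ≟ 0
    ... | yes h = h
    ... | no n≢0 = contradiction (∣⇒≤ 4ⁿ∣1+n) (<⇒≱ (1+k<m^k {4} n (s≤s (s≤s (s≤s z≤n))) (n≢0⇒n>0 n≢0)))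
    g≡1 : 8 * g ≡ 4 * 2
    g≡1 = cong (8 *_) (trans (cong (λ w → geom (B₀ ^ 2 + d) (B₀ ^ 2) (suc w)) n≡0) (cong suc (*-zeroʳ (B₀ ^ 2))))

half-pos : ∀ i {m} → m ≡ 2 * i → 0 < m → 0 < i × i < m
half-pos zero    refl ()
half-pos (suc i) refl _ = s≤s z≤n , m<m+n (suc i) (s≤s z≤n)

odd^-Mod : ∀ {q N} i → Mod q (N ^ 2) 1 → Mod q (N ^ (1 + 2 * i)) N
odd^-Mod {q} {N} i sq = subst₂ (Mod q) (cong (N *_) (^-*-assoc N 2 i)) (trans (cong (N *_) (^-zeroˡ i)) (*-identityʳ N)) (Mod-*ˡ N (Mod-^ i sq))

even^-Mod : ∀ {q N} i → Mod q (N ^ 2) 1 → Mod q (N ^ (2 * i)) 1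
even^-Mod {q} {N} i sq = subst₂ (Mod q) (^-*-assoc N 2 i) (^-zeroˡ i) (Mod-^ i sq)

4∤2 : ¬ 4 ∣ 2
4∤2 h = <⇒≱ (s≤s (s≤s (s≤s z≤n))) (∣⇒≤ h)

mersenne-odd : ∀ {N} k → 0 < k → N + 1 ≡ 2 ^ k → Odd N
mersenne-odd {N} k 0<k N≡ 2∣N = ∤1 prime[2] (∣m+n∣m⇒∣n (subst (2 ∣_) (sym N≡) (∣-self^ k 0<k ∣-refl)) 2∣N)

-- `(2^k - 1)² = 2^(2k) - 2^(k+1) + 1` with `2k ≥ k + 1`.
mersenne² : ∀ {N} k → 0 < k → N + 1 ≡ 2 ^ k → Mod (2 * 2 ^ k) (N ^ 2) 1
mersenne² {N} (suc k) _ N≡ = slack 1 (2 ^ k) (+-cancelʳ-≡ (2 * N + 1) _ _ (begin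
  N * (N * 1) + 2 * K * 1 + (2 * N + 1)      ≡⟨ left N K ⟩
  (N + 1) * (N + 1) + 2 * K                  ≡⟨ cong (λ w → w * w + 2 * K) N≡ ⟩
  K * K + 2 * K                              ≡⟨ cong (λ w → K * K + 2 * w) (sym N≡) ⟩
  K * K + 2 * (N + 1)                        ≡⟨ right N (2 ^ k) ⟩
  1 + 2 * K * 2 ^ k + (2 * N + 1)            ∎))
  where
  open ≡-Reasoning
  K = 2 ^ suc k
  left : ∀ N K → N * (N * 1) + 2 * K * 1 + (2 * N + 1) ≡ (N + 1) * (N + 1) + 2 * K
  left = solve-∀
  right : ∀ N w → 2 * w * (2 * w) + 2 * (N + 1) ≡ 1 + 2 * (2 * w) * w + (2 * N + 1)
  right = solve-∀

-- An odd power of `2^k - 1` is congruent to `2^k - 1` modulo `2^(k+1)`, so adding 1 yields exactly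
-- `k` factors 2; the other side yields at least `k′`.
mersenne-powers-< : ∀ {N N′} k k′ i j → 0 < k → k < k′ → N + 1 ≡ 2 ^ k → N′ + 1 ≡ 2 ^ k′ → N ^ (1 + 2 * i) ≢ N′ ^ (1 + 2 * j)
mersenne-powers-< {N} {N′} k k′ i j 0<k k<k′ N≡ N≡′ eq = <⇒≱ (m<m+n (2 ^ k) (≤-trans (^-pos k (s≤s z≤n)) (m≤m+n _ 0)))
  (∣⇒≤ {{>-nonZero (^-pos k (s≤s z≤n))}} (subst (2 * 2 ^ k ∣_) N≡ (Mod-∣ (Mod-+ (odd^-Mod {N = N} i (mersenne² k 0<k N≡)) (Mod-refl {m = 1})) divisible)))
  where
  2^∣2^ : ∀ {i j} → i ≤ j → 2 ^ i ∣ 2 ^ j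
  2^∣2^ {i} i≤j = subst (2 ^ i ∣_) (trans (sym (^-distribˡ-+-* 2 i _)) (cong (2 ^_) (m+[n∸m]≡n i≤j))) (m∣m*n _)
  divisible : 2 ^ suc k ∣ N ^ (1 + 2 * i) + 1
  divisible = ∣-trans (2^∣2^ k<k′) (subst (2 ^ k′ ∣_) (sym (cong (_+ 1) eq))
    (Mod-∣ (Mod-+ (Mod-sym {n = N′} (odd^-Mod {N = N′} j sq)) (Mod-refl {m = 1})) (subst (2 ^ k′ ∣_) (sym N≡′) ∣-refl)))
    where
    weaken : ∀ {q m n} → Mod (2 * q) m n → Mod q m n
    weaken {q} {m} {n} (slack i j e) = slack (2 * i) (2 * j) (trans (move m q i) (trans e (sym (move n q j))))
      where
      move : ∀ m q i → m + q * (2 * i) ≡ m + 2 * q * i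
      move = solve-∀
    sq : Mod (2 ^ k′) (N′ ^ 2) 1
    sq = weaken (mersenne² k′ (<-trans 0<k k<k′) N≡′)

-- Descent on the exponents: two even ones are halved, mixed parities give -1 against 1 modulo 4,
-- and two odd ones are compared by their powers of 2.
mersenne-powers : ∀ {N N′} k k′ m n → 1 < k → 1 < k′ → 0 < m → N + 1 ≡ 2 ^ k → N′ + 1 ≡ 2 ^ k′ → N ^ m ≡ N′ ^ n → k ≡ k′
mersenne-powers {N} {N′} k k′ m n 1<k 1<k′ 0<m N≡ N≡′ eq = <-rec P step m n 0<m eq
  where
  0<k : 0 < k
  0<k = <-trans (s≤s z≤n) 1<k
  0<k′ : 0 < k′
  0<k′ = <-trans (s≤s z≤n) 1<k′
  P : ℕ → Set
  P m = ∀ n → 0 < m → N ^ m ≡ N′ ^ n → k ≡ k′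
  mismatch : ∀ {N N′} k k′ i j → 1 < k → 0 < k′ → N + 1 ≡ 2 ^ k → N′ + 1 ≡ 2 ^ k′ → N ^ (1 + 2 * i) ≢ N′ ^ (2 * j)
  mismatch {N} {N′} k k′ i j 1<k 0<k′ N≡ N≡′ eq = 4∤2 (Mod-∣ (Mod-+ (even^-Mod {N = N′} j (odd²≈1 (mersenne-odd k′ 0<k′ N≡′))) (Mod-refl {m = 1}))
    (subst (λ w → 4 ∣ w + 1) eq (Mod-∣ (Mod-+ (Mod-sym (odd^-Mod {N = N} i (odd²≈1 (mersenne-odd k (<-trans (s≤s z≤n) 1<k) N≡)))) (Mod-refl {m = 1}))
      (subst (4 ∣_) (sym N≡) (4∣2^ 1<k)))))
  step : ∀ m → (∀ {i} → i < m → P i) → P m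
  step m rec n 0<m eq = byParity (parity m) (parity n)
    where
    byParity : _ → _ → k ≡ k′
    byParity (inj₁ 2∣m) (inj₁ 2∣n) =
      let i , m≡ = ∣⇒∃* 2∣m ; j , n≡ = ∣⇒∃* 2∣n ; 0<i , i<m = half-pos i m≡ 0<m
      in rec i<m j 0<i (^-injˡ 2 (s≤s z≤n) (trans (square N i) (trans (cong (N ^_) (sym m≡)) (trans eq (trans (cong (N′ ^_) n≡) (sym (square N′ j)))))))
      where
      square : ∀ N i → (N ^ i) ^ 2 ≡ N ^ (2 * i)
      square N i = trans (^-*-assoc N i 2) (cong (N ^_) (*-comm i 2))
    byParity (inj₂ (i , refl)) (inj₁ 2∣n) = let j , n≡ = ∣⇒∃* 2∣n in
      ⊥-elim (mismatch k k′ i j 1<k 0<k′ N≡ N≡′ (trans eq (cong (N′ ^_) n≡)))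
    byParity (inj₁ 2∣m) (inj₂ (j , refl)) = let i , m≡ = ∣⇒∃* 2∣m in
      ⊥-elim (mismatch k′ k j i 1<k′ 0<k N≡′ N≡ (trans (sym eq) (cong (N ^_) m≡)))
    byParity (inj₂ (i , refl)) (inj₂ (j , refl)) = compare (<-cmp k k′)
      where
      compare : _ → k ≡ k′
      compare (tri≈ _ k≡k′ _) = k≡k′
      compare (tri< k<k′ _ _) = ⊥-elim (mersenne-powers-< k k′ i j 0<k k<k′ N≡ N≡′ eq)
      compare (tri> _ _ k′<k) = ⊥-elim (mersenne-powers-< k′ k j i 0<k′ k′<k N≡′ N≡ (sym eq))

-- An even `Y` gives 2 modulo 4. For odd `Y`, `b + 1` divides `2^m`, so `b` and `b^Y` are both one
-- less than a power of 2, and `mersenne-powers` identifies these.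
perfectPower+1≡2^⇒exponent≡1 : ∀ {b} Y m → 0 < Y → 1 < m → b ^ Y + 1 ≡ 2 ^ m → Y ≡ 1
perfectPower+1≡2^⇒exponent≡1 {b} Y m 0<Y 1<m eq = byParity (parity Y)
  where
  0<m : 0 < m
  0<m = <-trans (s≤s z≤n) 1<m
  b-odd : Odd b
  b-odd 2∣b = mersenne-odd m 0<m eq (∣-self^ Y 0<Y 2∣b)
  1<b : 1 < b
  1<b = ≤∧≢⇒< (n≢0⇒n>0 λ { refl → b-odd (2 ∣0) }) λ { refl → 4∤2 (subst (4 ∣_) (trans (sym eq) (cong (_+ 1) (^-zeroˡ Y))) (4∣2^ 1<m)) }
  byParity : 2 ∣ Y ⊎ ∃[ i ] Y ≡ 1 + 2 * i → Y ≡ 1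
  byParity (inj₁ 2∣Y) = let j , Y≡ = ∣⇒∃* 2∣Y in
    ⊥-elim (4∤2 (Mod-∣ (Mod-+ (even^-Mod {N = b} j (odd²≈1 b-odd)) (Mod-refl {m = 1}))
      (subst (λ w → 4 ∣ b ^ w + 1) Y≡ (subst (4 ∣_) (sym eq) (4∣2^ 1<m)))))
  byParity (inj₂ (i , Y≡)) = base (onlyPrime2⇒powerOf2 (m<n⇒0<n (m<m+n b (s≤s z≤n)))
      λ q pq q∣ → prime∣2^⇒≡2 m pq (subst (q ∣_) b^Y+1≡ (∣-trans q∣ (sum∣sum^odd b 1 i))))
    where
    b^Y+1≡ : b ^ (1 + 2 * i) + 1 ^ (1 + 2 * i) ≡ 2 ^ m
    b^Y+1≡ = trans (cong₂ _+_ (cong (b ^_) (sym Y≡)) (^-zeroˡ (1 + 2 * i))) eq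
    base : IsPowerOf2 (b + 1) → Y ≡ 1
    base (k , b+1≡) = ^-injʳ Y 1 1<b (trans (+-cancelʳ-≡ 1 _ _ (trans eq (trans (cong (2 ^_) (sym k≡m)) (sym b+1≡)))) (sym (*-identityʳ b)))
      where
      1<k : 1 < k
      1<k = ^-cancelʳ-< {2} 1 k (s≤s z≤n) (subst (2 <_) b+1≡ (+-monoˡ-< 1 1<b))
      k≡m : k ≡ m
      k≡m = mersenne-powers k m Y 1 1<k 1<m 0<Y b+1≡ eq (sym (*-identityʳ (b ^ Y)))

-- An odd `Z` gives 3 modulo 4, so `m = 1`. For `Z = 2l`, `9^l - 1 = 8 g` with `g` a power of 2
-- dividing `l`, so `l = 1`.
power-of-3≡2^+1 : ∀ Z m → 0 < Z → 0 < m → 3 ^ Z ≡ 1 + 2 ^ m → (Z ≡ 1 × m ≡ 1) ⊎ (Z ≡ 2 × m ≡ 3)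
power-of-3≡2^+1 Z m 0<Z 0<m eq = byParity (parity Z)
  where
  byParity : 2 ∣ Z ⊎ ∃[ i ] Z ≡ 1 + 2 * i → (Z ≡ 1 × m ≡ 1) ⊎ (Z ≡ 2 × m ≡ 3)
  byParity (inj₂ (i , Z≡)) with m ≟ 1
  ... | yes m≡1 = inj₁ (^-injʳ Z 1 (s≤s (s≤s z≤n)) (trans eq (cong (λ w → 1 + 2 ^ w) m≡1)) , m≡1)
  ... | no m≢1 = ⊥-elim (4∤2 (Mod⇒∣ 1 (Mod-trans (Mod-sym (odd^-Mod {N = 3} i (odd²≈1 (1+2m-odd 1))))
        (subst (λ w → Mod 4 w 1) (trans (sym eq) (cong (3 ^_) Z≡)) (∣⇒Mod 1 (4∣2^ (≤∧≢⇒< 0<m (m≢1 ∘ sym))))))))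
  byParity (inj₁ 2∣Z) = even (∣⇒∃* 2∣Z)
    where
    even : ∃[ l ] Z ≡ 2 * l → (Z ≡ 1 × m ≡ 1) ⊎ (Z ≡ 2 × m ≡ 3)
    even (l , Z≡) = inj₂ (Z≡2 , ^-injʳ m 3 (s≤s (s≤s z≤n)) (+-cancelˡ-≡ 1 _ _ (trans (sym eq) (cong (3 ^_) Z≡2))))
      where
      g = geom 9 1 l
      8g≡ : 8 * g ≡ 2 ^ m
      8g≡ = +-cancelˡ-≡ 1 _ _ (trans (cong (_+ 8 * g) (sym (^-zeroˡ l))) (trans (sym (^-diff 1 8 l)) (trans (^-*-assoc 3 2 l) (trans (cong (3 ^_) (sym Z≡)) eq))))
      0<l : 0 < l
      0<l = *-pos⁻ʳ 2 l (subst (0 <_) Z≡ 0<Z)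
      g∣l : g ∣ l
      g∣l = lifting g {8} {1} l (*-pos⁻ʳ 8 g (subst (0 <_) (sym 8g≡) (^-pos m (s≤s z≤n))))
        (λ q pq q∣g → subst (λ w → Lifts w 8 1) (sym (prime∣2^⇒≡2 m pq (subst (q ∣_) 8g≡ (∣n⇒∣m*n 8 q∣g))))
          (divides 4 refl , ∤1 prime[2] , λ _ → divides 2 refl)) ∣-refl
      Z≡2 : Z ≡ 2
      Z≡2 = trans Z≡ (cong (2 *_) (geom≤k⇒k≡1 l 0<l (s≤s (s≤s (s≤s z≤n))) (∣⇒≤ {{>-nonZero 0<l}} g∣l)))

-- With `c = 1 + s`, both factors of `s · geom = 2^m` are powers of 2. If `4 ∣ s`, lifting forces
-- `Z = 1`; `s = 1` fails by parity and `s = 2` is the case of powers of 3, with the exception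
-- `9 = 8 + 1`.
perfectPower≡2^+1 : ∀ {c} Z m → 0 < Z → 0 < m → c ^ Z ≡ 2 ^ m + 1 → Z ≡ 1 ⊎ (c ≡ 3 × Z ≡ 2 × m ≡ 3)
perfectPower≡2^+1 {zero} (suc Z) m _ 0<m eq = contradiction eq (<⇒≢ (≤-trans (s≤s z≤n) (m≤n+m 1 (2 ^ m))))
perfectPower≡2^+1 {suc s} Z m 0<Z 0<m eq = byDivisibility (4 ∣? s)
  where
  g = geom (1 + s) 1 Z
  sg≡ : s * g ≡ 2 ^ m
  sg≡ = +-cancelˡ-≡ 1 _ _ (trans (cong (_+ s * g) (sym (^-zeroˡ Z))) (trans (sym (^-diff 1 s Z)) (trans eq (+-comm (2 ^ m) 1))))
  0<sg : 0 < s * g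
  0<sg = subst (0 <_) (sym sg≡) (^-pos m (s≤s z≤n))
  0<s : 0 < s
  0<s = *-pos⁻ˡ s g 0<sg
  g∣Z : 4 ∣ s → g ∣ Z
  g∣Z 4∣s = lifting g {s} {1} Z (*-pos⁻ʳ s g 0<sg)
    (λ q pq q∣g → subst (λ w → Lifts w s 1) (sym (prime∣2^⇒≡2 m pq (subst (q ∣_) sg≡ (∣n⇒∣m*n s q∣g))))
      (∣-trans (divides 2 refl) 4∣s , ∤1 prime[2] , λ _ → 4∣s)) ∣-refl
  small : s ≡ 1 ⊎ s ≡ 2 → Z ≡ 1 ⊎ (suc s ≡ 3 × Z ≡ 2 × m ≡ 3)
  small (inj₁ refl) = ⊥-elim (∤1 prime[2] (∣m+n∣m⇒∣n (subst (2 ∣_) eq (∣-self^ Z 0<Z ∣-refl)) (∣-self^ m 0<m ∣-refl)))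
  small (inj₂ refl) with power-of-3≡2^+1 Z m 0<Z 0<m (trans eq (+-comm (2 ^ m) 1))
  ... | inj₁ (Z≡1 , _) = inj₁ Z≡1
  ... | inj₂ (Z≡2 , m≡3) = inj₂ (refl , Z≡2 , m≡3)
  byDivisibility : Dec (4 ∣ s) → Z ≡ 1 ⊎ (suc s ≡ 3 × Z ≡ 2 × m ≡ 3)
  byDivisibility (yes 4∣s) = inj₁ (geom≤k⇒k≡1 Z 0<Z (s≤s (≤-trans (s≤s (s≤s z≤n)) (∣⇒≤ {{>-nonZero 0<s}} 4∣s)))
    (∣⇒≤ {{>-nonZero 0<Z}} (g∣Z 4∣s)))
  byDivisibility (no 4∤s) = small (oneOrTwo 0<s
    (λ q pq q≢2 q∣s → q≢2 (prime∣2^⇒≡2 m pq (subst (q ∣_) sg≡ (∣m⇒∣m*n g q∣s)))) 4∤s)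

-- Modulo 7 the order of 3 is 6, so `6 ∣ z`. But `3^6 = 729` is 1 modulo 13 as well, and 13 cannot
-- divide `2^f 7^y`.
1+2^f*7^y≢3^z : ∀ f y z → 0 < y → 1 + 2 ^ f * 7 ^ y ≢ 3 ^ z
1+2^f*7^y≢3^z f y z 0<y eq = byResidue (z % 6) (m%n<n z 6) (m≡m%n+[m/n]*n z 6)
  where
  3^z≡ : ∀ r q → z ≡ r + q * 6 → 3 ^ z ≡ 3 ^ r * 729 ^ q
  3^z≡ r q z≡ = trans (cong (3 ^_) z≡) (trans (^-distribˡ-+-* 3 r (q * 6)) (cong (3 ^ r *_) (trans (cong (3 ^_) (*-comm q 6)) (sym (^-*-assoc 3 6 q)))))
  residue : ∀ r q → z ≡ r + q * 6 → Mod 7 (3 ^ r) 1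
  residue r q z≡ = Mod-trans (subst₂ (Mod 7) (*-identityʳ (3 ^ r)) (sym (3^z≡ r q z≡)) (Mod-*ˡ (3 ^ r)
      (Mod-sym (subst (Mod 7 (729 ^ q)) (^-zeroˡ q) (Mod-^ q (slack 0 104 refl))))))
    (subst (λ w → Mod 7 w 1) eq (∣⇒Mod 1 (∣n⇒∣m*n (2 ^ f) (∣-self^ y 0<y ∣-refl))))
  impossible : ∀ r n → z ≡ r + (z / 6) * 6 → 3 ^ r ≡ 1 + n → ¬ 7 ∣ n → ⊥
  impossible r n z≡ 3^r≡ 7∤n = 7∤n (Mod⇒∣ 1 (subst (λ w → Mod 7 w 1) 3^r≡ (residue r (z / 6) z≡)))
  byResidue : ∀ r → r < 6 → z ≡ r + (z / 6) * 6 → ⊥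
  byResidue 0 _ z≡ = ∤-* p13 (∤-^ f p13 (toWitnessFalse {a? = 13 ∣? 2} _)) (∤-^ y p13 (toWitnessFalse {a? = 13 ∣? 7} _))
      (Mod⇒∣ 1 (subst₂ (Mod 13) (trans (sym (trans (3^z≡ 0 (z / 6) z≡) (*-identityˡ _))) (sym eq)) (^-zeroˡ (z / 6)) (Mod-^ (z / 6) (slack 0 56 refl))))
    where
    p13 : Prime 13
    p13 = toWitness {a? = prime? 13} _
  byResidue 1 _ z≡ = impossible 1 2 z≡ refl (toWitnessFalse {a? = 7 ∣? 2} _)
  byResidue 2 _ z≡ = impossible 2 8 z≡ refl (toWitnessFalse {a? = 7 ∣? 8} _)
  byResidue 3 _ z≡ = impossible 3 26 z≡ refl (toWitnessFalse {a? = 7 ∣? 26} _)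
  byResidue 4 _ z≡ = impossible 4 80 z≡ refl (toWitnessFalse {a? = 7 ∣? 80} _)
  byResidue 5 _ z≡ = impossible 5 242 z≡ refl (toWitnessFalse {a? = 7 ∣? 242} _)
  byResidue (suc (suc (suc (suc (suc (suc _)))))) (s≤s (s≤s (s≤s (s≤s (s≤s (s≤s ())))))) _

-- The part of `n` shared with `w′` is absorbed there; the remaining cofactor divides the geometric
-- sum and hence, by lifting, `z`.
lifting-bound : ∀ {n w′ w} z → 0 < n → 0 < w′ → 0 < z → (∀ q → Prime q → q ∣ n → q ∣ w × q ≢ 2) → n ∣ w′ * geom (1 + w) 1 z → n ≤ w′ * z
lifting-bound {n} {w′} {w} z 0<n 0<w′ 0<z primes n∣ with gcdSplit n w′ 0<n
... | h , n₀ , w₀ , 0<h , refl , refl , cop = subst (h * n₀ ≤_) (sym (*-assoc h w₀ z)) (*-monoʳ-≤ h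
      (≤-trans (∣⇒≤ {{>-nonZero 0<z}} n₀∣z) (m≤n*m z w₀ {{>-nonZero (*-pos⁻ʳ h w₀ 0<w′)}})))
  where
  n₀∣z : n₀ ∣ z
  n₀∣z = lifting n₀ {w} {1} z (*-pos⁻ʳ h n₀ 0<n)
    (λ q pq q∣n₀ → let q∣w , q≢2 = primes q pq (∣n⇒∣m*n h q∣n₀) in q∣w , ∤1 pq , λ q≡2 → ⊥-elim (q≢2 q≡2))
    (coprime-divisor cop (*-cancelˡ-∣ h {{>-nonZero 0<h}} (subst (h * n₀ ∣_) (*-assoc h w₀ (geom (1 + w) 1 z)) n∣)))

-- With x = c ^ m ≡ 1 (mod 2 ^ m b), lifting gives 2 ^ m b ^ y ≤ (x − 1) z, too small since c ≤ 2 b.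
1+2^f*b^y≢[b+2]^z : ∀ {b} m f y z → 1 < m → 0 < z → z < y → b + 1 ≡ 2 ^ m → 1 + 2 ^ f * b ^ y ≢ (b + 2) ^ z
1+2^f*b^y≢[b+2]^z {b} m f y z 1<m 0<z z<y b≡ eq = <⇒≱ upper lower
  where
  open ≤-Reasoning
  c = b + 2
  0<m : 0 < m
  0<m = <-trans (s≤s z≤n) 1<m
  b-odd : Odd b
  b-odd = mersenne-odd m 0<m b≡
  m≤b : m ≤ b
  m≤b = s≤s⁻¹ (subst (m <_) (trans (sym b≡) (+-comm b 1)) (k<m^k m (s≤s (s≤s z≤n))))
  1<b : 1 < b
  1<b = <-≤-trans 1<m m≤b
  0<b : 0 < b
  0<b = <-trans (s≤s z≤n) 1<b
  c≡ : c ≡ 1 + 2 ^ m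
  c≡ = trans (sym (+-assoc b 1 1)) (trans (cong (_+ 1) b≡) (+-comm (2 ^ m) 1))
  c≈2 : Mod b c 2
  c≈2 = subst (λ w → Mod b w 2) (+-comm 2 b) (∣⇒Mod 2 ∣-refl)
  2^m≈1 : Mod b (2 ^ m) 1
  2^m≈1 = subst (λ w → Mod b w 1) (trans (+-comm 1 b) b≡) (∣⇒Mod 1 ∣-refl)
  c^z≈1 : Mod b (c ^ z) 1
  c^z≈1 = subst (λ w → Mod b w 1) eq (∣⇒Mod 1 (∣n⇒∣m*n (2 ^ f) (∣-self^ y (<-trans 0<z z<y) ∣-refl)))
  -- Since `c ≡ 2 (mod b)`, `b = 2^m - 1` divides `2^z - 1`, which is positive and too small if
  -- `z < m`.
  m≤z : m ≤ z
  m≤z = ≮⇒≥ λ z<m → let t , 0<t , 2^z≡ = <⇒∃+ (1<^ {2} z (s≤s (s≤s z≤n)) 0<z)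
                        b∣t = Mod⇒∣ 1 (subst (λ w → Mod b w 1) 2^z≡ (Mod-trans (Mod-sym (Mod-^ z c≈2)) c^z≈1))
                    in <⇒≱ (^-monoʳ-< 2 (s≤s (s≤s z≤n)) z<m)
                         (subst₂ _≤_ (trans (+-comm 1 b) b≡) (sym 2^z≡) (s≤s (∣⇒≤ {{>-nonZero 0<t}} b∣t)))
  w′ = geom (1 + 2 ^ m) 1 m
  w = 2 ^ m * w′
  x≡ : c ^ m ≡ 1 + w
  x≡ = trans (cong (_^ m) c≡) (trans (^-diff 1 (2 ^ m) m) (cong (_+ w) (^-zeroˡ m)))
  b∣w : b ∣ w
  b∣w = Mod⇒∣ 1 (subst (λ t → Mod b t 1) x≡ (Mod-trans (Mod-^ m c≈2) 2^m≈1))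
  0<w : 0 < w
  0<w = s≤s⁻¹ (subst (1 <_) x≡ (1<^ m (≤-trans 1<b (m≤m+n b 2)) 0<m))
  -- `c^(mz) - 1` is factored twice, from `c^z = 1 + M` and from `c^m = 1 + w`.
  b^y∣ : b ^ y ∣ w * geom (1 + w) 1 z
  b^y∣ = ∣-trans (n∣m*n (2 ^ f)) (subst (2 ^ f * b ^ y ∣_) eq′ (m∣m*n _))
    where
    M = 2 ^ f * b ^ y
    eq′ : M * geom (1 + M) 1 m ≡ w * geom (1 + w) 1 z
    eq′ = +-cancelˡ-≡ 1 _ _ (trans (cong (_+ M * geom (1 + M) 1 m) (sym (^-zeroˡ m))) (trans (sym (^-diff 1 M m)) (trans (cong (_^ m) eq)
      (trans (^-^-comm c z m) (trans (cong (_^ z) x≡) (trans (^-diff 1 w z) (cong (_+ w * geom (1 + w) 1 z) (^-zeroˡ z))))))))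
  b^y∣′ : b ^ y ∣ w′ * geom (1 + w) 1 z
  b^y∣′ = coprime-divisor (coprimeFromPrimes (^-pos y 0<b) λ p pp p∣b^y p∣2^m →
      b-odd (subst (_∣ b) (prime∣2^⇒≡2 m pp p∣2^m) (prime∣^ y pp p∣b^y)))
    (subst (b ^ y ∣_) (*-assoc (2 ^ m) w′ (geom (1 + w) 1 z)) b^y∣)
  bound : b ^ y ≤ w′ * z
  bound = lifting-bound {w = w} z (^-pos y 0<b) (*-pos⁻ʳ (2 ^ m) w′ 0<w) 0<z
    (λ q pq q∣ → ∣-trans (prime∣^ y pq q∣) b∣w , λ { refl → b-odd (prime∣^ y pq q∣) }) b^y∣′
  upper : 2 ^ m * b ^ y < 2 ^ m * (b ^ m * z)
  upper = begin-strict
    2 ^ m * b ^ y           ≤⟨ *-monoʳ-≤ (2 ^ m) bound ⟩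
    2 ^ m * (w′ * z)        ≡⟨ sym (*-assoc (2 ^ m) w′ z) ⟩
    w * z                   <⟨ *-monoˡ-< z {{>-nonZero 0<z}} (subst (w <_) (sym x≡) (n<1+n w)) ⟩
    c ^ m * z               ≤⟨ *-monoˡ-≤ z (^-monoˡ-≤ m (subst (b + 2 ≤_) (cong (b +_) (sym (+-identityʳ b))) (+-monoʳ-≤ b 1<b))) ⟩
    (2 * b) ^ m * z         ≡⟨ trans (cong (_* z) (^-*-distrib 2 b m)) (*-assoc (2 ^ m) (b ^ m) z) ⟩
    2 ^ m * (b ^ m * z)     ∎
  -- With `z = m + r` and `z < y`: `b^y ≥ b^m b^(r+1) ≥ b^m m (r + 1) ≥ b^m z`.
  lower : 2 ^ m * (b ^ m * z) ≤ 2 ^ m * b ^ y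
  lower = *-monoʳ-≤ (2 ^ m) (begin
    b ^ m * z                  ≡⟨ cong (b ^ m *_) z≡ ⟩
    b ^ m * (m + r)            ≤⟨ *-monoʳ-≤ (b ^ m) (+-monoʳ-≤ m (m≤n*m r m {{>-nonZero 0<m}})) ⟩
    b ^ m * (m + m * r)        ≡⟨ cong (b ^ m *_) (sym (*-suc m r)) ⟩
    b ^ m * (m * suc r)        ≤⟨ *-monoʳ-≤ (b ^ m) (*-mono-≤ m≤b (k<m^k r 1<b)) ⟩
    b ^ m * b ^ suc r          ≡⟨ sym (^-distribˡ-+-* b m (suc r)) ⟩
    b ^ (m + suc r)            ≤⟨ ^-monoʳ-≤ b {{>-nonZero 0<b}} (subst (_≤ y) (trans (cong suc z≡) (sym (+-suc m r))) z<y) ⟩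
    b ^ y                      ∎)
    where
    r = z ∸ m
    z≡ : z ≡ m + r
    z≡ = sym (m+[n∸m]≡n m≤z)

-- The third solution

mersenne∸-odd : ∀ m → 0 < m → Odd (2 ^ m ∸ 1)
mersenne∸-odd m 0<m = mersenne-odd m 0<m (m∸n+n≡m (^-pos m (s≤s z≤n)))

1+2^-odd : ∀ m → 0 < m → Odd (2 ^ m + 1)
1+2^-odd m 0<m h = ∤1 prime[2] (∣m+n∣m⇒∣n h (∣-self^ m 0<m ∣-refl))

-- `(x, y)` and `(x′, y′)` belong to a family (i) pair with `a` a power of 2, and `s₂` is another
-- solution. If `s₂` is Type B at 2, its left summand is the power of 2 contained in `c^z₂`;
-- dividing by it leaves `1 + 2^f b₁^y₂ = c₁^z₂`, with `f > 0`.
module PowerOf2Third {a b c x y z x′ y′ u m x₂ y₂ z₂} (V : Valuations 2 a b c) (a-powerOf2 : IsPowerOf2 a)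
  (0<u : 0 < u) (0<m : 0 < m) (b^y≡ : b ^ y ≡ 2 ^ u * (2 ^ m ∸ 1)) (c^z≡ : c ^ z ≡ 2 ^ u * (2 ^ m + 1))
  (a^x≡ : a ^ x ≡ 2 ^ (u + 1)) (a^x′≡ : a ^ x′ ≡ 2 ^ (2 * u + suc m + 1)) (y′≡ : y′ ≡ 2 * y)
  (0<y : 0 < y) (0<z : 0 < z) (s₂ : Sol a b c x₂ y₂ z₂) where
  open Valuations V

  CorrespondsToEither : Set
  CorrespondsToEither = Corr a b x y a b x₂ y₂ ⊎ Corr a b x′ y′ a b x₂ y₂

  a₁≡1 : a₁ ≡ 1
  a₁≡1 = sym (proj₂ (factorOut-unique {2} (proj₁ a-powerOf2) α (s≤s (s≤s z≤n)) (∤1 prime[2]) p∤a₁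
    (trans (*-identityʳ _) (trans (sym (proj₂ a-powerOf2)) a≡))))

  b-split : β * y ≡ u × b₁ ^ y ≡ 2 ^ m ∸ 1
  b-split = factorOut-unique {2} (β * y) u (s≤s (s≤s z≤n)) (∤-^ y prime[2] p∤b₁) (mersenne∸-odd m 0<m) (trans (sym (^-split {2} {β} y b≡)) b^y≡)

  c-split : γ * z ≡ u × c₁ ^ z ≡ 2 ^ m + 1
  c-split = factorOut-unique {2} (γ * z) u (s≤s (s≤s z≤n)) (∤-^ z prime[2] p∤c₁) (1+2^-odd m 0<m) (trans (sym (^-split {2} {γ} z c≡)) c^z≡)

  b₁^y+1≡ : b₁ ^ y + 1 ≡ 2 ^ m
  b₁^y+1≡ = trans (cong (_+ 1) (proj₂ b-split)) (m∸n+n≡m (^-pos m (s≤s z≤n)))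

  a^≡ : ∀ n → a ^ n ≡ 2 ^ (α * n)
  a^≡ n = trans (^-split {2} {α} n a≡) (trans (cong (2 ^ (α * n) *_) (trans (cong (_^ n) a₁≡1) (^-zeroˡ n))) (*-identityʳ _))

  reduced : ∀ f → α * x₂ ≡ γ * z₂ → β * y₂ ≡ α * x₂ + f → 1 + 2 ^ f * b₁ ^ y₂ ≡ c₁ ^ z₂
  reduced f αx≡γz βy≡ = *-cancelˡ (^-pos (γ * z₂) (s≤s z≤n)) (begin
    2 ^ (γ * z₂) * (1 + 2 ^ f * b₁ ^ y₂)                   ≡⟨ cong (λ w → 2 ^ w * (1 + 2 ^ f * b₁ ^ y₂)) (sym αx≡γz) ⟩
    2 ^ (α * x₂) * (1 + 2 ^ f * b₁ ^ y₂)                   ≡⟨ sym (factor-+ 2 (α * x₂) f 1 (b₁ ^ y₂)) ⟩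
    2 ^ (α * x₂) * 1 + 2 ^ (α * x₂ + f) * b₁ ^ y₂          ≡⟨ cong₂ _+_ (trans (*-identityʳ _) (sym (a^≡ x₂)))
                                                              (trans (cong (λ w → 2 ^ w * b₁ ^ y₂) (sym βy≡)) (sym (^-split {2} {β} y₂ b≡))) ⟩
    a ^ x₂ + b ^ y₂                                        ≡⟨ proj₂ (proj₂ (proj₂ s₂)) ⟩
    c ^ z₂                                                 ≡⟨ ^-split {2} {γ} z₂ c≡ ⟩
    2 ^ (γ * z₂) * c₁ ^ z₂                                 ∎)
    where open ≡-Reasoning

  -- Here `y = 1`, so `b₁ = 2^m - 1`. Either `z = 1`, whence `c₁ = b₁ + 2` and `β = γ`, so Type B
  -- means `z₂ < y₂`; or `c₁ = 3`, `b₁ = 7` through `9 = 8 + 1`.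
  large : 1 < m → α * x₂ ≡ γ * z₂ → ∀ f → β * y₂ ≡ α * x₂ + f → 0 < f → ⊥
  large 1<m αx≡γz f βy≡ 0<f = byShape (perfectPower≡2^+1 z m 0<z 0<m (proj₂ c-split))
    where
    y≡1 : y ≡ 1
    y≡1 = perfectPower+1≡2^⇒exponent≡1 y m 0<y 1<m b₁^y+1≡
    b₁+1≡ : b₁ + 1 ≡ 2 ^ m
    b₁+1≡ = trans (cong (_+ 1) (trans (sym (*-identityʳ b₁)) (cong (b₁ ^_) (sym y≡1)))) b₁^y+1≡
    β≡u : β ≡ u
    β≡u = trans (sym (*-identityʳ β)) (trans (cong (β *_) (sym y≡1)) (proj₁ b-split))
    byShape : z ≡ 1 ⊎ (c₁ ≡ 3 × z ≡ 2 × m ≡ 3) → ⊥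
    byShape (inj₂ (c₁≡3 , _ , m≡3)) = 1+2^f*7^y≢3^z f y₂ z₂ (proj₁ (proj₂ s₂))
      (trans (cong (λ w → 1 + 2 ^ f * w ^ y₂) (sym b₁≡7)) (trans (reduced f αx≡γz βy≡) (cong (_^ z₂) c₁≡3)))
      where
      b₁≡7 : b₁ ≡ 7
      b₁≡7 = +-cancelʳ-≡ 1 _ _ (trans b₁+1≡ (cong (2 ^_) m≡3))
    byShape (inj₁ z≡1) = 1+2^f*b^y≢[b+2]^z m f y₂ z₂ 1<m (proj₁ (proj₂ (proj₂ s₂))) z₂<y₂ b₁+1≡
      (trans (reduced f αx≡γz βy≡) (cong (_^ z₂) c₁≡))
      where
      γ≡u : γ ≡ u
      γ≡u = trans (sym (*-identityʳ γ)) (trans (cong (γ *_) (sym z≡1)) (proj₁ c-split))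
      c₁≡ : c₁ ≡ b₁ + 2
      c₁≡ = trans (sym (*-identityʳ c₁)) (trans (cong (c₁ ^_) (sym z≡1)) (trans (proj₂ c-split) (trans (cong (_+ 1) (sym b₁+1≡)) (+-assoc b₁ 1 1))))
      z₂<y₂ : z₂ < y₂
      z₂<y₂ = *-cancelˡ-< u z₂ y₂ (subst₂ _<_ (trans αx≡γz (cong (_* z₂) γ≡u)) (trans (sym βy≡) (cong (_* y₂) β≡u)) (m<m+n (α * x₂) 0<f))

  -- Now `b₁ = 1` and `c₁ = 3`, leaving `1 + 2^f = 3^z₂`. Its two solutions `3 = 1 + 2` and
  -- `9 = 1 + 8` reproduce the two members of the pair with the summands exchanged.
  small : m ≡ 1 → α * x₂ ≡ γ * z₂ → ∀ f → β * y₂ ≡ α * x₂ + f → 0 < f → CorrespondsToEither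
  small m≡1 αx≡γz f βy≡ 0<f = byShape (perfectPower≡2^+1 z m 0<z 0<m (proj₂ c-split))
    where
    b₁≡1 : b₁ ≡ 1
    b₁≡1 = ^≡1⇒≡1 b₁ y 0<y (trans (proj₂ b-split) (cong (λ w → 2 ^ w ∸ 1) m≡1))
    b^y≡2^u : b ^ y ≡ 2 ^ u
    b^y≡2^u = trans b^y≡ (trans (cong (λ w → 2 ^ u * (2 ^ w ∸ 1)) m≡1) (*-identityʳ (2 ^ u)))
    byShape : z ≡ 1 ⊎ (c₁ ≡ 3 × z ≡ 2 × m ≡ 3) → CorrespondsToEither
    byShape (inj₂ (_ , _ , m≡3)) = contradiction (trans (sym m≡1) m≡3) λ ()
    byShape (inj₁ z≡1) = finish (power-of-3≡2^+1 z₂ f (proj₁ (proj₂ (proj₂ s₂))) 0<f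
        (trans (cong (_^ z₂) (sym c₁≡3)) (trans (sym (reduced f αx≡γz βy≡)) (cong suc (trans (cong (2 ^ f *_) (trans (cong (_^ y₂) b₁≡1) (^-zeroˡ y₂))) (*-identityʳ (2 ^ f)))))))
      where
      c₁≡3 : c₁ ≡ 3
      c₁≡3 = trans (sym (*-identityʳ c₁)) (trans (cong (c₁ ^_) (sym z≡1)) (trans (proj₂ c-split) (cong (λ w → 2 ^ w + 1) m≡1)))
      γ≡u : γ ≡ u
      γ≡u = trans (sym (*-identityʳ γ)) (trans (cong (γ *_) (sym z≡1)) (proj₁ c-split))
      αx≡uz : α * x₂ ≡ u * z₂
      αx≡uz = trans αx≡γz (cong (_* z₂) γ≡u)
      a^x₂≡ : a ^ x₂ ≡ 2 ^ (u * z₂)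
      a^x₂≡ = trans (a^≡ x₂) (cong (2 ^_) αx≡uz)
      b^y₂≡ : b ^ y₂ ≡ 2 ^ (u * z₂ + f)
      b^y₂≡ = trans (^-split {2} {β} y₂ b≡) (trans (cong₂ (λ s t → 2 ^ s * t) (trans βy≡ (cong (_+ f) αx≡uz)) (trans (cong (_^ y₂) b₁≡1) (^-zeroˡ y₂))) (*-identityʳ _))
      finish : (z₂ ≡ 1 × f ≡ 1) ⊎ (z₂ ≡ 2 × f ≡ 3) → CorrespondsToEither
      finish (inj₁ (z₂≡1 , f≡1)) = inj₁ (inj₂ (trans a^x≡ (sym (trans b^y₂≡ (cong (2 ^_) (cong₂ _+_ uz≡u f≡1)))) , trans b^y≡2^u (sym (trans a^x₂≡ (cong (2 ^_) uz≡u)))))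
        where
        uz≡u : u * z₂ ≡ u
        uz≡u = trans (cong (u *_) z₂≡1) (*-identityʳ u)
      finish (inj₂ (z₂≡2 , f≡3)) = inj₂ (inj₂ (trans a^x′≡ (sym (trans b^y₂≡ (cong (2 ^_) exponent))) , trans b^y′≡ (sym (trans a^x₂≡ (cong (λ w → 2 ^ (u * w)) z₂≡2)))))
        where
        exponent : u * z₂ + f ≡ 2 * u + suc m + 1
        exponent = trans (cong₂ (λ s t → u * s + t) z₂≡2 f≡3) (trans (rearrange u) (cong (λ w → 2 * u + suc w + 1) (sym m≡1)))
          where
          rearrange : ∀ u → u * 2 + 3 ≡ 2 * u + 2 + 1
          rearrange = solve-∀
        b^y′≡ : b ^ y′ ≡ 2 ^ (u * 2)
        b^y′≡ = trans (sym (base-power b y 2 y′≡)) (trans (cong (_^ 2) b^y≡2^u) (^-*-assoc 2 u 2))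

  typeB-corresponds : α * x₂ < β * y₂ → α * x₂ ≡ γ * z₂ → CorrespondsToEither
  typeB-corresponds lt αx≡γz = decide (<⇒∃+ lt) (m ≟ 1)
    where
    decide : ∃[ f ] (0 < f × β * y₂ ≡ α * x₂ + f) → _ → CorrespondsToEither
    decide (f , 0<f , βy≡) (yes m≡1) = small m≡1 αx≡γz f βy≡ 0<f
    decide (f , 0<f , βy≡) (no m≢1) = ⊥-elim (large (≤∧≢⇒< 0<m (m≢1 ∘ sym)) αx≡γz f βy≡ 0<f)

module _ {p a b c x y z x′ y′ z′} (pp : Prime p) (p≢2 : p ≢ 2) (p∣a : p ∣ a) (V : Valuations p a b c)
  (S : ScaledSolution a b c x y z x′ y′ z′) where
  open Valuations V

  -- `a^x`, `b^y`, `c^z` are `G` times `D`, `B₀`, `B₀ + D`, and an odd prime of `a` divides none of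
  -- these cofactors; all three valuations are that of `G`.
  smaller-typeO : 0 < x → α * x ≡ β * y × α * x ≡ γ * z
  smaller-typeO 0<x = go S
    where
    go : ScaledSolution a b c x y z x′ y′ z′ → α * x ≡ β * y × α * x ≡ γ * z
    go (k , 1<k , _ , _ , St) = trans αx≡t (sym βy≡t) , trans αx≡t (sym γz≡t)
      where
      open DiffStructure St
      0<k : 0 < k
      0<k = <-trans (s≤s z≤n) 1<k
      fact = factorOut p G (1<prime pp) 0<G
      t = proj₁ fact
      G₁ = proj₁ (proj₂ fact)
      G≡ : G ≡ p ^ t * G₁
      G≡ = proj₁ (proj₂ (proj₂ fact))
      p∤G₁ : ¬ p ∣ G₁
      p∤G₁ = proj₂ (proj₂ (proj₂ fact))
      p∤D : ¬ p ∣ D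
      p∤D p∣D with D≡1∨2
      ... | inj₁ D≡1 = ∤1 pp (subst (p ∣_) D≡1 p∣D)
      ... | inj₂ D≡2 = p≢2 (prime∣2 pp (subst (p ∣_) D≡2 p∣D))
      exponent : ∀ i {n u v} → n ≡ p ^ i * u → ¬ p ∣ u → n ≡ G * v → ¬ p ∣ v → i ≡ t
      exponent i {n} {u} {v} n≡ p∤u n≡′ p∤v = proj₁ (factorOut-unique i t (1<prime pp) p∤u (∤-* pp p∤G₁ p∤v)
        (trans (sym n≡) (trans n≡′ (trans (cong (_* v) G≡) (*-assoc (p ^ t) G₁ v)))))
      αx≡t : α * x ≡ t
      αx≡t = exponent (α * x) (^-split {p} {α} x a≡) (∤-^ x pp p∤a₁) aˣ≡ p∤D
      βy≡t : β * y ≡ t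
      βy≡t = exponent (β * y) (^-split {p} {β} y b≡) (∤-^ y pp p∤b₁) B≡ (prime∣a⇒∤B₀ St 0<k pp p∣a)
      γz≡t : γ * z ≡ t
      γz≡t = exponent (γ * z) (^-split {p} {γ} z c≡) (∤-^ z pp p∤c₁) C≡ (prime∣a⇒∤C₀ St 0<k pp p∣a)

product≡1 : ∀ {m n} → m * n ≡ 1 → m ≡ 1 × n ≡ 1
product≡1 {m} {n} eq = m*n≡1⇒m≡1 m n eq , m*n≡1⇒n≡1 m n eq

power-value : ∀ {a x G e} k {x′} → a ^ x ≡ G → x′ ≡ k * x + e → a ^ x′ ≡ G ^ k * a ^ e
power-value {a} {x} {e = e} k refl refl = trans (^-distribˡ-+-* a (k * x) e) (cong (_* a ^ e) (sym (base-power a x k refl)))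

-- The two descriptions of a ^ x and b ^ y give S.D T.D = S.B₀ T.B₀, so a ^ x : b ^ y is 1 : 1, 1 : 2 or 2 : 1.
sharedSmaller : ∀ {p a b c x y z x₁ y₁ z₁ x₂ y₂ z₂} → Prime p → p ≢ 2 → p ∣ a → p ∣ b → 0 < x → 0 < y →
  ScaledSolution a b c x y z x₁ y₁ z₁ → ScaledSolution b a c y x z y₂ x₂ z₂ → Corr a b x₁ y₁ a b x₂ y₂
sharedSmaller {p} {a} {b} {c} {x} {y} {z} {x₁} {y₁} {z₁} {x₂} {y₂} {z₂} pp p≢2 p∣a p∣b 0<x 0<y
  (k , 1<k , y₁≡ , _ , S) (k′ , 1<k′ , x₂≡ , _ , T) = byCases S.D≡1∨2 T.D≡1∨2
  where
  module S = DiffStructure S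
  module T = DiffStructure T
  0<k : 0 < k
  0<k = <-trans (s≤s z≤n) 1<k
  0<k′ : 0 < k′
  0<k′ = <-trans (s≤s z≤n) 1<k′
  DD≡BB : S.D * T.D ≡ T.B₀ * S.B₀
  DD≡BB = *-cancelˡ (*-pos S.0<G T.0<G) (trans (left S.G T.G S.D T.D)
    (trans (cong₂ _*_ (trans (sym S.aˣ≡) T.B≡) (trans (sym T.aˣ≡) S.B≡)) (right T.G T.B₀ S.G S.B₀)))
    where
    left : ∀ G H D E → G * H * (D * E) ≡ G * D * (H * E)
    left = solve-∀
    right : ∀ H A G B → H * A * (G * B) ≡ G * H * (A * B)
    right = solve-∀
  product : ∀ {D E} → S.D ≡ D → T.D ≡ E → T.B₀ * S.B₀ ≡ D * E
  product D≡ E≡ = trans (sym DD≡BB) (cong₂ _*_ D≡ E≡)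
  p∤2 : ¬ p ∣ 2
  p∤2 h = p≢2 (prime∣2 pp h)
  oddDivisorOf2 : ∀ {m n} → m * n ≡ 2 → Odd m → m ≡ 1
  oddDivisorOf2 {m} {n} eq om with prime⇒irreducible prime[2] (subst (m ∣_) eq (m∣m*n n))
  ... | inj₁ m≡1 = m≡1
  ... | inj₂ refl = ⊥-elim (om ∣-refl)
  -- Both `B₀` are 1, so `a^x = b^y = G`, and `a^e + 1`, `b^e′ + 1` are the powers `2^k`, `2^k′`.
  -- Suitable powers of `a^e` and `b^e′` coincide, so `k = k′`, and the two larger solutions differ
  -- by exchanging the summands.
  equalShapes : S.D ≡ 1 → T.D ≡ 1 → Corr a b x₁ y₁ a b x₂ y₂
  equalShapes D≡1 E≡1 = inj₂ (trans a^x₁≡ (sym b^y₂≡) , trans b^y₁≡ (sym a^x₂≡))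
    where
    A₀≡1 : T.B₀ ≡ 1
    A₀≡1 = proj₁ (product≡1 {T.B₀} {S.B₀} (product D≡1 E≡1))
    B₀≡1 : S.B₀ ≡ 1
    B₀≡1 = proj₂ (product≡1 {T.B₀} {S.B₀} (product D≡1 E≡1))
    a^x≡G : a ^ x ≡ S.G
    a^x≡G = trans S.aˣ≡ (trans (cong (S.G *_) D≡1) (*-identityʳ S.G))
    b^y≡G : b ^ y ≡ S.G
    b^y≡G = trans S.B≡ (trans (cong (S.G *_) B₀≡1) (*-identityʳ S.G))
    mersenne : ∀ {n m f D B} → (B + D) ^ n ≡ B ^ n + D ^ n * m ^ f → D ≡ 1 → B ≡ 1 → m ^ f + 1 ≡ 2 ^ n
    mersenne {n} {m} {f} pow refl refl = trans (+-comm (m ^ f) 1) (sym (trans pow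
      (trans (cong₂ (λ s t → s + t * m ^ f) (^-zeroˡ n) (^-zeroˡ n)) (cong suc (*-identityˡ (m ^ f))))))
    ma : a ^ S.e + 1 ≡ 2 ^ k
    ma = mersenne {k} {a} {S.e} S.power D≡1 B₀≡1
    mb : b ^ T.e + 1 ≡ 2 ^ k′
    mb = mersenne {k′} {b} {T.e} T.power E≡1 A₀≡1
    shared : (a ^ S.e) ^ (x * T.e) ≡ (b ^ T.e) ^ (y * S.e)
    shared = begin
      (a ^ S.e) ^ (x * T.e)        ≡⟨ sym (^-*-assoc (a ^ S.e) x T.e) ⟩
      ((a ^ S.e) ^ x) ^ T.e        ≡⟨ cong (_^ T.e) (^-^-comm a S.e x) ⟩
      ((a ^ x) ^ S.e) ^ T.e        ≡⟨ cong (λ w → (w ^ S.e) ^ T.e) (trans a^x≡G (sym b^y≡G)) ⟩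
      ((b ^ y) ^ S.e) ^ T.e        ≡⟨ ^-^-comm (b ^ y) S.e T.e ⟩
      ((b ^ y) ^ T.e) ^ S.e        ≡⟨ cong (_^ S.e) (^-^-comm b y T.e) ⟩
      ((b ^ T.e) ^ y) ^ S.e        ≡⟨ ^-*-assoc (b ^ T.e) y S.e ⟩
      (b ^ T.e) ^ (y * S.e)        ∎
      where open ≡-Reasoning
    k≡k′ : k ≡ k′
    k≡k′ = mersenne-powers k k′ (x * T.e) (y * S.e) 1<k 1<k′ (*-pos {x} {T.e} 0<x T.0<e) ma mb shared
    a^e≡b^e : a ^ S.e ≡ b ^ T.e
    a^e≡b^e = +-cancelʳ-≡ 1 _ _ (trans ma (trans (cong (2 ^_) k≡k′) (sym mb)))
    a^x₁≡ : a ^ x₁ ≡ S.G ^ k * a ^ S.e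
    a^x₁≡ = power-value {a} {x} {e = S.e} k a^x≡G S.x₂≡
    b^y₂≡ : b ^ y₂ ≡ S.G ^ k * a ^ S.e
    b^y₂≡ = trans (power-value {b} {y} {e = T.e} k′ b^y≡G T.x₂≡) (cong₂ (λ s t → S.G ^ s * t) (sym k≡k′) (sym a^e≡b^e))
    b^y₁≡ : b ^ y₁ ≡ S.G ^ k
    b^y₁≡ = trans (sym (base-power b y k y₁≡)) (cong (_^ k) b^y≡G)
    a^x₂≡ : a ^ x₂ ≡ S.G ^ k
    a^x₂≡ = trans (sym (base-power a x k′ x₂≡)) (cong₂ _^_ a^x≡G (sym k≡k′))
  byCases : S.D ≡ 1 ⊎ S.D ≡ 2 → T.D ≡ 1 ⊎ T.D ≡ 2 → Corr a b x₁ y₁ a b x₂ y₂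
  byCases (inj₁ D≡1) (inj₁ E≡1) = equalShapes D≡1 E≡1
  -- Ratios 1 : 2 and 2 : 1 make the odd `B₀` equal to 1, so one base has a power equal to 2,
  -- contrary to its odd prime `p`. In the last case two odd numbers would have product 4.
  byCases (inj₁ D≡1) (inj₂ E≡2) = ⊥-elim (p∤2 (subst (p ∣_) (B₀≡1⇒aᵉ≡2 T 1<k′ E≡2
      (oddDivisorOf2 {T.B₀} {S.B₀} (product D≡1 E≡2) (Even.2∤B₀ T 0<k′ E≡2))) (∣-self^ T.e T.0<e p∣b)))
  byCases (inj₂ D≡2) (inj₁ E≡1) = ⊥-elim (p∤2 (subst (p ∣_) (B₀≡1⇒aᵉ≡2 S 1<k D≡2
      (oddDivisorOf2 {S.B₀} {T.B₀} (trans (*-comm S.B₀ T.B₀) (product D≡2 E≡1)) (Even.2∤B₀ S 0<k D≡2))) (∣-self^ S.e S.0<e p∣a)))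
  byCases (inj₂ D≡2) (inj₂ E≡2) = ⊥-elim (∤-* prime[2] (Even.2∤B₀ T 0<k′ E≡2) (Even.2∤B₀ S 0<k D≡2)
      (subst (2 ∣_) (sym (product D≡2 E≡2)) (divides 2 refl)))

Corr-trans : ∀ A B X Y a b x y x′ y′ → Corr A B X Y a b x y → Corr a b x y a b x′ y′ → Corr A B X Y a b x′ y′
Corr-trans _ _ _ _ _ _ _ _ _ _ (inj₁ (p , q)) (inj₁ (r , s)) = inj₁ (trans p r , trans q s)
Corr-trans _ _ _ _ _ _ _ _ _ _ (inj₁ (p , q)) (inj₂ (r , s)) = inj₂ (trans p r , trans q s)
Corr-trans _ _ _ _ _ _ _ _ _ _ (inj₂ (p , q)) (inj₁ (r , s)) = inj₂ (trans p s , trans q r)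
Corr-trans _ _ _ _ _ _ _ _ _ _ (inj₂ (p , q)) (inj₂ (r , s)) = inj₁ (trans p s , trans q r)

-- The valuation argument needs an odd common prime; `powerOf2` records the family (i) data
-- available when the pair provides none.
data OddPrimeOrPowerOf2 (a b c x y x′ y′ z : ℕ) : Set where
  oddPrime  : ∀ p → Prime p → p ≢ 2 → p ∣ a → p ∣ b → OddPrimeOrPowerOf2 a b c x y x′ y′ z
  powerOf2  : ∀ u m → IsPowerOf2 a → 2 ∣ a → 2 ∣ b → 0 < u → 0 < m → b ^ y ≡ 2 ^ u * (2 ^ m ∸ 1) → c ^ z ≡ 2 ^ u * (2 ^ m + 1) →
    a ^ x ≡ 2 ^ (u + 1) → a ^ x′ ≡ 2 ^ (2 * u + suc m + 1) → y′ ≡ 2 * y → OddPrimeOrPowerOf2 a b c x y x′ y′ z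

-- For `D = 1` the number `a` is odd, so any common prime is odd. For `D = 2` an odd prime of `a`
-- divides `G`, because `a^x = 2 G`, and therefore also `b^y`.
oddPrimeOrPowerOf2 : ∀ {a b c x y z x′ y′ z′} → 1 < a → 1 < gcd a b → 0 < x → 0 < y →
  ScaledSolution a b c x y z x′ y′ z′ → OddPrimeOrPowerOf2 a b c x y x′ y′ z
oddPrimeOrPowerOf2 {a} {b} {c} {x} {y} {z} {x′} {y′} 1<a 1<gcd 0<x 0<y (k , 1<k , y′≡ , _ , St) = byD D≡1∨2
  where
  open DiffStructure St
  0<k : 0 < k
  0<k = <-trans (s≤s z≤n) 1<k
  byD : D ≡ 1 ⊎ D ≡ 2 → OddPrimeOrPowerOf2 a b c x y x′ y′ z
  byD (inj₁ D≡1) = let p , pp , p∣a , p∣b = gcd>1⇒commonPrime {a} {b} 1<gcd in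
    oddPrime p pp (λ p≡2 → D≡1⇒odd St 0<k D≡1 (subst (_∣ a) p≡2 p∣a)) p∣a p∣b
  byD (inj₂ D≡2) = byOddPart (factorOut 2 a (s≤s (s≤s z≤n)) (<-trans (s≤s z≤n) 1<a))
    where
    byOddPart : ∃[ i ] ∃[ A ] (a ≡ 2 ^ i * A × Odd A) → OddPrimeOrPowerOf2 a b c x y x′ y′ z
    byOddPart (i , A , a≡ , oA) with A ≟ 1
    ... | yes A≡1 =
          let a≡2^i = oddPart≡1 {i = i} a≡ A≡1
              2∣b = commonPrime-powerOf2 {a} {b} {i} 1<gcd a≡2^i
              k≡2 , u , m , 0<u , 0<m , b≡ , c≡ , aˣ≡′ , aˣ′≡ = powerOf2-values St i 0<x 1<k D≡2 a≡2^i (∣-self^ y 0<y 2∣b)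
          in powerOf2 u m (i , a≡2^i) (Even.2∣a St 0<k D≡2) 2∣b 0<u 0<m b≡ c≡ aˣ≡′ aˣ′≡ (trans y′≡ (cong (_* y) k≡2))
    ... | no A≢1 =
          let q , pq , q∣A = primeDivisor {A} (≤∧≢⇒< (n≢0⇒n>0 λ { refl → oA (2 ∣0) }) (A≢1 ∘ sym))
              q≢2 = λ q≡2 → oA (subst (_∣ A) q≡2 q∣A)
              q∣a = subst (q ∣_) (sym a≡) (∣n⇒∣m*n (2 ^ i) q∣A)
          in oddPrime q pq q≢2 q∣a (prime∣^ y pq (subst (q ∣_) (sym B≡) (∣m⇒∣m*n B₀
               (case euclidsLemma G D pq (subst (q ∣_) aˣ≡ (∣-self^ x 0<x q∣a)) of λ
                 { (inj₁ h) → h ; (inj₂ h) → ⊥-elim (q≢2 (prime∣2 pq (subst (q ∣_) D≡2 h))) }))))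

FamilyPair-F₁ : ∀ {a b c x y x′ y′ z} u m → 0 < u → 0 < m → b ^ y ≡ 2 ^ u * (2 ^ m ∸ 1) → c ^ z ≡ 2 ^ u * (2 ^ m + 1) →
  a ^ x ≡ 2 ^ (u + 1) → a ^ x′ ≡ 2 ^ (2 * u + suc m + 1) → y′ ≡ 2 * y → ∀ x₁ y₁ x₂ y₂ →
  Corr a b x y a b x₁ y₁ → Corr a b x′ y′ a b x₂ y₂ → FamilyPair F₁ a b x₁ y₁ x₂ y₂
FamilyPair-F₁ {a} {b} {c} {x} {y} {x′} {y′} {z} u m 0<u 0<m b≡ c≡ a≡ a≡′ y′≡ x₁ y₁ x₂ y₂ corr₁ corr₂
  with F₁-pair {a} {b} {c} {x} {y} {z} {x′} {y′} u m 0<u 0<m b≡ c≡ a≡ a≡′ y′≡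
... | A , B , C , X₁ , Y₁ , Z₁ , X₂ , Y₂ , Z₂ , f , d₁ , d₂ = A , B , C , X₁ , Y₁ , Z₁ , X₂ , Y₂ , Z₂ , f ,
      Corr-trans A B X₁ Y₁ a b x y x₁ y₁ d₁ corr₁ , Corr-trans A B X₂ Y₂ a b x′ y′ x₂ y₂ d₂ corr₂

Corr-refl : ∀ a b x y → Corr a b x y a b x y
Corr-refl _ _ _ _ = inj₁ (refl , refl)

module Third {a b c x₁ y₁ z₁ x₂ y₂ z₂ x₃ y₃ z₃} (H : Setup a b c x₁ y₁ z₁ x₂ y₂ z₂)
  (oriented : Oriented a b c x₁ y₁ z₁ x₂ y₂ z₂) (s₃ : Sol a b c x₃ y₃ z₃) where
  open Setup H
  0<x₁ : 0 < x₁
  0<x₁ = proj₁ sol₁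
  0<x₃ : 0 < x₃
  0<x₃ = proj₁ s₃
  0<y₁ : 0 < y₁
  0<y₁ = proj₁ (proj₂ sol₁)
  0<y₃ : 0 < y₃
  0<y₃ = proj₁ (proj₂ s₃)

  val : ∀ {p} → Prime p → Valuations p a b c
  val pp = valuations pp 0<a 0<b 0<c

  typeB₂ : ∀ {p} (pp : Prime p) → p ∣ a → p ∣ b → let open Valuations (val pp) in α * x₂ < β * y₂ × α * x₂ ≡ γ * z₂
  typeB₂ pp p∣a p∣b = proj₂ (oriented _ pp p∣a p∣b (val pp))

  -- At an odd common prime a smaller solution satisfies both Type equalities, so it shares a ratio with the Type B solution as well.
  oddPrime-smaller₃ : ∀ {p} → Prime p → p ≢ 2 → p ∣ a → p ∣ b → ScaledSolution a b c x₃ y₃ z₃ x₁ y₁ z₁ → ⊥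
  oddPrime-smaller₃ {p} pp p≢2 p∣a p∣b S = go (sameRatio {b} {a} {c} {y₂} {x₂} {z₂} {y₃} {x₃} {z₃} 1<b 1<a 1<c
      (Sol-swap {a} {b} {c} {x₂} {y₂} {z₂} sol₂) (Sol-swap {a} {b} {c} {x₃} {y₃} {z₃} s₃)
      (cross-≡ x₂ z₂ x₃ z₃ 0<α 0<γ (proj₂ B₂) (proj₂ O₃)))
    where
    open Types pp p∣a p∣b (commonPrime∣c {p} {a} {b} {c} {x₁} {y₁} {z₁} pp sol₁ p∣a p∣b) (val pp)
    B₂ : α * x₂ < β * y₂ × α * x₂ ≡ γ * z₂
    B₂ = typeB₂ pp p∣a p∣b
    O₃ : α * x₃ ≡ β * y₃ × α * x₃ ≡ γ * z₃
    O₃ = smaller-typeO pp p≢2 p∣a (val pp) S 0<x₃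
    go : _ → ⊥
    go (inj₁ (y₃≡ , x₃≡ , _)) = <⇒≢ (proj₁ B₂) (trans (cong (α *_) (sym x₃≡)) (trans (proj₁ O₃) (cong (β *_) y₃≡)))
    go (inj₂ (inj₁ T)) = <⇒≢ (proj₁ B₂) (sym (proj₁ (smaller-typeO pp p≢2 p∣b (Valuations-swap (val pp)) T (proj₁ (proj₂ sol₂)))))
    go (inj₂ (inj₂ T)) = notCorr (sharedSmaller {p} {a} {b} {c} {x₃} {y₃} {z₃} {x₁} {y₁} {z₁} {x₂} {y₂} {z₂} pp p≢2 p∣a p∣b 0<x₃ 0<y₃ S T)

  -- In the power-of-2 case the second solution corresponds to a member of the pair: to the first
  -- solution, which is excluded directly, or to the third, which would put the two given solutions
  -- in family (i).
  smaller₃-impossible : ScaledSolution a b c x₃ y₃ z₃ x₁ y₁ z₁ → ⊥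
  smaller₃-impossible S = go (oddPrimeOrPowerOf2 {a} {b} {c} {x₃} {y₃} {z₃} {x₁} {y₁} {z₁} 1<a 1<gcd 0<x₃ 0<y₃ S)
    where
    go : OddPrimeOrPowerOf2 a b c x₃ y₃ x₁ y₁ z₃ → ⊥
    go (oddPrime p pp p≢2 p∣a p∣b) = oddPrime-smaller₃ pp p≢2 p∣a p∣b S
    go (powerOf2 u m pa 2∣a 2∣b 0<u 0<m b≡ c≡ a≡ a≡′ y≡) = corr (let lt , eq = typeB₂ prime[2] 2∣a 2∣b in
        PowerOf2Third.typeB-corresponds {a} {b} {c} {x₃} {y₃} {z₃} {x₁} {y₁} {u} {m} {x₂} {y₂} {z₂} (val prime[2]) pa 0<u 0<m b≡ c≡ a≡ a≡′ y≡
          0<y₃ (proj₁ (proj₂ (proj₂ s₃))) sol₂ lt eq)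
      where
      corr : Corr a b x₃ y₃ a b x₂ y₂ ⊎ Corr a b x₁ y₁ a b x₂ y₂ → ⊥
      corr (inj₁ c₃₂) = notExc₂₁ (inj₁ (FamilyPair-F₁ {a} {b} {c} {x₃} {y₃} {x₁} {y₁} {z₃} u m 0<u 0<m b≡ c≡ a≡ a≡′ y≡ x₂ y₂ x₁ y₁ c₃₂ (Corr-refl a b x₁ y₁)))
      corr (inj₂ c₁₂) = notCorr c₁₂

  -- At an odd common prime the first solution would be a threefold tie, while Type A is strict.
  smaller₁-impossible : ScaledSolution a b c x₁ y₁ z₁ x₃ y₃ z₃ → ⊥
  smaller₁-impossible S = go (oddPrimeOrPowerOf2 {a} {b} {c} {x₁} {y₁} {z₁} {x₃} {y₃} {z₃} 1<a 1<gcd 0<x₁ 0<y₁ S)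
    where
    go : OddPrimeOrPowerOf2 a b c x₁ y₁ x₃ y₃ z₁ → ⊥
    go (oddPrime p pp p≢2 p∣a p∣b) = <⇒≢ (proj₁ (proj₁ (oriented p pp p∣a p∣b (val pp)))) (sym (proj₁ (smaller-typeO pp p≢2 p∣a (val pp) S 0<x₁)))
    go (powerOf2 u m pa 2∣a 2∣b 0<u 0<m b≡ c≡ a≡ a≡′ y≡) = corr (let lt , eq = typeB₂ prime[2] 2∣a 2∣b in
        PowerOf2Third.typeB-corresponds {a} {b} {c} {x₁} {y₁} {z₁} {x₃} {y₃} {u} {m} {x₂} {y₂} {z₂} (val prime[2]) pa 0<u 0<m b≡ c≡ a≡ a≡′ y≡
          0<y₁ (proj₁ (proj₂ (proj₂ sol₁))) sol₂ lt eq)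
      where
      corr : Corr a b x₁ y₁ a b x₂ y₂ ⊎ Corr a b x₃ y₃ a b x₂ y₂ → ⊥
      corr (inj₁ c₁₂) = notCorr c₁₂
      corr (inj₂ c₃₂) = notExc₁₂ (inj₁ (FamilyPair-F₁ {a} {b} {c} {x₁} {y₁} {x₃} {y₃} {z₁} u m 0<u 0<m b≡ c≡ a≡ a≡′ y≡ x₁ y₁ x₂ y₂ (Corr-refl a b x₁ y₁) c₃₂))

  ratioA⇒equal : y₁ * z₃ ≡ y₃ * z₁ → x₃ ≡ x₁ × y₃ ≡ y₁ × z₃ ≡ z₁
  ratioA⇒equal ratio = go (sameRatio {a} {b} {c} {x₁} {y₁} {z₁} {x₃} {y₃} {z₃} 1<a 1<b 1<c sol₁ s₃ ratio)
    where
    go : _ → x₃ ≡ x₁ × y₃ ≡ y₁ × z₃ ≡ z₁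
    go (inj₁ eq) = eq
    go (inj₂ (inj₁ S)) = ⊥-elim (smaller₁-impossible S)
    go (inj₂ (inj₂ S)) = ⊥-elim (smaller₃-impossible S)

Oriented-swap : ∀ {a b c x₁ y₁ z₁ x₂ y₂ z₂} → Oriented a b c x₁ y₁ z₁ x₂ y₂ z₂ → Oriented b a c y₂ x₂ z₂ y₁ x₁ z₁
Oriented-swap o p pp p∣b p∣a V = let A , B = o p pp p∣a p∣b (Valuations-swap V) in B , A

-- One common prime suffices to attach the new solution to one of the two by an exponent ratio. A
-- threefold tie is treated like Type A; Type B becomes Type A after exchanging the bases together
-- with the order of the solutions.
onlyTwo : ∀ {a b c x₁ y₁ z₁ x₂ y₂ z₂} → Setup a b c x₁ y₁ z₁ x₂ y₂ z₂ → Oriented a b c x₁ y₁ z₁ x₂ y₂ z₂ → ∀ x y z → Sol a b c x y z →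
  (x ≡ x₁ × y ≡ y₁ × z ≡ z₁) ⊎ (x ≡ x₂ × y ≡ y₂ × z ≡ z₂)
onlyTwo {a} {b} {c} {x₁} {y₁} {z₁} {x₂} {y₂} {z₂} H oriented x y z s = start (gcd>1⇒commonPrime {a} {b} 1<gcd)
  where
  open Setup H
  start : ∃[ p ] (Prime p × p ∣ a × p ∣ b) → (x ≡ x₁ × y ≡ y₁ × z ≡ z₁) ⊎ (x ≡ x₂ × y ≡ y₂ × z ≡ z₂)
  start (p , pp , p∣a , p∣b) = go (classify {x} {y} {z} s)
    where
    open Types pp p∣a p∣b (commonPrime∣c {p} {a} {b} {c} {x₁} {y₁} {z₁} pp sol₁ p∣a p∣b) (valuations pp 0<a 0<b 0<c)
    A₁ : TypeA x₁ y₁ z₁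
    A₁ = proj₁ (oriented p pp p∣a p∣b (valuations pp 0<a 0<b 0<c))
    B₂ : TypeB x₂ y₂ z₂
    B₂ = proj₂ (oriented p pp p∣a p∣b (valuations pp 0<a 0<b 0<c))
    isFirst : β * y ≡ γ * z → x ≡ x₁ × y ≡ y₁ × z ≡ z₁
    isFirst e = Third.ratioA⇒equal H oriented s (cross-≡ y₁ z₁ y z 0<β 0<γ (proj₂ A₁) e)
    isSecond : α * x ≡ γ * z → x ≡ x₂ × y ≡ y₂ × z ≡ z₂
    isSecond e = let y≡ , x≡ , z≡ = Third.ratioA⇒equal (swapBases (swapOrder H)) (Oriented-swap oriented)
                       (Sol-swap {a} {b} {c} {x} {y} {z} s) (cross-≡ x₂ z₂ x z 0<α 0<γ (proj₂ B₂) e)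
                 in x≡ , y≡ , z≡
    go : TypeA x y z ⊎ TypeB x y z ⊎ TypeC x y z ⊎ TypeO x y z → (x ≡ x₁ × y ≡ y₁ × z ≡ z₁) ⊎ (x ≡ x₂ × y ≡ y₂ × z ≡ z₂)
    go (inj₁ (_ , e)) = inj₁ (isFirst e)
    go (inj₂ (inj₁ (_ , e))) = inj₂ (isSecond e)
    go (inj₂ (inj₂ (inj₁ C))) = ⊥-elim (TypeA-TypeC-incompatible {x₁} {y₁} {z₁} {x} {y} {z} 0<c 0<a 0<b sol₁ A₁ s C)
    go (inj₂ (inj₂ (inj₂ (o , o′)))) = inj₁ (isFirst (trans (sym o) o′))

-- Assembling the conclusion

InFamily-pair₁₂ : ∀ F a b c x₁ y₁ z₁ x₂ y₂ z₂ → FamilyPair F a b x₁ y₁ x₂ y₂ → InFamily F a b c x₁ y₁ z₁ x₂ y₂ z₂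
InFamily-pair₁₂ F a b c x₁ y₁ z₁ x₂ y₂ z₂ (A , B , C , X₁ , Y₁ , Z₁ , X₂ , Y₂ , Z₂ , f , c₁ , c₂) =
  A , B , C , X₁ , Y₁ , Z₁ , X₂ , Y₂ , Z₂ , f , inj₁ c₁ , inj₂ c₂

InFamily-pair₂₁ : ∀ F a b c x₁ y₁ z₁ x₂ y₂ z₂ → FamilyPair F a b x₂ y₂ x₁ y₁ → InFamily F a b c x₁ y₁ z₁ x₂ y₂ z₂
InFamily-pair₂₁ F a b c x₁ y₁ z₁ x₂ y₂ z₂ (A , B , C , X₁ , Y₁ , Z₁ , X₂ , Y₂ , Z₂ , f , c₁ , c₂) =
  A , B , C , X₁ , Y₁ , Z₁ , X₂ , Y₂ , Z₂ , f , inj₂ c₁ , inj₁ c₂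

attach : ∀ {a b c g} {P : Set} → CommonFactorisation a b c g → P →
  ∃[ αg ] ∃[ βg ] ∃[ γg ] ∃[ a₁ ] ∃[ b₁ ] ∃[ c₁ ]
    (0 < g) × (0 < αg) × (0 < βg) × (0 < γg) × (0 < a₁) × (0 < b₁) × (0 < c₁) ×
    (a ≡ g ^ αg * a₁) × (b ≡ g ^ βg * b₁) × (c ≡ g ^ γg * c₁) ×
    (gcd g (a₁ * b₁ * c₁) ≡ 1) × (gcd a₁ b₁ ≡ 1) × P
attach (αg , βg , γg , a₁ , b₁ , c₁ , 0<g , 0<αg , 0<βg , 0<γg , 0<a₁ , 0<b₁ , 0<c₁ , a≡ , b≡ , c≡ , cop , cop′) p =
  αg , βg , γg , a₁ , b₁ , c₁ , 0<g , 0<αg , 0<βg , 0<γg , 0<a₁ , 0<b₁ , 0<c₁ , a≡ , b≡ , c≡ , cop , cop′ , p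

theorem4p5 : (a b c x₁ y₁ z₁ x₂ y₂ z₂ : ℕ) →
  1 < a → 1 < b → 1 < c → 1 < gcd a b →
  ¬ (IsPowerOf2 a × IsPowerOf2 b × IsPowerOf2 c) →
  Sol a b c x₁ y₁ z₁ → Sol a b c x₂ y₂ z₂ →
  ¬ Corr a b x₁ y₁ a b x₂ y₂ →
  ¬ InFamily F₁ a b c x₁ y₁ z₁ x₂ y₂ z₂ →
  ¬ InFamily F₂ a b c x₁ y₁ z₁ x₂ y₂ z₂ →
  ¬ InFamily F₃ a b c x₁ y₁ z₁ x₂ y₂ z₂ →
  ¬ InFamily F₄ a b c x₁ y₁ z₁ x₂ y₂ z₂ →
  ∃[ g ] ∃[ αg ] ∃[ βg ] ∃[ γg ] ∃[ a₁ ] ∃[ b₁ ] ∃[ c₁ ]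
    (0 < g) × (0 < αg) × (0 < βg) × (0 < γg) × (0 < a₁) × (0 < b₁) × (0 < c₁) ×
    (a ≡ g ^ αg * a₁) × (b ≡ g ^ βg * b₁) × (c ≡ g ^ γg * c₁) ×
    (gcd g (a₁ * b₁ * c₁) ≡ 1) × (gcd a₁ b₁ ≡ 1) ×
    ((TypeAg g a b c x₁ y₁ z₁ × TypeBg g a b c x₂ y₂ z₂) ⊎
     (TypeBg g a b c x₁ y₁ z₁ × TypeAg g a b c x₂ y₂ z₂)) ×
    (∀ x y z → Sol a b c x y z →
      ((x ≡ x₁) × (y ≡ y₁) × (z ≡ z₁)) ⊎ ((x ≡ x₂) × (y ≡ y₂) × (z ≡ z₂)))
theorem4p5 a b c x₁ y₁ z₁ x₂ y₂ z₂ 1<a 1<b 1<c 1<gcd notPow2 s₁ s₂ notCorr n₁ n₂ n₃ n₄ = assemble (orientation H)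
  where
  notExceptional : ∀ {x y x′ y′} → (∀ F → FamilyPair F a b x y x′ y′ → InFamily F a b c x₁ y₁ z₁ x₂ y₂ z₂) → ¬ Exceptional a b x y x′ y′
  notExceptional family (inj₁ f) = n₁ (family F₁ f)
  notExceptional family (inj₂ (inj₁ f)) = n₂ (family F₂ f)
  notExceptional family (inj₂ (inj₂ (inj₁ f))) = n₃ (family F₃ f)
  notExceptional family (inj₂ (inj₂ (inj₂ f))) = n₄ (family F₄ f)
  H : Setup a b c x₁ y₁ z₁ x₂ y₂ z₂
  H = record { 1<a = 1<a ; 1<b = 1<b ; 1<c = 1<c ; 1<gcd = 1<gcd ; notPow2 = notPow2 ; sol₁ = s₁ ; sol₂ = s₂ ; notCorr = notCorr
    ; notExc₁₂ = notExceptional {x₁} {y₁} {x₂} {y₂} (λ F → InFamily-pair₁₂ F a b c x₁ y₁ z₁ x₂ y₂ z₂)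
    ; notExc₂₁ = notExceptional {x₂} {y₂} {x₁} {y₁} (λ F → InFamily-pair₂₁ F a b c x₁ y₁ z₁ x₂ y₂ z₂) }
  assemble : Oriented a b c x₁ y₁ z₁ x₂ y₂ z₂ ⊎ Oriented a b c x₂ y₂ z₂ x₁ y₁ z₁ → _
  assemble (inj₁ o) = forward (commonFactorisation H o)
    where
    forward : ∃[ g ] (CommonFactorisation a b c g × TypeAg g a b c x₁ y₁ z₁ × TypeBg g a b c x₂ y₂ z₂) → _
    forward (g , F , A , B) = g , attach F (inj₁ (A , B) , onlyTwo H o)
  assemble (inj₂ o) = backward (commonFactorisation (swapOrder H) o)
    where
    backward : ∃[ g ] (CommonFactorisation a b c g × TypeAg g a b c x₂ y₂ z₂ × TypeBg g a b c x₁ y₁ z₁) → _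
    backward (g , F , A , B) = g , attach F (inj₂ (B , A) , λ x y z s → swap-⊎ (onlyTwo (swapOrder H) o x y z s))
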